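{- Let $N$ be an even positive integer and $p<q$ relatively prime positive integers. Write $\frac qp=a_1+\cfrac{1}{a_2+\cdots+\cfrac{1}{a_n}}$ with integers $a_k\ge1$, set $(p_0,q_0)=(0,1)$ and for $1\le k\le n$ let $q_k/p_k$ (coprime, positive) be the truncation $a_1+\cfrac{1}{a_2+\cdots+\cfrac1{a_k}}$. Then $$N!\,\beta_N r_N\,\mathrm{Td}^N_{pq}(x,y)-\alpha_Nr_N(x+py)^{N-1}x-\alpha_Nr_N\big((-1)^{n-1}q_{n-1}x+y\big)^{N-1}y\in q\,\mathbb Z[x,y].$$
   Context: $\mathrm{Td}_{pq}$ is the Todd series of the lattice cone generated by $v_1=(1,0)$, $v_2=(p,q)$: with $\Gamma=\mathbb Z^2/(\mathbb Zv_1+\mathbb Zv_2)$, writing $g=a_1(g)v_1+a_2(g)v_2$ with rational $a_i(g)$ and $\chi_i(\gamma)=\exp(2\pi i\,a_i(g))$, $\mathrm{Td}_{pq}(x,y)=\sum_{\gamma\in\Gamma}\frac{x}{1-\chi_1(\gamma)e^{ -x}}\frac{y}{1-\chi_2(\gamma)e^{ -y}}$ as a power series at $0$ (rational coefficients); $\mathrm{Td}^N_{pq}$ is its homogeneous part of degree $N$. Bernoulli numbers: $\frac{z}{e^z-1}=\sum_k\frac{B_k}{k!}z^k$. $B_N=\alpha_N/\beta_N$ in lowest terms, $\beta_N>0$. $r_N$ is the lcm of the denominators of $\beta_N\binom{N}{i+1}B_{i+1}B_{N-i-1}$ over odd $i$ with $0\le i\le N-2$ (empty lcm $=1$). -}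

module Defs where

open import Level using (Level)
open import Algebra.Bundles using (CommutativeRing)
open import Data.Nat as ℕ using (ℕ; zero; suc)
open import Data.Nat.Combinatorics using (_C_)
open import Data.Nat using (_!)
open import Data.Nat.Properties using (_!≢0)
open import Data.Product using (_×_)
import Data.Nat.Properties
open import Data.Nat.LCM using (lcm)
open import Data.Integer as ℤ using (ℤ; +_; -[1+_])
open import Data.Integer.DivMod using (_%ℕ_)
open import Data.Rational as ℚ using (ℚ; ↥_; ↧ₙ_; 0ℚ; 1/_)
open import Data.Rational.Properties as ℚP using ()
open import Data.List using (List; []; _∷_; take; length)
open import Relation.Nullary using (¬_; yes; no)
open import Relation.Binary.PropositionalEquality using (_≡_)

ℚfromℕ : ℕ → ℚ
ℚfromℕ n = + n ℚ./ 1

ℚfromℤ : ℤ → ℚ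
ℚfromℤ z = z ℚ./ 1

-- reciprocal (junk value 0 at 0)
recip : ℚ → ℚ
recip r with r ℚP.≟ 0ℚ
... | yes _ = 0ℚ
... | no r≢0 = 1/_ r {{ℚ.≢-nonZero r≢0}}

signℤ : ℕ → ℤ
signℤ zero = + 1
signℤ (suc k) = ℤ.- signℤ k

-- Bernoulli numbers, convention z/(e^z-1) = Σ B_k z^k/k!  (B_1 = -1/2),
-- via the recurrence equivalent to the generating function:
-- B_0 = 1,  B_m = -(1/(m+1)) Σ_{k<m} C(m+1,k) B_k.
-- bernRev n = [B_n, B_{n-1}, ..., B_0]

private
  -- Σ_{k<length bs} C(m+1,k) B_k, with bs = [B_{j}, ..., B_0] listed downward
  bsum : ℕ → List ℚ → ℚ
  bsum m [] = 0ℚ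
  bsum m (b ∷ bs) = ℚfromℕ (suc m C length bs) ℚ.* b ℚ.+ bsum m bs

bernRev : ℕ → List ℚ
bernRev zero = ℚfromℕ 1 ∷ []
bernRev (suc m) =
  let bs = bernRev m in
  (ℚ.- ((+ 1 ℚ./ suc (suc m)) ℚ.* bsum (suc m) bs)) ∷ bs

bernoulli : ℕ → ℚ
bernoulli n with bernRev n
... | [] = 0ℚ
... | b ∷ _ = b

αB : ℕ → ℤ
αB N = ↥ (bernoulli N)

βB : ℕ → ℕ
βB N = ↧ₙ (bernoulli N)

rTerm : ℕ → ℕ → ℕ
rTerm N i = ↧ₙ (ℚfromℕ (βB N) ℚ.* ℚfromℕ (N C suc i)
                 ℚ.* bernoulli (suc i) ℚ.* bernoulli (N ℕ.∸ suc i))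

isOdd : ℕ → ℕ → ℕ
isOdd zero x = 1
isOdd (suc zero) x = x
isOdd (suc (suc i)) x = isOdd i x

rUpTo : ℕ → ℕ → ℕ
rUpTo N zero = 1
rUpTo N (suc k) = lcm (rUpTo N k) (isOdd k (rTerm N k))

rN : ℕ → ℕ
rN N = rUpTo N (N ℕ.∸ 1)

cf : List ℕ → ℚ
cf [] = 0ℚ
cf (a ∷ []) = ℚfromℕ a
cf (a ∷ b ∷ rest) = ℚfromℕ a ℚ.+ recip (cf (b ∷ rest))

cfNum : List ℕ → ℕ → ℤ
cfNum as zero = + 1
cfNum as (suc k) = ↥ (cf (take (suc k) as))

-- Homogeneous bivariate integer polynomials of a given degree d,
-- represented by  a ↦ coefficient of x^a y^(d-a).

HPoly : Set
HPoly = ℕ → ℤ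

sumℤ : ℕ → (ℕ → ℤ) → ℤ
sumℤ zero f = + 0
sumℤ (suc n) f = sumℤ n f ℤ.+ f n

hmul : HPoly → HPoly → HPoly
hmul f g a = sumℤ (suc a) (λ i → f i ℤ.* g (a ℕ.∸ i))

hone : HPoly
hone zero = + 1
hone (suc _) = + 0

hpow : HPoly → ℕ → HPoly
hpow f zero = hone
hpow f (suc n) = hmul f (hpow f n)

lin : ℤ → ℤ → HPoly
lin u v zero = v
lin u v (suc zero) = u
lin u v (suc (suc _)) = + 0

-- Field-valued part: the Todd series lives in a field K of
-- characteristic 0 containing a primitive q-th root of unity ζ
-- (playing the role of exp(2πi/q)).

module _ {c ℓ : Level} (R : CommutativeRing c ℓ) where
  open CommutativeRing R

  natK : ℕ → Carrier
  natK zero = 0#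
  natK (suc n) = 1# + natK n

  intK : ℤ → Carrier
  intK (+ n) = natK n
  intK -[1+ n ] = - natK (suc n)

  powK : Carrier → ℕ → Carrier
  powK x zero = 1#
  powK x (suc n) = x * powK x n

  IsFieldInverse : (Carrier → Carrier) → Set (c Level.⊔ ℓ)
  IsFieldInverse inv = ∀ x → ¬ (x ≈ 0#) → x * inv x ≈ 1#

  CharZero : Set ℓ
  CharZero = ∀ n → natK n ≈ 0# → n ≡ 0

  IsPrimitiveRoot : ℕ → Carrier → Set ℓ
  IsPrimitiveRoot q ζ =
    (powK ζ q ≈ 1#) × (∀ k → 0 ℕ.< k → k ℕ.< q → ¬ (powK ζ k ≈ 1#))

  module WithInv (inv : Carrier → Carrier) where

    ratK : ℚ → Carrier
    ratK r = intK (↥ r) * inv (natK (↧ₙ r))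

    sumK : ℕ → (ℕ → Carrier) → Carrier
    sumK zero f = 0#
    sumK (suc n) f = sumK n f + f n

    -- coefficients of the multiplicative inverse of a power series h
    -- with h_0 invertible:  c_0 = h_0⁻¹,  c_n = -h_0⁻¹ Σ_{k=1}^n h_k c_{n-k}.
    -- invRev h n = [c_n, ..., c_0]
    invRev : (ℕ → Carrier) → ℕ → List Carrier
    invRev h zero = inv (h 0) ∷ []
    invRev h (suc n) = (- (inv (h 0) * dot 1 cs)) ∷ cs
      where
        cs = invRev h n
        dot : ℕ → List Carrier → Carrier
        dot k [] = 0#
        dot k (x ∷ xs) = h k * x + dot (suc k) xs

    invCoef : (ℕ → Carrier) → ℕ → Carrier
    invCoef h n with invRev h n
    ... | [] = 0#
    ... | x ∷ _ = x

    expNeg : ℕ → Carrier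
    expNeg k = ratK (ℚfromℤ (signℤ k) ℚ.* (ℚ._/_ (+ 1) (k !) {{_!≢0 k}}))

    denom : Carrier → ℕ → Carrier
    denom χ zero = 1# - χ * expNeg 0
    denom χ (suc k) = - (χ * expNeg (suc k))

    -- coefficients of x / (1 - χ e^{-x}) where χ = ζ^e, 0 ≤ e < q.
    -- If χ = 1 (e = 0) the denominator is x·h̃ with h̃_0 = 1 and the series is 1/h̃;
    -- otherwise the constant term 1-χ is invertible and the series is x·(1/h).
    toddFactor : Carrier → ℕ → ℕ → Carrier
    toddFactor ζ zero m = invCoef (λ k → denom 1# (suc k)) m
    toddFactor ζ (suc e) zero = 0#
    toddFactor ζ (suc e) (suc m) = invCoef (denom (powK ζ (suc e))) m

    -- Γ = ℤ²/(ℤ(1,0) + ℤ(p,q)).  For g = (g₁,g₂) = a₁ v₁ + a₂ v₂ we have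
    -- q a₂ = g₂ and q a₁ = q g₁ - p g₂, so χᵢ(γ) = exp(2πi aᵢ) = ζ^(q aᵢ mod q).
    modq : ℤ → ℕ → ℕ
    modq z zero = 0
    modq z (suc k) = z %ℕ suc k

    exp₁ : ℕ → ℕ → ℤ → ℤ → ℕ
    exp₁ p q g₁ g₂ = modq (+ q ℤ.* g₁ ℤ.- + p ℤ.* g₂) q

    exp₂ : ℕ → ℕ → ℤ → ℤ → ℕ
    exp₂ p q g₁ g₂ = modq g₂ q

    -- coefficient of x^a y^b in Td_{pq}; Γ is enumerated by the
    -- representatives (0, j), 0 ≤ j < q.
    toddCoef : ℕ → ℕ → Carrier → ℕ → ℕ → Carrier
    toddCoef p q ζ a b =
      sumK q (λ j → toddFactor ζ (exp₁ p q (+ 0) (+ j)) a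
                   * toddFactor ζ (exp₂ p q (+ 0) (+ j)) b)

    mainCoef : ℕ → ℕ → Carrier → List ℕ → ℕ → ℕ → Carrier
    mainCoef p q ζ as N a =
      ratK (ℚfromℕ ((N !) ℕ.* βB N ℕ.* rN N)) * toddCoef p q ζ a (N ℕ.∸ a)
      - intK (αB N ℤ.* + rN N ℤ.* (P₁ a ℤ.+ P₂ a))
      where
        n = length as
        s = signℤ (n ℕ.∸ 1) ℤ.* cfNum as (n ℕ.∸ 1)
        P₁ = hmul (hpow (lin (+ 1) (+ p)) (N ℕ.∸ 1)) (lin (+ 1) (+ 0))
        P₂ = hmul (hpow (lin s (+ 1)) (N ℕ.∸ 1)) (lin (+ 0) (+ 1))

{-# OPTIONS --safe #-}
module Submission where

-- Orthogonality of characters turns the sum over Γ into a sum over lattice points: with E = e^{-t},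
-- Td(xt, yt) = q x y t² Σ E^{kx + ly} / ((1 - E^{qx})(1 - E^{qy})), the sum being over 0 ≤ k, l < q with
-- l ≡ pk mod q, that is, over the half-open parallelogram of a cone of index q.  Subtractive Euclid subdivides
-- this cone into unimodular ones.  A unimodular cone with generators of values u, w contributes
-- Σ_j C(N,j) B_j B_{N-j} u^{j-1} w^{N-j-1}; after multiplication by β_N r_N the terms with 0 < j < N have integer
-- coefficients and, because of the factor q, vanish mod q.  The terms j = 0, N carry α_N r_N (w^{N-1}/u + u^{N-1}/w):
-- at an inner ray w the two neighbours combine to (u^{N-1} + v^{N-1})/(u + v), a polynomial as N - 1 is odd, and the
-- two outer rays give (x + py)^{N-1} x and (sx + y)^{N-1} y with s p ≡ 1 mod q.
-- It suffices to know all this for y = 1 and natural x ≥ q, where only powers of E occur and every value is positive;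
-- then coefficients of polynomials in x are compared.

open import Defs
open import Level using (Level)
import Level
open import Algebra.Bundles using (CommutativeRing)
open import Algebra.Solver.Ring.AlmostCommutativeRing using (fromCommutativeRing; _-Raw-AlmostCommutative⟶_)
import Algebra.Solver.Ring
open import Data.Nat as ℕ using (ℕ; zero; suc; _<_; _≤_; s≤s; z≤n; _!)
import Data.Nat.Properties as ℕP
import Data.Nat.Solver
open import Data.Nat.Combinatorics using (_C_; k![n∸k]!∣n!; nCk≡n!/k![n-k]!; nC1≡n; nCk≡nC[n∸k])
open import Data.Nat.Coprimality using (Coprime)
import Data.Nat.Coprimality as Coprimality
open import Data.Nat.Divisibility using (_∣_; divides; ∣-refl; ∣-trans; _∣0; ∣1⇒≡1; ∣m∣n⇒∣m+n; ∣m+n∣m⇒∣n; ∣n⇒∣m*n; >⇒∤; m%n≡0⇒n∣m)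
open import Data.Nat.DivMod using (m/n*n≡m; m≡m%n+[m/n]*n; m%n<n; m<n⇒m%n≡m)
open import Data.Nat.LCM using (m∣lcm[m,n]; n∣lcm[m,n])
open import Data.Integer as ℤ using (ℤ; +_; -[1+_]; _⊖_)
import Data.Integer.Properties as ℤP
import Data.Integer.DivMod as ℤD
import Data.Integer.Solver
open import Data.Rational as ℚ using (ℚ; mkℚ; ↥_; ↧ₙ_; 0ℚ; toℚᵘ)
import Data.Rational.Properties as ℚP
open import Data.Rational.Unnormalised as ℚᵘ using (ℚᵘ; mkℚᵘ; *≡*)
open import Data.List using (List; []; _∷_; length; map; take)
open import Data.List.Properties using (∷-injectiveˡ)
open import Data.List.Relation.Unary.All using (All; []; _∷_)
open import Data.Maybe using (Maybe; just; nothing)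
open import Data.Product using (_,_; _×_; proj₁; proj₂; ∃-syntax; map₂)
open import Data.Sum using (_⊎_; inj₁; inj₂; [_,_]′)
open import Data.Unit using (⊤; tt)
open import Function using (_∘_)
open import Relation.Nullary using (¬_; Dec; yes; no; contradiction)
open import Relation.Binary.PropositionalEquality as ≡ using (_≡_; _≢_)
import Relation.Binary.Reasoning.Setoid

-- Commutative rings

-- Two obstacles shape the proof. Denominators: boundary terms such as w^(N-1)/u are not
-- polynomials. The statement proved by induction, `Formula`, is therefore multiplied by the values
-- u and z of the two outer rays, and a subdivision becomes a polynomial identity multiplied by the
-- value of the new ray. That value is a positive natural number and can be cancelled in
-- characteristic 0. Signs: the condition l ≡ pk belongs to a cone with a negative coordinate. With
-- q = p + r and -p ≡ r it becomes the cone of (1,0) and (r,q), where (1,0) has value q and (0,1)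
-- has value x - r; all values are natural once x ≥ q. So Euclid runs on (r,q), not on (p,q). The
-- way back to p is modulo q: x - r ≡ x + p, and the last ray before (r,q) has value ex + 1 with ep
-- ≡ 1.

module RingLemmas {c ℓ : Level} (R : CommutativeRing c ℓ) where
  open CommutativeRing R hiding (zero)
  open Relation.Binary.Reasoning.Setoid setoid
  open import Algebra.Properties.Ring ring using (-‿distribˡ-*; -‿distribʳ-*; -‿involutive; -0#≈0#)
  open import Algebra.Properties.AbelianGroup +-abelianGroup using (⁻¹-∙-comm)
  open import Algebra.Properties.CommutativeSemigroup +-commutativeSemigroup using (interchange)

  ι : ℕ → Carrier
  ι = natK R

  ι-1 : ι 1 ≈ 1#
  ι-1 = +-identityʳ 1#

  ι-+ : ∀ m n → ι (m ℕ.+ n) ≈ ι m + ι n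
  ι-+ zero n = sym (+-identityˡ _)
  ι-+ (suc m) n = trans (+-congˡ (ι-+ m n)) (sym (+-assoc _ _ _))

  ι-* : ∀ m n → ι (m ℕ.* n) ≈ ι m * ι n
  ι-* zero n = sym (zeroˡ _)
  ι-* (suc m) n = begin
    ι (n ℕ.+ m ℕ.* n)      ≈⟨ ι-+ n (m ℕ.* n) ⟩
    ι n + ι (m ℕ.* n)      ≈⟨ +-cong (sym (*-identityˡ _)) (ι-* m n) ⟩
    1# * ι n + ι m * ι n   ≈⟨ distribʳ _ _ _ ⟨
    (1# + ι m) * ι n       ∎

  intK-⊖ : ∀ m n → intK R (m ⊖ n) ≈ ι m - ι n
  intK-⊖ zero zero = sym (-‿inverseʳ _)
  intK-⊖ zero (suc n) = sym (+-identityˡ _)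
  intK-⊖ (suc m) zero = sym (trans (+-congˡ -0#≈0#) (+-identityʳ _))
  intK-⊖ (suc m) (suc n) = begin
    intK R (suc m ⊖ suc n)           ≡⟨ ≡.cong (intK R) (ℤP.[1+m]⊖[1+n]≡m⊖n m n) ⟩
    intK R (m ⊖ n)                   ≈⟨ intK-⊖ m n ⟩
    ι m - ι n                        ≈⟨ +-identityˡ _ ⟨
    0# + (ι m - ι n)                 ≈⟨ +-congʳ (-‿inverseʳ 1#) ⟨
    (1# - 1#) + (ι m - ι n)          ≈⟨ interchange _ _ _ _ ⟩
    (1# + ι m) + (- 1# + - ι n)      ≈⟨ +-congˡ (⁻¹-∙-comm _ _) ⟩
    (1# + ι m) - (1# + ι n)          ∎

  intK-neg : ∀ i → intK R (ℤ.- i) ≈ - intK R i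
  intK-neg (+ zero) = sym -0#≈0#
  intK-neg (+ suc n) = refl
  intK-neg -[1+ n ] = sym (-‿involutive _)

  intK-+ : ∀ i j → intK R (i ℤ.+ j) ≈ intK R i + intK R j
  intK-+ (+ m) (+ n) = ι-+ m n
  intK-+ (+ m) -[1+ n ] = intK-⊖ m (suc n)
  intK-+ -[1+ m ] (+ n) = trans (intK-⊖ n (suc m)) (+-comm _ _)
  intK-+ -[1+ m ] -[1+ n ] = begin
    - ι (suc (suc (m ℕ.+ n)))   ≡⟨ ≡.cong (λ k → - ι (suc k)) (≡.sym (ℕP.+-suc m n)) ⟩
    - ι (suc m ℕ.+ suc n)       ≈⟨ -‿cong (ι-+ (suc m) (suc n)) ⟩
    - (ι (suc m) + ι (suc n))   ≈⟨ ⁻¹-∙-comm _ _ ⟨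
    - ι (suc m) + - ι (suc n)   ∎

  private
    intK-pos-* : ∀ m j → intK R (+ m ℤ.* j) ≈ ι m * intK R j
    intK-pos-* m (+ n) = trans (reflexive (≡.cong (intK R) (≡.sym (ℤP.pos-* m n)))) (ι-* m n)
    intK-pos-* m -[1+ n ] = begin
      intK R (+ m ℤ.* (ℤ.- + suc n))     ≡⟨ ≡.cong (intK R) (ℤP.neg-distribʳ-* (+ m) (+ suc n)) ⟨
      intK R (ℤ.- (+ m ℤ.* + suc n))     ≈⟨ intK-neg (+ m ℤ.* + suc n) ⟩
      - intK R (+ m ℤ.* + suc n)         ≈⟨ -‿cong (intK-pos-* m (+ suc n)) ⟩
      - (ι m * ι (suc n))                ≈⟨ -‿distribʳ-* _ _ ⟩
      ι m * (- ι (suc n))                ∎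

  intK-* : ∀ i j → intK R (i ℤ.* j) ≈ intK R i * intK R j
  intK-* (+ m) j = intK-pos-* m j
  intK-* -[1+ m ] j = begin
    intK R ((ℤ.- + suc m) ℤ.* j)   ≡⟨ ≡.cong (intK R) (ℤP.neg-distribˡ-* (+ suc m) j) ⟨
    intK R (ℤ.- (+ suc m ℤ.* j))   ≈⟨ intK-neg (+ suc m ℤ.* j) ⟩
    - intK R (+ suc m ℤ.* j)       ≈⟨ -‿cong (intK-pos-* (suc m) j) ⟩
    - (ι (suc m) * intK R j)       ≈⟨ -‿distribˡ-* _ _ ⟩
    (- ι (suc m)) * intK R j       ∎

  private
    ℤ-morphism : ℤ.+-*-rawRing -Raw-AlmostCommutative⟶ fromCommutativeRing R
    ℤ-morphism = record
      { ⟦_⟧ = intK R ; +-homo = intK-+ ; *-homo = intK-* ; -‿homo = intK-neg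
      ; 0-homo = refl ; 1-homo = ι-1 }

    _coeff≟_ : ∀ i j → Maybe (intK R i ≈ intK R j)
    i coeff≟ j with i ℤP.≟ j
    ... | yes eq = just (reflexive (≡.cong (intK R) eq))
    ... | no _ = nothing

  -- A coefficient `con (+ 1)` is interpreted as `natK 1`, that is `1# + 0#`, and not as `1#`. Goals
  -- that contain `1#` therefore mostly pass it as a variable and apply the unit laws by hand.
  module Solver = Algebra.Solver.Ring ℤ.+-*-rawRing (fromCommutativeRing R) ℤ-morphism _coeff≟_

  infixr 8 _^_
  _^_ : Carrier → ℕ → Carrier
  _^_ = powK R

  ^-cong : ∀ {x y} → x ≈ y → ∀ n → x ^ n ≈ y ^ n
  ^-cong eq zero = refl
  ^-cong eq (suc n) = *-cong eq (^-cong eq n)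

  ^-+ : ∀ x m n → x ^ (m ℕ.+ n) ≈ x ^ m * x ^ n
  ^-+ x zero n = sym (*-identityˡ _)
  ^-+ x (suc m) n = trans (*-congˡ (^-+ x m n)) (sym (*-assoc _ _ _))

  1^ : ∀ n → 1# ^ n ≈ 1#
  1^ zero = refl
  1^ (suc n) = trans (*-identityˡ _) (1^ n)

  ^-* : ∀ x m n → x ^ (m ℕ.* n) ≈ (x ^ n) ^ m
  ^-* x zero n = refl
  ^-* x (suc m) n = trans (^-+ x n (m ℕ.* n)) (*-congˡ (^-* x m n))

  *-^ : ∀ x y n → (x * y) ^ n ≈ x ^ n * y ^ n
  *-^ x y zero = sym (*-identityˡ _)
  *-^ x y (suc n) = begin
    (x * y) * (x * y) ^ n         ≈⟨ *-congˡ (*-^ x y n) ⟩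
    (x * y) * (x ^ n * y ^ n)     ≈⟨ solve 4 (λ a b c d → (a :* b) :* (c :* d) := (a :* c) :* (b :* d)) refl x y (x ^ n) (y ^ n) ⟩
    (x * x ^ n) * (y * y ^ n)     ∎
    where open Solver

  neg-^-odd : ∀ x k → (- x) ^ suc (k ℕ.+ k) ≈ - (x ^ suc (k ℕ.+ k))
  neg-^-odd x zero = sym (-‿distribˡ-* _ _)
  neg-^-odd x (suc k) rewrite ℕP.+-suc k k = begin
    (- x) * ((- x) * (- x) ^ suc (k ℕ.+ k))     ≈⟨ *-congˡ (*-congˡ (neg-^-odd x k)) ⟩
    (- x) * ((- x) * (- (x ^ suc (k ℕ.+ k))))   ≈⟨ solve 2 (λ a b → (:- a) :* ((:- a) :* (:- b)) := :- (a :* (a :* b))) refl x (x ^ suc (k ℕ.+ k)) ⟩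
    - (x * (x * x ^ suc (k ℕ.+ k)))             ∎
    where open Solver

  sgn : ℕ → Carrier
  sgn n = (- 1#) ^ n

  sgn-even : ∀ k → sgn (k ℕ.+ k) ≈ 1#
  sgn-even zero = refl
  sgn-even (suc k) rewrite ℕP.+-suc k k = begin
    - 1# * (- 1# * sgn (k ℕ.+ k))   ≈⟨ solve 2 (λ a b → (:- a) :* ((:- a) :* b) := a :* (a :* b)) refl 1# (sgn (k ℕ.+ k)) ⟩
    1# * (1# * sgn (k ℕ.+ k))       ≈⟨ trans (*-identityˡ _) (*-identityˡ _) ⟩
    sgn (k ℕ.+ k)                   ≈⟨ sgn-even k ⟩
    1#                              ∎
    where open Solver

  Σ : ℕ → (ℕ → Carrier) → Carrier
  Σ zero f = 0#
  Σ (suc n) f = Σ n f + f n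

  Σ-cong-< : ∀ n {f g : ℕ → Carrier} → (∀ i → i < n → f i ≈ g i) → Σ n f ≈ Σ n g
  Σ-cong-< zero eq = refl
  Σ-cong-< (suc n) eq = +-cong (Σ-cong-< n (λ i i<n → eq i (ℕP.m<n⇒m<1+n i<n))) (eq n (ℕP.n<1+n n))

  Σ-cong : ∀ n {f g : ℕ → Carrier} → (∀ i → f i ≈ g i) → Σ n f ≈ Σ n g
  Σ-cong n eq = Σ-cong-< n (λ i _ → eq i)

  Σ-zero : ∀ n {f : ℕ → Carrier} → (∀ i → i < n → f i ≈ 0#) → Σ n f ≈ 0#
  Σ-zero zero eq = refl
  Σ-zero (suc n) eq =
    trans (+-cong (Σ-zero n (λ i i<n → eq i (ℕP.m<n⇒m<1+n i<n))) (eq n (ℕP.n<1+n n))) (+-identityˡ _)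

  Σ-+ : ∀ n f g → Σ n (λ i → f i + g i) ≈ Σ n f + Σ n g
  Σ-+ zero f g = sym (+-identityˡ _)
  Σ-+ (suc n) f g = trans (+-congʳ (Σ-+ n f g)) (interchange _ _ _ _)

  Σ-*ˡ : ∀ n a f → a * Σ n f ≈ Σ n (λ i → a * f i)
  Σ-*ˡ zero a f = zeroʳ _
  Σ-*ˡ (suc n) a f = trans (distribˡ _ _ _) (+-congʳ (Σ-*ˡ n a f))

  Σ-*ʳ : ∀ n a f → Σ n f * a ≈ Σ n (λ i → f i * a)
  Σ-*ʳ zero a f = zeroˡ _
  Σ-*ʳ (suc n) a f = trans (distribʳ _ _ _) (+-congʳ (Σ-*ʳ n a f))

  Σ-swap : ∀ m n (f : ℕ → ℕ → Carrier) →
           Σ m (λ i → Σ n (f i)) ≈ Σ n (λ j → Σ m (λ i → f i j))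
  Σ-swap zero n f = sym (Σ-zero n (λ _ _ → refl))
  Σ-swap (suc m) n f = trans (+-congʳ (Σ-swap m n f)) (sym (Σ-+ n _ _))

  Σ-front : ∀ n f → Σ (suc n) f ≈ f 0 + Σ n (λ i → f (suc i))
  Σ-front zero f = +-comm _ _
  Σ-front (suc n) f = trans (+-congʳ (Σ-front n f)) (+-assoc _ _ _)

  Σ-single : ∀ n d {f : ℕ → Carrier} → d < n → (∀ i → i < n → i ≢ d → f i ≈ 0#) → Σ n f ≈ f d
  Σ-single (suc n) d {f} d<1+n eq with d ℕP.≟ n
  ... | yes ≡.refl = trans (+-congʳ (Σ-zero n λ i i<n → eq i (ℕP.m<n⇒m<1+n i<n) (ℕP.<⇒≢ i<n))) (+-identityˡ _)
  ... | no d≢n = trans (+-cong (Σ-single n d (ℕP.≤∧≢⇒< (ℕP.≤-pred d<1+n) d≢n)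
                                  (λ i i<n → eq i (ℕP.m<n⇒m<1+n i<n)))
                               (eq n (ℕP.n<1+n n) (λ n≡d → d≢n (≡.sym n≡d)))) (+-identityʳ _)

  Σ-const : ∀ n a → Σ n (λ _ → a) ≈ ι n * a
  Σ-const zero a = sym (zeroˡ _)
  Σ-const (suc n) a = begin
    Σ n (λ _ → a) + a    ≈⟨ +-cong (Σ-const n a) (sym (*-identityˡ _)) ⟩
    ι n * a + 1# * a     ≈⟨ distribʳ _ _ _ ⟨
    (ι n + 1#) * a       ≈⟨ *-congʳ (+-comm _ _) ⟩
    (1# + ι n) * a       ∎

  geometric : ∀ x n → (1# - x) * Σ n (x ^_) ≈ 1# - x ^ n
  geometric x zero = trans (zeroʳ _) (sym (-‿inverseʳ _))
  geometric x (suc n) = begin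
    (1# - x) * (Σ n (x ^_) + x ^ n)               ≈⟨ distribˡ _ _ _ ⟩
    (1# - x) * Σ n (x ^_) + (1# - x) * x ^ n      ≈⟨ +-congʳ (geometric x n) ⟩
    (1# - x ^ n) + (1# - x) * x ^ n               ≈⟨ +-congˡ (distribʳ _ _ _) ⟩
    (1# - x ^ n) + (1# * x ^ n + (- x) * x ^ n)   ≈⟨ +-congˡ (+-congʳ (*-identityˡ _)) ⟩
    (1# - x ^ n) + (x ^ n + (- x) * x ^ n)        ≈⟨ solve 3 (λ o a b → (o :- b) :+ (b :+ (:- a) :* b) := o :- a :* b) refl 1# x (x ^ n) ⟩
    1# - x * x ^ n                                ∎
    where open Solver

-- Formal power series

module PowerSeries {c ℓ : Level} (R : CommutativeRing c ℓ) where
  open CommutativeRing R hiding (zero)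
  open RingLemmas R
  open Relation.Binary.Reasoning.Setoid setoid
  open import Algebra.Properties.CommutativeSemigroup +-commutativeSemigroup using (interchange)

  Series : Set c
  Series = ℕ → Carrier

  -- A record, so that the two series can be inferred from a proof of equality.
  infix 4 _≋_
  record _≋_ (f g : Series) : Set ℓ where
    constructor coeffwise
    field at : ∀ n → f n ≈ g n
  open _≋_ public

  infixl 6 _⊕_
  infixl 7 _⊛_
  -- The Cauchy product recurses on the tail of its first factor, so that the ring laws are
  -- inductions without reindexing of double sums. `⊛-coeff` recovers the usual sum.
  _⊕_ _⊛_ : Series → Series → Series
  (f ⊕ g) n = f n + g n
  (f ⊛ g) zero = f 0 * g 0
  (f ⊛ g) (suc n) = f 0 * g (suc n) + ((f ∘ suc) ⊛ g) n

  cst : Carrier → Series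
  cst a zero = a
  cst a (suc _) = 0#

  X : Series
  X zero = 0#
  X (suc n) = cst 1# n

  ⊖_ : Series → Series
  (⊖ f) n = - f n

  ⊛-cong′ : ∀ {f f′ g g′ : Series} → (∀ n → f n ≈ f′ n) → (∀ n → g n ≈ g′ n) → ∀ n → (f ⊛ g) n ≈ (f′ ⊛ g′) n
  ⊛-cong′ p r zero = *-cong (p 0) (r 0)
  ⊛-cong′ p r (suc n) = +-cong (*-cong (p 0) (r (suc n))) (⊛-cong′ (p ∘ suc) r n)

  ⊛-distribʳ : ∀ f g h n → ((g ⊕ h) ⊛ f) n ≈ (g ⊛ f) n + (h ⊛ f) n
  ⊛-distribʳ f g h zero = distribʳ _ _ _
  ⊛-distribʳ f g h (suc n) = trans (+-cong (distribʳ _ _ _) (⊛-distribʳ f (g ∘ suc) (h ∘ suc) n)) (interchange _ _ _ _)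

  ⊛-scaleˡ : ∀ a f g n → ((λ k → a * f k) ⊛ g) n ≈ a * (f ⊛ g) n
  ⊛-scaleˡ a f g zero = *-assoc _ _ _
  ⊛-scaleˡ a f g (suc n) = trans (+-cong (*-assoc _ _ _) (⊛-scaleˡ a (f ∘ suc) g n)) (sym (distribˡ _ _ _))

  ⊛-assoc : ∀ f g h n → ((f ⊛ g) ⊛ h) n ≈ (f ⊛ (g ⊛ h)) n
  ⊛-assoc f g h zero = *-assoc _ _ _
  ⊛-assoc f g h (suc n) = begin
    f 0 * g 0 * h (suc n) + (((λ k → f 0 * g (suc k)) ⊕ ((f ∘ suc) ⊛ g)) ⊛ h) n
      ≈⟨ +-cong (*-assoc _ _ _) (⊛-distribʳ h (λ k → f 0 * g (suc k)) ((f ∘ suc) ⊛ g) n) ⟩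
    f 0 * (g 0 * h (suc n)) + (((λ k → f 0 * g (suc k)) ⊛ h) n + (((f ∘ suc) ⊛ g) ⊛ h) n)
      ≈⟨ +-congˡ (+-cong (⊛-scaleˡ (f 0) (g ∘ suc) h n) (⊛-assoc (f ∘ suc) g h n)) ⟩
    f 0 * (g 0 * h (suc n)) + (f 0 * ((g ∘ suc) ⊛ h) n + ((f ∘ suc) ⊛ (g ⊛ h)) n)
      ≈⟨ +-assoc _ _ _ ⟨
    f 0 * (g 0 * h (suc n)) + f 0 * ((g ∘ suc) ⊛ h) n + ((f ∘ suc) ⊛ (g ⊛ h)) n
      ≈⟨ +-congʳ (distribˡ _ _ _) ⟨
    f 0 * (g 0 * h (suc n) + ((g ∘ suc) ⊛ h) n) + ((f ∘ suc) ⊛ (g ⊛ h)) n ∎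

  ⊛-sucʳ : ∀ f g n → (f ⊛ g) (suc n) ≈ f (suc n) * g 0 + (f ⊛ (g ∘ suc)) n
  ⊛-sucʳ f g zero = +-comm _ _
  ⊛-sucʳ f g (suc n) = begin
    f 0 * g (suc (suc n)) + ((f ∘ suc) ⊛ g) (suc n)
      ≈⟨ +-congˡ (⊛-sucʳ (f ∘ suc) g n) ⟩
    f 0 * g (suc (suc n)) + (f (suc (suc n)) * g 0 + ((f ∘ suc) ⊛ (g ∘ suc)) n)
      ≈⟨ solve 3 (λ a b c → a :+ (b :+ c) := b :+ (a :+ c)) refl _ _ _ ⟩
    f (suc (suc n)) * g 0 + (f 0 * g (suc (suc n)) + ((f ∘ suc) ⊛ (g ∘ suc)) n) ∎
    where open Solver

  ⊛-comm : ∀ f g n → (f ⊛ g) n ≈ (g ⊛ f) n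
  ⊛-comm f g zero = *-comm _ _
  ⊛-comm f g (suc n) = trans (⊛-sucʳ f g n) (+-cong (*-comm _ _) (⊛-comm f (g ∘ suc) n))

  0⊛ : ∀ f g → (∀ n → f n ≈ 0#) → ∀ n → (f ⊛ g) n ≈ 0#
  0⊛ f g z zero = trans (*-congʳ (z 0)) (zeroˡ _)
  0⊛ f g z (suc n) = trans (+-cong (trans (*-congʳ (z 0)) (zeroˡ _)) (0⊛ (f ∘ suc) g (z ∘ suc) n)) (+-identityˡ _)

  cst-⊛ : ∀ a f n → (cst a ⊛ f) n ≈ a * f n
  cst-⊛ a f zero = refl
  cst-⊛ a f (suc n) = trans (+-congˡ (0⊛ (λ _ → 0#) f (λ _ → refl) n)) (+-identityʳ _)

  X-⊛ : ∀ f n → (X ⊛ f) (suc n) ≈ f n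
  X-⊛ f n = trans (+-cong (zeroˡ _) (trans (cst-⊛ 1# f n) (*-identityˡ _))) (+-identityˡ _)

  ⊛-identityˡ : ∀ f n → (cst 1# ⊛ f) n ≈ f n
  ⊛-identityˡ f n = trans (cst-⊛ 1# f n) (*-identityˡ _)

  seriesRing : CommutativeRing c ℓ
  seriesRing = record
    { Carrier = Series ; _≈_ = _≋_ ; _+_ = _⊕_ ; _*_ = _⊛_ ; -_ = ⊖_ ; 0# = λ _ → 0# ; 1# = cst 1#
    ; isCommutativeRing = record
      { isRing = record
        { +-isAbelianGroup = record
          { isGroup = record
            { isMonoid = record
              { isSemigroup = record
                { isMagma = record
                  { isEquivalence = record
                    { refl = coeffwise λ _ → refl
                    ; sym = λ p → coeffwise λ n → sym (at p n)
                    ; trans = λ p r → coeffwise λ n → trans (at p n) (at r n) }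
                  ; ∙-cong = λ p r → coeffwise λ n → +-cong (at p n) (at r n) }
                ; assoc = λ f g h → coeffwise λ n → +-assoc _ _ _ }
              ; identity = (λ f → coeffwise λ n → +-identityˡ _) , (λ f → coeffwise λ n → +-identityʳ _) }
            ; inverse = (λ f → coeffwise λ n → -‿inverseˡ _) , (λ f → coeffwise λ n → -‿inverseʳ _)
            ; ⁻¹-cong = λ p → coeffwise λ n → -‿cong (at p n) }
          ; comm = λ f g → coeffwise λ n → +-comm _ _ }
        ; *-cong = λ p r → coeffwise (⊛-cong′ (at p) (at r))
        ; *-assoc = λ f g h → coeffwise (⊛-assoc f g h)
        ; *-identity = (λ f → coeffwise (⊛-identityˡ f)) ,
                       (λ f → coeffwise λ n → trans (⊛-comm f (cst 1#) n) (⊛-identityˡ f n))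
        ; distrib = (λ f g h → coeffwise λ n → trans (⊛-comm f (g ⊕ h) n)
                        (trans (⊛-distribʳ f g h n) (+-cong (⊛-comm g f n) (⊛-comm h f n)))) ,
                    (λ f g h → coeffwise (⊛-distribʳ f g h)) }
      ; *-comm = λ f g → coeffwise (⊛-comm f g) } }

  private module S = CommutativeRing seriesRing

  X-cancel : ∀ {f g} → X ⊛ f ≋ X ⊛ g → f ≋ g
  X-cancel {f} {g} eq = coeffwise λ n → trans (sym (X-⊛ f n)) (trans (at eq (suc n)) (X-⊛ g n))

  cst-cong : ∀ {a b} → a ≈ b → cst a ≋ cst b
  cst-cong eq = coeffwise λ { zero → eq ; (suc n) → refl }

  cst-+ : ∀ a b → cst (a + b) ≋ cst a ⊕ cst b
  cst-+ a b = coeffwise λ { zero → refl ; (suc n) → sym (+-identityˡ _) }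

  cst-* : ∀ a b → cst (a * b) ≋ cst a ⊛ cst b
  cst-* a b = coeffwise λ { zero → refl ; (suc n) → sym (trans (cst-⊛ a (cst b) (suc n)) (zeroʳ _)) }

  cst-^ : ∀ a n → cst (a ^ n) ≋ powK seriesRing (cst a) n
  cst-^ a zero = S.refl
  cst-^ a (suc n) = S.trans (cst-* a (a ^ n)) (S.*-congˡ (cst-^ a n))

  ⊛-coeff : ∀ f g n → (f ⊛ g) n ≈ Σ (suc n) (λ i → f i * g (n ℕ.∸ i))
  ⊛-coeff f g zero = sym (+-identityˡ _)
  ⊛-coeff f g (suc n) = sym (trans (Σ-front (suc n) (λ i → f i * g (suc n ℕ.∸ i)))
                                   (+-congˡ (sym (⊛-coeff (f ∘ suc) g n))))

  ⊛-inverse-unique : ∀ {f g h} → f ⊛ h ≋ cst 1# → g ⊛ h ≋ cst 1# → f ≋ g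
  ⊛-inverse-unique {f} {g} {h} fh gh =
    S.trans (S.sym (S.*-identityʳ f)) (S.trans (S.*-congˡ (S.sym gh)) (S.trans
      (solve 3 (λ a b c → a :* (b :* c) := b :* (a :* c)) S.refl f g h)
      (S.trans (S.*-congˡ fh) (S.*-identityʳ g))))
    where open RingLemmas.Solver seriesRing

  scale : Carrier → Series → Series
  scale a f n = f n * a ^ n

  scale-cong : ∀ a {f g} → f ≋ g → scale a f ≋ scale a g
  scale-cong a eq = coeffwise λ n → *-congʳ (at eq n)

  scale-⊛ : ∀ a f g → scale a (f ⊛ g) ≋ scale a f ⊛ scale a g
  scale-⊛ a f g = coeffwise (go f)
    where
    open Solver
    go : ∀ f n → scale a (f ⊛ g) n ≈ (scale a f ⊛ scale a g) n
    go f zero = trans (*-identityʳ _) (sym (*-cong (*-identityʳ _) (*-identityʳ _)))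
    go f (suc n) = begin
      (f 0 * g (suc n) + ((f ∘ suc) ⊛ g) n) * (a * a ^ n)
        ≈⟨ solve 5 (λ x y z a b → (x :* y :+ z) :* (a :* b) := x :* (y :* (a :* b)) :+ a :* (z :* b)) refl
             (f 0) (g (suc n)) (((f ∘ suc) ⊛ g) n) a (a ^ n) ⟩
      f 0 * (g (suc n) * a ^ suc n) + a * scale a ((f ∘ suc) ⊛ g) n
        ≈⟨ +-cong (*-congʳ (sym (*-identityʳ _))) (*-congˡ (go (f ∘ suc) n)) ⟩
      scale a f 0 * scale a g (suc n) + a * (scale a (f ∘ suc) ⊛ scale a g) n
        ≈⟨ +-congˡ (⊛-scaleˡ a (scale a (f ∘ suc)) (scale a g) n) ⟨
      scale a f 0 * scale a g (suc n) + ((λ k → a * scale a (f ∘ suc) k) ⊛ scale a g) n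
        ≈⟨ +-congˡ (⊛-cong′ (λ k → solve 3 (λ x y z → x :* (y :* z) := y :* (x :* z)) refl a (f (suc k)) (a ^ k)) (λ _ → refl) n) ⟩
      scale a f 0 * scale a g (suc n) + ((scale a f ∘ suc) ⊛ scale a g) n ∎

  scale-X : ∀ a → scale a X ≋ cst a ⊛ X
  scale-X a = coeffwise λ
    { zero → trans (zeroˡ _) (sym (zeroʳ _))
    ; (suc zero) → trans (*-identityˡ _) (trans (*-identityʳ _) (sym (trans (cst-⊛ a X 1) (*-identityʳ _))))
    ; (suc (suc n)) → trans (zeroˡ _) (sym (trans (cst-⊛ a X (suc (suc n))) (zeroʳ _))) }

  scale-cst : ∀ a b → scale a (cst b) ≋ cst b
  scale-cst a b = coeffwise λ { zero → *-identityʳ _ ; (suc n) → zeroˡ _ }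

  -- The Euler operator X d/dX. Unlike d/dX it shifts no index, and it is still a derivation
  -- (`θ-⊛`).
  θ : Series → Series
  θ f n = ι n * f n

  θ-⊛ : ∀ f g n → θ (f ⊛ g) n ≈ (θ f ⊛ g) n + (f ⊛ θ g) n
  θ-⊛ f g zero = solve 3 (λ z x y → con 0ℤ :* z := con 0ℤ :* x :* y :+ x :* (con 0ℤ :* y)) refl (f 0 * g 0) (f 0) (g 0)
    where open Solver
          open import Data.Integer using (0ℤ)
  θ-⊛ f g (suc n) = begin
    ι (suc n) * (f 0 * g (suc n) + ((f ∘ suc) ⊛ g) n)
      ≈⟨ solve 5 (λ o m x y z → (o :+ m) :* (x :* y :+ z) := x :* ((o :+ m) :* y) :+ (o :* z :+ m :* z)) refl
           1# (ι n) (f 0) (g (suc n)) (((f ∘ suc) ⊛ g) n) ⟩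
    f 0 * θ g (suc n) + (1# * ((f ∘ suc) ⊛ g) n + θ ((f ∘ suc) ⊛ g) n)
      ≈⟨ +-congˡ (+-cong (sym (⊛-scaleˡ 1# (f ∘ suc) g n)) (θ-⊛ (f ∘ suc) g n)) ⟩
    f 0 * θ g (suc n) + (((λ k → 1# * f (suc k)) ⊛ g) n + ((θ (f ∘ suc) ⊛ g) n + ((f ∘ suc) ⊛ θ g) n))
      ≈⟨ solve 4 (λ x a b c → x :+ (a :+ (b :+ c)) := (a :+ b) :+ (x :+ c)) refl _ _ _ _ ⟩
    (((λ k → 1# * f (suc k)) ⊛ g) n + (θ (f ∘ suc) ⊛ g) n) + (f ⊛ θ g) (suc n)
      ≈⟨ +-congʳ (sym (⊛-distribʳ g (λ k → 1# * f (suc k)) (θ (f ∘ suc)) n)) ⟩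
    (((λ k → 1# * f (suc k)) ⊕ θ (f ∘ suc)) ⊛ g) n + (f ⊛ θ g) (suc n)
      ≈⟨ +-congʳ (⊛-cong′ (λ k → sym (distribʳ _ _ _)) (λ _ → refl) n) ⟩
    ((θ f ∘ suc) ⊛ g) n + (f ⊛ θ g) (suc n)
      ≈⟨ +-congʳ (sym (trans (+-congʳ (trans (*-congʳ (zeroˡ _)) (zeroˡ _))) (+-identityˡ _))) ⟩
    (θ f ⊛ g) (suc n) + (f ⊛ θ g) (suc n) ∎
    where open Solver

-- Lattice paths along a line

-- Each step is a shear of the lattice. `stepA` is (c,j) ↦ (c+j,j); it fixes (1,0), so the cone of
-- (1,0) and (p,q) is merely transported. `stepB` is (c,j) ↦ (c,c+j); it moves (1,0) to (1,1), so
-- the unimodular cone of (1,0) and (1,1) has to be added to the image. Only `stepB` subdivides.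
data Euclid : ℕ → ℕ → Set where
  base  : Euclid 0 1
  stepA : ∀ {p q} → Euclid p q → Euclid (p ℕ.+ q) q
  stepB : ∀ {p r} → Euclid p r → Euclid p (p ℕ.+ r)

euclid : ∀ p q → 0 < q → Coprime p q → Euclid p q
euclid p q = go (p ℕ.+ q) p q ℕP.≤-refl
  where
  go : ∀ fuel p q → p ℕ.+ q ≤ fuel → 0 < q → Coprime p q → Euclid p q
  go zero p q p+q≤0 0<q _ with ℕP.≤-trans (ℕP.m≤n+m q p) p+q≤0
  go zero p .0 p+q≤0 () _ | z≤n
  go (suc fuel) zero q _ _ cop with cop (q ∣0 , ∣-refl)
  ... | ≡.refl = base
  go (suc fuel) (suc p) q le 0<q cop with ℕP.≤-total q (suc p)
  ... | inj₁ q≤p with ℕP.m≤n⇒∃[o]m+o≡n q≤p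
  ...   | k , eq = ≡.subst (λ n → Euclid n q) k+q (stepA (go fuel k q fits 0<q cop′))
    where
    k+q : k ℕ.+ q ≡ suc p
    k+q = ≡.trans (ℕP.+-comm k q) eq
    fits : k ℕ.+ q ≤ fuel
    fits = ≡.subst (_≤ fuel) (≡.sym k+q) (ℕP.≤-pred (ℕP.≤-trans
             (≡.subst (suc (suc p) ≤_) (≡.cong suc (ℕP.+-comm q p)) (s≤s (ℕP.+-monoˡ-≤ p 0<q))) le))
    cop′ : Coprime k q
    cop′ {d} (d∣k , d∣q) = cop (≡.subst (d ∣_) k+q (∣m∣n⇒∣m+n d∣k d∣q) , d∣q)
  go (suc fuel) (suc p) q le 0<q cop | inj₂ p<q with ℕP.m≤n⇒∃[o]m+o≡n p<q
  -- Equal entries must both be 1 by coprimality. `stepB` would leave the entry 0, from which `base`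
  -- is not reached, so this case is a `stepA`.
  ... | zero , eq with cop (∣-refl , ≡.subst (suc p ∣_) (≡.trans (≡.sym (ℕP.+-identityʳ (suc p))) eq) ∣-refl)
  ...   | ≡.refl with eq
  ...     | ≡.refl = stepA base
  go (suc fuel) (suc p) q le 0<q cop | inj₂ p<q | suc k , ≡.refl =
    stepB (go fuel (suc p) (suc k) (ℕP.≤-pred (ℕP.≤-trans (s≤s (ℕP.m≤n+m (suc p ℕ.+ suc k) p)) le)) (s≤s z≤n)
      λ (d∣p , d∣k) → cop (d∣p , ∣m∣n⇒∣m+n d∣p d∣k))

-- The vector (`dual₁`, `dual₂`) is the last ray before (p,q) in the subdivision: it starts as (1,0)
-- next to (0,1) and undergoes the same shears, which preserve the determinant.
dual₁ dual₂ : ∀ {p q} → Euclid p q → ℕ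
dual₁ base = 1
dual₁ (stepA E) = dual₁ E ℕ.+ dual₂ E
dual₁ (stepB E) = dual₁ E
dual₂ base = 0
dual₂ (stepA E) = dual₂ E
dual₂ (stepB E) = dual₁ E ℕ.+ dual₂ E

dual-det : ∀ {p q} (E : Euclid p q) → dual₁ E ℕ.* q ≡ suc (dual₂ E ℕ.* p)
dual-det base = ≡.refl
dual-det (stepA {p} {q} E) = ≡.trans
  (≡.trans (ℕP.*-distribʳ-+ q (dual₁ E) (dual₂ E)) (≡.cong (ℕ._+ dual₂ E ℕ.* q) (dual-det E)))
  (≡.cong suc (≡.sym (ℕP.*-distribˡ-+ (dual₂ E) p q)))
dual-det (stepB {p} {r} E) = ≡.trans
  (≡.trans (ℕP.*-distribˡ-+ (dual₁ E) p r) (≡.trans (≡.cong (dual₁ E ℕ.* p ℕ.+_) (dual-det E)) (ℕP.+-suc _ _)))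
  (≡.cong suc (≡.sym (ℕP.*-distribʳ-+ p (dual₁ E) (dual₂ E))))

data Letter : Set where
  𝕒 𝕓 : Letter

-- The two shears acting on paths. The unit step that is not fixed becomes the diagonal (1,1), which
-- has to be traced by two unit steps; their order is the one that keeps the path next to the new
-- diagonal, as `hugs-substA` and `hugs-substB` verify.
substA substB : List Letter → List Letter
substA [] = []
substA (𝕒 ∷ w) = 𝕒 ∷ substA w
substA (𝕓 ∷ w) = 𝕓 ∷ 𝕒 ∷ substA w
substB [] = []
substB (𝕒 ∷ w) = 𝕒 ∷ 𝕓 ∷ substB w
substB (𝕓 ∷ w) = 𝕓 ∷ substB w

-- A Christoffel word: reading 𝕒 and 𝕓 as unit steps in the two coordinates, it traces the lattice path from
-- (0,0) to (p,q) next to the diagonal, and its 𝕓 steps start exactly at the lattice points of the half-open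
-- parallelogram of the cone generated by (1,0) and (p,q).
word : ∀ {p q} → Euclid p q → List Letter
word base = 𝕓 ∷ []
word (stepA E) = substA (word E)
word (stepB E) = substB (word E)

#a #b : List Letter → ℕ
#a [] = 0
#a (𝕒 ∷ w) = suc (#a w)
#a (𝕓 ∷ w) = #a w
#b [] = 0
#b (𝕒 ∷ w) = #b w
#b (𝕓 ∷ w) = suc (#b w)

#a-substA : ∀ w → #a (substA w) ≡ #a w ℕ.+ #b w
#a-substA [] = ≡.refl
#a-substA (𝕒 ∷ w) = ≡.cong suc (#a-substA w)
#a-substA (𝕓 ∷ w) = ≡.trans (≡.cong suc (#a-substA w)) (≡.sym (ℕP.+-suc _ _))

#b-substA : ∀ w → #b (substA w) ≡ #b w
#b-substA [] = ≡.refl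
#b-substA (𝕒 ∷ w) = #b-substA w
#b-substA (𝕓 ∷ w) = ≡.cong suc (#b-substA w)

#a-substB : ∀ w → #a (substB w) ≡ #a w
#a-substB [] = ≡.refl
#a-substB (𝕒 ∷ w) = ≡.cong suc (#a-substB w)
#a-substB (𝕓 ∷ w) = #a-substB w

#b-substB : ∀ w → #b (substB w) ≡ #a w ℕ.+ #b w
#b-substB [] = ≡.refl
#b-substB (𝕒 ∷ w) = ≡.cong suc (#b-substB w)
#b-substB (𝕓 ∷ w) = ≡.trans (≡.cong suc (#b-substB w)) (≡.sym (ℕP.+-suc _ _))

#a-word : ∀ {p q} (E : Euclid p q) → #a (word E) ≡ p
#b-word : ∀ {p q} (E : Euclid p q) → #b (word E) ≡ q
#a-word base = ≡.refl
#a-word (stepA E) = ≡.trans (#a-substA (word E)) (≡.cong₂ ℕ._+_ (#a-word E) (#b-word E))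
#a-word (stepB E) = ≡.trans (#a-substB (word E)) (#a-word E)
#b-word base = ≡.refl
#b-word (stepA E) = ≡.trans (#b-substA (word E)) (#b-word E)
#b-word (stepB E) = ≡.trans (#b-substB (word E)) (≡.cong₂ ℕ._+_ (#a-word E) (#b-word E))

-- `Above` says that c is the least number with c*q ≥ j*p, so that (c,j) is the point of row j in
-- the half-open parallelogram. `Below` is carried along for the induction: `substB` creates a `𝕓`
-- step out of an `𝕒` step, and its `Above` can only come from the `Below` of that step.
Above Below : ℕ → ℕ → ℕ → ℕ → Set
Above p q c j = ∃[ d ] (c ℕ.* q ≡ j ℕ.* p ℕ.+ d × d < q)
Below p q c j = ∃[ d ] (j ℕ.* p ≡ c ℕ.* q ℕ.+ d × 0 < d × d ≤ p)

Hugs : ℕ → ℕ → ℕ → ℕ → List Letter → Set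
Hugs p q c j [] = ⊤
Hugs p q c j (𝕒 ∷ w) = Below p q c j × Hugs p q (suc c) j w
Hugs p q c j (𝕓 ∷ w) = Above p q c j × Hugs p q c (suc j) w

hugs-substA : ∀ {p q} w c j → Hugs p q c j w → Hugs (p ℕ.+ q) q (c ℕ.+ j) j (substA w)
hugs-substA [] c j _ = tt
hugs-substA {p} {q} (𝕒 ∷ w) c j ((d , eq , 0<d , d≤p) , h) =
  (d , ≡.trans (ℕP.*-distribˡ-+ j p q) (≡.trans (≡.cong (ℕ._+ j ℕ.* q) eq)
        (solve 4 (λ c j q d → c :* q :+ d :+ j :* q := (c :+ j) :* q :+ d) ≡.refl c j q d))
     , 0<d , ℕP.≤-trans d≤p (ℕP.m≤m+n p q)) , hugs-substA w (suc c) j h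
  where open Data.Nat.Solver.+-*-Solver
hugs-substA {p} {q} (𝕓 ∷ w) c j ((d , eq , d<q) , h) with ℕP.m≤n⇒∃[o]m+o≡n d<q
... | f , ≡.refl =
  (d , ≡.trans (ℕP.*-distribʳ-+ q c j) (≡.trans (≡.cong (ℕ._+ j ℕ.* q) eq)
        (solve 4 (λ p j q d → j :* p :+ d :+ j :* q := j :* (p :+ q) :+ d) ≡.refl p j q d)) , d<q) ,
  -- The added `𝕒` step starts at (c+j, j+1), where the defect is p + (q - d); `suc f` is q - d.
  (p ℕ.+ suc f ,
    ≡.trans (solve 4 (λ p j d f → (con 1 :+ j) :* (p :+ (con 1 :+ d :+ f))
                 := (j :* p :+ d) :+ j :* (con 1 :+ d :+ f) :+ (p :+ (con 1 :+ f))) ≡.refl p j d f)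
      (≡.trans (≡.cong (λ z → z ℕ.+ j ℕ.* q ℕ.+ (p ℕ.+ suc f)) (≡.sym eq))
        (≡.cong (ℕ._+ (p ℕ.+ suc f)) (≡.sym (ℕP.*-distribʳ-+ q c j)))) ,
    ℕP.≤-trans (s≤s z≤n) (ℕP.m≤n+m (suc f) p) ,
    ℕP.+-monoʳ-≤ p (s≤s (ℕP.m≤n+m f d))) ,
  ≡.subst (λ k → Hugs (p ℕ.+ q) q k (suc j) (substA w)) (ℕP.+-suc c j) (hugs-substA w c (suc j) h)
  where open Data.Nat.Solver.+-*-Solver

hugs-substB : ∀ {p r} w c i → Hugs p r c i w → Hugs p (p ℕ.+ r) c (c ℕ.+ i) (substB w)
hugs-substB [] c i _ = tt
hugs-substB {p} {r} (𝕒 ∷ w) c i ((d , eq , 0<d , d≤p) , h) with ℕP.m≤n⇒∃[o]m+o≡n d≤p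
... | f , ≡.refl =
  (d , ≡.trans (ℕP.*-distribʳ-+ p c i) (≡.trans (≡.cong (c ℕ.* p ℕ.+_) eq)
        (solve 4 (λ c p r d → c :* p :+ (c :* r :+ d) := c :* (p :+ r) :+ d) ≡.refl c p r d)) , 0<d , d≤p) ,
  -- The added `𝕓` step starts at (c+1, c+i), where the defect is (p - d) + r, with `f` for p - d.
  -- It is less than p + r because d > 0, which is why `Below` is strict.
  (f ℕ.+ r ,
    ≡.trans (solve 4 (λ c d f r → (con 1 :+ c) :* (d :+ f :+ r)
                 := c :* (d :+ f) :+ (c :* r :+ d) :+ (f :+ r)) ≡.refl c d f r)
      (≡.trans (≡.cong (λ z → c ℕ.* p ℕ.+ z ℕ.+ (f ℕ.+ r)) (≡.sym eq))
        (≡.cong (ℕ._+ (f ℕ.+ r)) (≡.sym (ℕP.*-distribʳ-+ p c i)))) ,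
    ℕP.+-monoˡ-≤ r (ℕP.+-monoˡ-≤ f 0<d)) ,
  hugs-substB w (suc c) i h
  where open Data.Nat.Solver.+-*-Solver
hugs-substB {p} {r} (𝕓 ∷ w) c i ((d , eq , d<r) , h) =
  (d , ≡.trans (ℕP.*-distribˡ-+ c p r) (≡.trans (≡.cong (c ℕ.* p ℕ.+_) eq)
        (solve 4 (λ c i p d → c :* p :+ (i :* p :+ d) := (c :+ i) :* p :+ d) ≡.refl c i p d)) ,
       ℕP.≤-trans d<r (ℕP.m≤n+m r p)) ,
  ≡.subst (λ k → Hugs p (p ℕ.+ r) c k (substB w)) (ℕP.+-suc c i) (hugs-substB w c (suc i) h)
  where open Data.Nat.Solver.+-*-Solver

hugs-word : ∀ {p q} (E : Euclid p q) → Hugs p q 0 0 (word E)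
hugs-word base = (0 , ≡.refl , s≤s z≤n) , tt
hugs-word (stepA E) = hugs-substA (word E) 0 0 (hugs-word E)
hugs-word (stepB E) = hugs-substB (word E) 0 0 (hugs-word E)

-- Sums over the `𝕓` steps of a path.

module PathSums {c ℓ : Level} (S : CommutativeRing c ℓ) where
  open CommutativeRing S hiding (zero)
  open RingLemmas S
  open Relation.Binary.Reasoning.Setoid setoid

  pathSum : (ℕ → ℕ → Carrier) → ℕ → ℕ → List Letter → Carrier
  pathSum g c j [] = 0#
  pathSum g c j (𝕒 ∷ w) = pathSum g (suc c) j w
  pathSum g c j (𝕓 ∷ w) = g c j + pathSum g c (suc j) w

  pathSum-cong : ∀ {g h} → (∀ c j → g c j ≈ h c j) → ∀ c j w → pathSum g c j w ≈ pathSum h c j w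
  pathSum-cong eq c j [] = refl
  pathSum-cong eq c j (𝕒 ∷ w) = pathSum-cong eq (suc c) j w
  pathSum-cong eq c j (𝕓 ∷ w) = +-cong (eq c j) (pathSum-cong eq c (suc j) w)

  pathSum-*ˡ : ∀ k g c j w → k * pathSum g c j w ≈ pathSum (λ c j → k * g c j) c j w
  pathSum-*ˡ k g c j [] = zeroʳ _
  pathSum-*ˡ k g c j (𝕒 ∷ w) = pathSum-*ˡ k g (suc c) j w
  pathSum-*ˡ k g c j (𝕓 ∷ w) = trans (distribˡ _ _ _) (+-congˡ (pathSum-*ˡ k g c (suc j) w))

  pathSum-substA : ∀ g c j w → pathSum g (c ℕ.+ j) j (substA w) ≈ pathSum (λ c j → g (c ℕ.+ j) j) c j w
  pathSum-substA g c j [] = refl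
  pathSum-substA g c j (𝕒 ∷ w) = pathSum-substA g (suc c) j w
  pathSum-substA g c j (𝕓 ∷ w) = +-congˡ (trans
    (reflexive (≡.cong (λ k → pathSum g k (suc j) (substA w)) (≡.sym (ℕP.+-suc c j)))) (pathSum-substA g c (suc j) w))

  -- The `𝕓` steps leave the rows j, j+1, ... once each, and `Above` fixes the other coordinate; so
  -- a path sum is an ordinary sum over rows.
  pathSum-Σ : ∀ {p q g} (G : ℕ → Carrier) → (∀ c j → Above p q c j → g c j ≈ G j) →
              ∀ c j w → Hugs p q c j w → pathSum g c j w ≈ Σ (#b w) (λ k → G (j ℕ.+ k))
  pathSum-Σ G eq c j [] h = refl
  pathSum-Σ G eq c j (𝕒 ∷ w) (_ , h) = pathSum-Σ G eq (suc c) j w h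
  pathSum-Σ {g = g} G eq c j (𝕓 ∷ w) (ab , h) = begin
    g c j + pathSum g c (suc j) w
      ≈⟨ +-cong (trans (eq c j ab) (reflexive (≡.cong G (≡.sym (ℕP.+-identityʳ j))))) (pathSum-Σ G eq c (suc j) w h) ⟩
    G (j ℕ.+ 0) + Σ (#b w) (λ k → G (suc j ℕ.+ k))
      ≈⟨ +-congˡ (Σ-cong (#b w) (λ k → reflexive (≡.cong G (≡.sym (ℕP.+-suc j k))))) ⟩
    G (j ℕ.+ 0) + Σ (#b w) (λ k → G (j ℕ.+ suc k))
      ≈⟨ Σ-front (#b w) (λ k → G (j ℕ.+ k)) ⟨
    Σ (suc (#b w)) (λ k → G (j ℕ.+ k)) ∎

  module _ (e : ℕ → Carrier) (e-+ : ∀ m n → e (m ℕ.+ n) ≈ e m * e n) where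

    weight : ℕ → ℕ → ℕ → ℕ → Carrier
    weight u v c j = e (c ℕ.* u ℕ.+ j ℕ.* v)

    private
      weight-a : ∀ u v c j → weight u v (suc c) j ≈ e u * weight u v c j
      weight-a u v c j = trans (reflexive (≡.cong e (ℕP.+-assoc u (c ℕ.* u) (j ℕ.* v)))) (e-+ u _)

      weight-b : ∀ u v c j → weight u v c (suc j) ≈ e v * weight u v c j
      weight-b u v c j = trans (reflexive (≡.cong e
        (solve 4 (λ u v c j → c :* u :+ (v :+ j :* v) := v :+ (c :* u :+ j :* v)) ≡.refl u v c j))) (e-+ v _)
        where open Data.Nat.Solver.+-*-Solver

      weight-shear : ∀ u v c i → weight u v c (c ℕ.+ i) ≈ weight (u ℕ.+ v) v c i
      weight-shear u v c i = reflexive (≡.cong e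
        (solve 4 (λ u v c i → c :* u :+ (c :+ i) :* v := c :* (u :+ v) :+ i :* v) ≡.refl u v c i))
        where open Data.Nat.Solver.+-*-Solver

    -- For the whole word this is the relation between numerators that `subdivision` needs, the
    -- bracket being 1 minus the weight of the end point. On a partial word the bracket is the
    -- difference of the weights at both ends. It telescopes: in the coordinates before the shear,
    -- an `𝕒` step multiplies the weight by `e (u ℕ.+ v)` and a `𝕓` step by `e v`.
    pathSum-substB : ∀ u v c i w →
      (1# - e (u ℕ.+ v)) * pathSum (weight u v) c (c ℕ.+ i) (substB w) ≈
      e u * (weight (u ℕ.+ v) v c i - weight (u ℕ.+ v) v (c ℕ.+ #a w) (i ℕ.+ #b w))
        + (1# - e u) * pathSum (weight (u ℕ.+ v) v) c i w
    pathSum-substB u v c i [] rewrite ℕP.+-identityʳ c | ℕP.+-identityʳ i =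
      solve 4 (λ o x y z → x :* con (+ 0) := y :* (z :- z) :+ (o :- y) :* con (+ 0)) refl 1# _ _ _
      where open Solver
    pathSum-substB u v c i (𝕒 ∷ w) rewrite ℕP.+-suc c (#a w) = begin
      (1# - W) * (weight u v (suc c) (c ℕ.+ i) + rest)
        ≈⟨ distribˡ _ _ _ ⟩
      (1# - W) * weight u v (suc c) (c ℕ.+ i) + (1# - W) * rest
        ≈⟨ +-cong (*-congˡ (trans (weight-a u v c (c ℕ.+ i)) (*-congˡ (weight-shear u v c i)))) (pathSum-substB u v (suc c) i w) ⟩
      (1# - W) * (e u * g) + (e u * (weight (u ℕ.+ v) v (suc c) i - end) + rest′)
        ≈⟨ +-congˡ (+-congʳ (*-congˡ (+-congʳ (weight-a (u ℕ.+ v) v c i)))) ⟩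
      (1# - W) * (e u * g) + (e u * (W * g - end) + rest′)
        ≈⟨ +-congʳ (trans (distribʳ _ _ _) (+-congʳ (*-identityˡ _))) ⟩
      (e u * g + (- W) * (e u * g)) + (e u * (W * g - end) + rest′)
        ≈⟨ solve 5 (λ W U g en r → (U :* g :+ (:- W) :* (U :* g)) :+ (U :* (W :* g :- en) :+ r) := U :* (g :- en) :+ r)
             refl W (e u) g end rest′ ⟩
      e u * (g - end) + rest′ ∎
      where
      open Solver
      W g end rest rest′ : Carrier
      W = e (u ℕ.+ v)
      g = weight (u ℕ.+ v) v c i
      end = weight (u ℕ.+ v) v (suc c ℕ.+ #a w) (i ℕ.+ #b w)
      rest = pathSum (weight u v) (suc c) (suc c ℕ.+ i) (substB w)
      rest′ = (1# - e u) * pathSum (weight (u ℕ.+ v) v) (suc c) i w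
    pathSum-substB u v c i (𝕓 ∷ w) rewrite ℕP.+-suc i (#b w) = begin
      (1# - W) * (weight u v c (c ℕ.+ i) + pathSum (weight u v) c (suc (c ℕ.+ i)) (substB w))
        ≡⟨ ≡.cong (λ k → (1# - W) * (weight u v c (c ℕ.+ i) + pathSum (weight u v) c k (substB w))) (≡.sym (ℕP.+-suc c i)) ⟩
      (1# - W) * (weight u v c (c ℕ.+ i) + pathSum (weight u v) c (c ℕ.+ suc i) (substB w))
        ≈⟨ distribˡ _ _ _ ⟩
      (1# - W) * weight u v c (c ℕ.+ i) + (1# - W) * pathSum (weight u v) c (c ℕ.+ suc i) (substB w)
        ≈⟨ +-cong (*-cong (+-congˡ (-‿cong (e-+ u v))) (weight-shear u v c i)) (pathSum-substB u v c (suc i) w) ⟩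
      (1# - e u * e v) * g + (e u * (weight (u ℕ.+ v) v c (suc i) - end) + (1# - e u) * rest)
        ≈⟨ +-congˡ (+-congʳ (*-congˡ (+-congʳ (weight-b (u ℕ.+ v) v c i)))) ⟩
      (1# - e u * e v) * g + (e u * (e v * g - end) + (1# - e u) * rest)
        ≈⟨ solve 6 (λ o U V g en r → (o :- U :* V) :* g :+ (U :* (V :* g :- en) :+ (o :- U) :* r)
                                   := U :* (g :- en) :+ (o :- U) :* (g :+ r)) refl 1# (e u) (e v) g end rest ⟩
      e u * (g - end) + (1# - e u) * (g + rest) ∎
      where
      open Solver
      W g end rest : Carrier
      W = e (u ℕ.+ v)
      g = weight (u ℕ.+ v) v c i
      end = weight (u ℕ.+ v) v (c ℕ.+ #a w) (suc (i ℕ.+ #b w))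
      rest = pathSum (weight (u ℕ.+ v) v) c (suc i) w

-- Continued fractions

-- Continuants. The empty list stands for 1/0, the convergent with (p_0, q_0) = (0, 1), so that
-- putting x in front of h/k gives (xh + k)/h without exception.
num den : List ℕ → ℕ
num [] = 1
num (x ∷ xs) = x ℕ.* num xs ℕ.+ den xs
den [] = 0
den (x ∷ xs) = num xs

num-den-coprime : ∀ xs → Coprime (num xs) (den xs)
num-den-coprime [] (d∣1 , _) = ∣1⇒≡1 d∣1
num-den-coprime (x ∷ xs) (d∣n , d∣d) =
  num-den-coprime xs (d∣d , ∣m+n∣m⇒∣n d∣n (∣n⇒∣m*n x d∣d))

num-positive : ∀ {xs} → All (1 ≤_) xs → 1 ≤ num xs
num-positive [] = ℕP.≤-refl
num-positive {x ∷ xs} (1≤x ∷ ps) = ℕP.≤-trans (ℕP.*-mono-≤ 1≤x (num-positive ps)) (ℕP.m≤m+n _ _)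

recip-nonZero : ∀ r (r≢0 : r ≢ 0ℚ) → recip r ≡ ℚ.1/_ r {{ℚ.≢-nonZero r≢0}}
recip-nonZero r r≢0 with r ℚP.≟ 0ℚ
... | yes r≡0 = contradiction r≡0 r≢0
... | no _ = ≡.refl

+-recip : ∀ x m n .(c : Coprime (suc m) (suc n)) .(c′ : Coprime (x ℕ.* suc m ℕ.+ suc n) (suc m)) →
          ℚfromℕ x ℚ.+ recip (mkℚ (+ suc m) n c) ≡ mkℚ (+ (x ℕ.* suc m ℕ.+ suc n)) m c′
+-recip x m n c c′ =
  ≡.trans (≡.cong₂ ℚ._+_ (ℚP.normalize-coprime {x} {0} (Coprimality.sym (Coprimality.1-coprimeTo x)))
                         (recip-nonZero (mkℚ (+ suc m) n c) λ ()))
    (≡.trans (ℚP./-cong eq (ℕP.+-identityʳ (suc m))) (ℚP.normalize-coprime c′))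
  where
  eq : + x ℤ.* + suc m ℤ.+ + suc n ℤ.* + 1 ≡ + (x ℕ.* suc m ℕ.+ suc n)
  eq = ≡.cong₂ ℤ._+_ (≡.sym (ℤP.pos-* x (suc m))) (ℤP.*-identityʳ (+ suc n))

private
  -- Equality with a literal `mkℚ` for every proof of coprimality. Since continuants are coprime, no
  -- reduction takes place, and `↥` and `↧ₙ` can be read off.
  IsFrac : ℚ → ℕ → ℕ → Set
  IsFrac r m n = ∃[ k ] (n ≡ suc k × (∀ .(c : Coprime m (suc k)) → r ≡ mkℚ (+ m) k c))

  isFrac-step : ∀ x {r m n} → 1 ≤ m → Coprime m n → IsFrac r m n → IsFrac (ℚfromℕ x ℚ.+ recip r) (x ℕ.* m ℕ.+ n) m
  isFrac-step x {m = suc m} _ cop (k , ≡.refl , r≡) =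
    m , ≡.refl , λ c → ≡.trans (≡.cong (λ r → ℚfromℕ x ℚ.+ recip r) (r≡ cop)) (+-recip x m k cop c)

  cf-isFrac : ∀ x xs → All (1 ≤_) (x ∷ xs) → IsFrac (cf (x ∷ xs)) (num (x ∷ xs)) (den (x ∷ xs))
  cf-isFrac x [] _ rewrite ℕP.*-identityʳ x | ℕP.+-identityʳ x = 0 , ≡.refl , λ c → ℚP.normalize-coprime c
  cf-isFrac x (y ∷ ys) (_ ∷ ps) = isFrac-step x (num-positive ps) (num-den-coprime (y ∷ ys)) (cf-isFrac y ys ps)

cf-frac : ∀ x xs → All (1 ≤_) (x ∷ xs) →
          ↥ (cf (x ∷ xs)) ≡ + num (x ∷ xs) × ↧ₙ (cf (x ∷ xs)) ≡ den (x ∷ xs)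
cf-frac x xs ps with cf-isFrac x xs ps
... | k , den≡ , cf≡ rewrite cf≡ (≡.subst (Coprime (num (x ∷ xs))) den≡ (num-den-coprime (x ∷ xs))) =
  ≡.refl , ≡.sym den≡

-- A list and its truncation have the same head, so the induction runs from the front: prepending x
-- applies to both fractions the matrix with rows (x,1) and (1,0), of determinant -1.
convergent-det : ∀ x xs → let prev = take (length xs) (x ∷ xs) in
  + num (x ∷ xs) ℤ.* + den prev ℤ.- + den (x ∷ xs) ℤ.* + num prev ≡ ℤ.- signℤ (length xs)
convergent-det x [] rewrite ℕP.*-identityʳ x | ℕP.+-identityʳ x | ℤP.*-zeroʳ (+ x) = ≡.refl
convergent-det x (y ∷ ys) = ≡.trans
  (≡.trans (≡.cong₂ (λ m n → m ℤ.* + num prev ℤ.- + num (y ∷ ys) ℤ.* n) (expand (num (y ∷ ys)) (den (y ∷ ys)))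
                    (expand (num prev) (den prev)))
    (solve 5 (λ x h k h′ k′ → (x :* h :+ k) :* h′ :- h :* (x :* h′ :+ k′) := :- (h :* k′ :- k :* h′)) ≡.refl
       (+ x) (+ num (y ∷ ys)) (+ den (y ∷ ys)) (+ num prev) (+ den prev)))
  (≡.cong ℤ.-_ (convergent-det y ys))
  where
  open Data.Integer.Solver.+-*-Solver
  prev = take (length ys) (y ∷ ys)
  expand : ∀ m n → + (x ℕ.* m ℕ.+ n) ≡ + x ℤ.* + m ℤ.+ + n
  expand m n = ≡.cong (ℤ._+ + n) (ℤP.pos-* x m)

all-take : ∀ n {xs : List ℕ} → All (1 ≤_) xs → All (1 ≤_) (take n xs)
all-take zero ps = []
all-take (suc n) [] = []
all-take (suc n) (p ∷ ps) = p ∷ all-take n ps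

cfNum-num : ∀ x xs → All (1 ≤_) (x ∷ xs) → ∀ k → cfNum (x ∷ xs) k ≡ + num (take k (x ∷ xs))
cfNum-num x xs ps zero = ≡.refl
cfNum-num x xs ps (suc k) = proj₁ (cf-frac x (take k xs) (all-take (suc k) ps))

sign² : ∀ n → signℤ n ℤ.* signℤ n ≡ + 1
sign² zero = ≡.refl
sign² (suc n) = ≡.trans (solve 1 (λ s → (:- s) :* (:- s) := s :* s) ≡.refl (signℤ n)) (sign² n)
  where open Data.Integer.Solver.+-*-Solver

-- The determinant of the last two convergents, multiplied by minus the sign σ. As σ² = 1, the
-- coefficient of q is the signed denominator σ p_{n-1} of the truncated fraction.
cf-inverse : ∀ {p q} as → 0 < length as → All (1 ≤_) as → ↥ (cf as) ≡ + q → ↧ₙ (cf as) ≡ p →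
  ∃[ k ] (signℤ (length as ℕ.∸ 1) ℤ.* cfNum as (length as ℕ.∸ 1)) ℤ.* + p ≡ + 1 ℤ.+ + q ℤ.* k
cf-inverse {p} {q} (x ∷ xs) _ ps q≡ p≡ = σ ℤ.* + den prev , (begin
  (σ ℤ.* cfNum (x ∷ xs) (length xs)) ℤ.* + p
    ≡⟨ ≡.cong (λ z → (σ ℤ.* z) ℤ.* + p) (cfNum-num x xs ps (length xs)) ⟩
  (σ ℤ.* + num prev) ℤ.* + p
    ≡⟨ solve 5 (λ s h p q k → (s :* h) :* p := (:- s) :* (q :* k :- p :* h) :+ q :* (s :* k)) ≡.refl
         σ (+ num prev) (+ p) (+ q) (+ den prev) ⟩
  (ℤ.- σ) ℤ.* (+ q ℤ.* + den prev ℤ.- + p ℤ.* + num prev) ℤ.+ + q ℤ.* (σ ℤ.* + den prev)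
    ≡⟨ ≡.cong (λ z → (ℤ.- σ) ℤ.* z ℤ.+ + q ℤ.* (σ ℤ.* + den prev)) det ⟩
  (ℤ.- σ) ℤ.* (ℤ.- σ) ℤ.+ + q ℤ.* (σ ℤ.* + den prev)
    ≡⟨ ≡.cong (ℤ._+ + q ℤ.* (σ ℤ.* + den prev)) (sign² (suc (length xs))) ⟩
  + 1 ℤ.+ + q ℤ.* (σ ℤ.* + den prev) ∎)
  where
  open Data.Integer.Solver.+-*-Solver
  open ≡.≡-Reasoning
  σ = signℤ (length xs)
  prev = take (length xs) (x ∷ xs)
  frac = cf-frac x xs ps
  det : + q ℤ.* + den prev ℤ.- + p ℤ.* + num prev ≡ ℤ.- σ
  det = ≡.trans (≡.cong₂ (λ m n → m ℤ.* + den prev ℤ.- + n ℤ.* + num prev)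
                 (≡.trans (≡.sym q≡) (proj₁ frac)) (≡.trans (≡.sym p≡) (proj₂ frac))) (convergent-det x xs)

-- Integer polynomials

nth : ∀ {a} {A : Set a} → A → List A → ℕ → A
nth z [] n = z
nth z (x ∷ xs) zero = x
nth z (x ∷ xs) (suc n) = nth z xs n

infixl 6 _⊞_
_⊞_ : List ℤ → List ℤ → List ℤ
[] ⊞ M = M
(x ∷ L) ⊞ [] = x ∷ L
(x ∷ L) ⊞ (y ∷ M) = x ℤ.+ y ∷ L ⊞ M

infixl 7 _⊠_
_⊠_ : List ℤ → List ℤ → List ℤ
[] ⊠ M = []
(x ∷ L) ⊠ M = map (x ℤ.*_) M ⊞ (+ 0 ∷ L ⊠ M)

powL : List ℤ → ℕ → List ℤ
powL L zero = + 1 ∷ []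
powL L (suc n) = L ⊠ powL L n

linL : ℤ → ℤ → List ℤ
linL u v = v ∷ u ∷ []

coeff : List ℤ → ℕ → ℤ
coeff = nth (+ 0)

module ℤSeries = PowerSeries ℤP.+-*-commutativeRing

coeff-⊞ : ∀ L M n → coeff (L ⊞ M) n ≡ coeff L n ℤ.+ coeff M n
coeff-⊞ [] M n = ≡.sym (ℤP.+-identityˡ _)
coeff-⊞ (x ∷ L) [] n = ≡.sym (ℤP.+-identityʳ _)
coeff-⊞ (x ∷ L) (y ∷ M) zero = ≡.refl
coeff-⊞ (x ∷ L) (y ∷ M) (suc n) = coeff-⊞ L M n

coeff-map-* : ∀ x M n → coeff (map (x ℤ.*_) M) n ≡ x ℤ.* coeff M n
coeff-map-* x [] n = ≡.sym (ℤP.*-zeroʳ x)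
coeff-map-* x (y ∷ M) zero = ≡.refl
coeff-map-* x (y ∷ M) (suc n) = coeff-map-* x M n

coeff-⊠ : ∀ L M n → coeff (L ⊠ M) n ≡ (coeff L ℤSeries.⊛ coeff M) n
coeff-⊠ [] M n = ≡.sym (ℤSeries.0⊛ (λ _ → + 0) (coeff M) (λ _ → ≡.refl) n)
coeff-⊠ (x ∷ L) M zero = ≡.trans (coeff-⊞ (map (x ℤ.*_) M) _ 0)
  (≡.trans (ℤP.+-identityʳ _) (coeff-map-* x M 0))
coeff-⊠ (x ∷ L) M (suc n) = ≡.trans (coeff-⊞ (map (x ℤ.*_) M) _ (suc n))
  (≡.cong₂ ℤ._+_ (coeff-map-* x M (suc n)) (coeff-⊠ L M n))

hmul-⊛ : ∀ f g n → hmul f g n ≡ (f ℤSeries.⊛ g) n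
hmul-⊛ f g n = ≡.trans (sumℤ-Σ (suc n) _) (≡.sym (ℤSeries.⊛-coeff f g n))
  where
  sumℤ-Σ : ∀ m h → sumℤ m h ≡ RingLemmas.Σ ℤP.+-*-commutativeRing m h
  sumℤ-Σ zero h = ≡.refl
  sumℤ-Σ (suc m) h = ≡.cong (ℤ._+ h m) (sumℤ-Σ m h)

-- Setting y = 1 loses nothing: the index of an `HPoly` is the exponent of x alone, and both
-- products are the Cauchy product of coefficient sequences. So the polynomials of the statement
-- become lists that can be evaluated.
coeff-hmul : ∀ {f g} L M → (∀ n → coeff L n ≡ f n) → (∀ n → coeff M n ≡ g n) → ∀ n → coeff (L ⊠ M) n ≡ hmul f g n
coeff-hmul {f} {g} L M f≡ g≡ n =
  ≡.trans (coeff-⊠ L M n) (≡.trans (ℤSeries.⊛-cong′ f≡ g≡ n) (≡.sym (hmul-⊛ f g n)))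

coeff-lin : ∀ u v n → coeff (linL u v) n ≡ lin u v n
coeff-lin u v zero = ≡.refl
coeff-lin u v (suc zero) = ≡.refl
coeff-lin u v (suc (suc n)) = ≡.refl

coeff-hpow : ∀ {f} L → (∀ n → coeff L n ≡ f n) → ∀ k n → coeff (powL L k) n ≡ hpow f k n
coeff-hpow L f≡ zero zero = ≡.refl
coeff-hpow L f≡ zero (suc n) = ≡.refl
coeff-hpow L f≡ (suc k) = coeff-hmul L (powL L k) f≡ (coeff-hpow L f≡ k)

module FieldLemmas {c ℓ : Level} (K : CommutativeRing c ℓ) (inv : CommutativeRing.Carrier K → CommutativeRing.Carrier K)
                   (isInv : IsFieldInverse K inv) (char0 : CharZero K) where
  open CommutativeRing K hiding (zero)
  open RingLemmas K
  open Relation.Binary.Reasoning.Setoid setoid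

  ι≉0 : ∀ {n} → 0 < n → ¬ (ι n ≈ 0#)
  ι≉0 {n} 0<n eq with char0 n eq
  ι≉0 () eq | ≡.refl

  *-cancel : ∀ {x y z} → ¬ (x ≈ 0#) → x * y ≈ x * z → y ≈ z
  *-cancel {x} {y} {z} x≉0 eq = begin
    y                 ≈⟨ unfold y ⟩
    inv x * (x * y)   ≈⟨ *-congˡ eq ⟩
    inv x * (x * z)   ≈⟨ unfold z ⟨
    z                 ∎
    where
    unfold : ∀ w → w ≈ inv x * (x * w)
    unfold w = sym (trans (sym (*-assoc _ _ _)) (trans (*-congʳ (trans (*-comm _ _) (isInv x x≉0))) (*-identityˡ w)))

  ι-cancel : ∀ {n} → 0 < n → ∀ {y z} → ι n * y ≈ ι n * z → y ≈ z
  ι-cancel 0<n = *-cancel (ι≉0 0<n)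

-- Polynomials determined by their values at large natural numbers.

module Polynomials {c ℓ : Level} (K : CommutativeRing c ℓ) (inv : CommutativeRing.Carrier K → CommutativeRing.Carrier K)
                   (isInv : IsFieldInverse K inv) (char0 : CharZero K) where
  open CommutativeRing K hiding (zero)
  open RingLemmas K
  open FieldLemmas K inv isInv char0
  open Relation.Binary.Reasoning.Setoid setoid

  eval : List Carrier → Carrier → Carrier
  eval [] x = 0#
  eval (y ∷ ys) x = y + x * eval ys x

  -- Synthetic division by x - x₀ (Ruffini-Horner): the coefficients of the quotient are the Horner
  -- values of the tails at x₀.
  quotient : Carrier → List Carrier → List Carrier
  quotient x₀ [] = []
  quotient x₀ (y ∷ []) = []
  quotient x₀ (y ∷ z ∷ zs) = eval (z ∷ zs) x₀ ∷ quotient x₀ (z ∷ zs)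

  quotient-spec : ∀ x₀ ys x → eval ys x - eval ys x₀ ≈ (x - x₀) * eval (quotient x₀ ys) x
  quotient-spec x₀ [] x = trans (-‿inverseʳ _) (sym (zeroʳ _))
  quotient-spec x₀ (y ∷ []) x = solve 3 (λ y x x₀ → (y :+ x :* con (+ 0)) :- (y :+ x₀ :* con (+ 0)) := (x :- x₀) :* con (+ 0)) refl y x x₀
    where open Solver
  quotient-spec x₀ (y ∷ z ∷ zs) x = begin
    (y + x * e) - (y + x₀ * e₀)
      ≈⟨ solve 5 (λ y x x₀ e e₀ → (y :+ x :* e) :- (y :+ x₀ :* e₀) := x :* (e :- e₀) :+ (x :- x₀) :* e₀) refl y x x₀ e e₀ ⟩
    x * (e - e₀) + (x - x₀) * e₀
      ≈⟨ +-congʳ (*-congˡ (quotient-spec x₀ (z ∷ zs) x)) ⟩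
    x * ((x - x₀) * eval (quotient x₀ (z ∷ zs)) x) + (x - x₀) * e₀
      ≈⟨ solve 4 (λ x d e₀ r → x :* (d :* r) :+ d :* e₀ := d :* (e₀ :+ x :* r)) refl x (x - x₀) e₀ (eval (quotient x₀ (z ∷ zs)) x) ⟩
    (x - x₀) * (e₀ + x * eval (quotient x₀ (z ∷ zs)) x) ∎
    where
    open Solver
    e e₀ : Carrier
    e = eval (z ∷ zs) x
    e₀ = eval (z ∷ zs) x₀

  quotient-zero : ∀ x₀ ys → eval ys x₀ ≈ 0# → All (_≈ 0#) (quotient x₀ ys) → All (_≈ 0#) ys
  quotient-zero x₀ [] _ _ = []
  quotient-zero x₀ (y ∷ []) e≈0 _ = trans (sym (trans (+-congˡ (zeroʳ _)) (+-identityʳ _))) e≈0 ∷ []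
  quotient-zero x₀ (y ∷ z ∷ zs) e≈0 (p ∷ ps) =
    trans (sym (trans (+-congˡ (trans (*-congˡ p) (zeroʳ _))) (+-identityʳ _))) e≈0 ∷ quotient-zero x₀ (z ∷ zs) p ps

  -- Without decidable equality a polynomial has no degree to compare with a number of roots.
  -- Instead the root x₀ is divided out; the quotient has a shorter list and vanishes from x₀ + 1
  -- on, because x - x₀ is a nonzero natural number there.
  vanishing : ∀ x₀ ys → (∀ x → x₀ ≤ x → eval ys (ι x) ≈ 0#) → All (_≈ 0#) ys
  vanishing x₀ ys = go (length ys) x₀ ys ℕP.≤-refl
    where
    quotient-length : ∀ x₀ y ys → length (quotient x₀ (y ∷ ys)) ≡ length ys
    quotient-length x₀ y [] = ≡.refl
    quotient-length x₀ y (z ∷ zs) = ≡.cong suc (quotient-length x₀ z zs)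

    go : ∀ n x₀ ys → length ys ≤ n → (∀ x → x₀ ≤ x → eval ys (ι x) ≈ 0#) → All (_≈ 0#) ys
    go n x₀ [] _ _ = []
    go (suc n) x₀ (y ∷ ys) (s≤s len) ev≈0 =
      quotient-zero (ι x₀) (y ∷ ys) ev₀ (go n (suc x₀) (quotient (ι x₀) (y ∷ ys))
        (≡.subst (_≤ n) (≡.sym (quotient-length (ι x₀) y ys)) len) ev≈0′)
      where
      ev₀ : eval (y ∷ ys) (ι x₀) ≈ 0#
      ev₀ = ev≈0 x₀ ℕP.≤-refl
      ev≈0′ : ∀ x → suc x₀ ≤ x → eval (quotient (ι x₀) (y ∷ ys)) (ι x) ≈ 0#
      ev≈0′ x x₀<x with ℕP.m≤n⇒∃[o]m+o≡n x₀<x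
      ... | k , ≡.refl = ι-cancel {suc k} (s≤s z≤n) (begin
        ι (suc k) * eval (quotient (ι x₀) (y ∷ ys)) (ι x)
          ≈⟨ *-congʳ difference ⟨
        (ι x - ι x₀) * eval (quotient (ι x₀) (y ∷ ys)) (ι x)
          ≈⟨ quotient-spec (ι x₀) (y ∷ ys) (ι x) ⟨
        eval (y ∷ ys) (ι x) - eval (y ∷ ys) (ι x₀)
          ≈⟨ +-cong (ev≈0 x (ℕP.<⇒≤ x₀<x)) (-‿cong ev₀) ⟩
        0# - 0#            ≈⟨ -‿inverseʳ _ ⟩
        0#                 ≈⟨ zeroʳ _ ⟨
        ι (suc k) * 0#     ∎)
        where
        difference : ι x - ι x₀ ≈ ι (suc k)
        difference = trans (+-congʳ (trans (reflexive (≡.cong ι (≡.sym (ℕP.+-suc x₀ k)))) (ι-+ x₀ (suc k))))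
          (solve 2 (λ m n → (m :+ n) :- m := n) refl (ι x₀) (ι (suc k)))
          where open Solver

  all-nth : ∀ {ys} → All (_≈ 0#) ys → ∀ n → nth 0# ys n ≈ 0#
  all-nth [] n = refl
  all-nth (p ∷ ps) zero = p
  all-nth (p ∷ ps) (suc n) = all-nth ps n

  tabulate : ℕ → (ℕ → Carrier) → List Carrier
  tabulate zero f = []
  tabulate (suc n) f = f 0 ∷ tabulate n (f ∘ suc)

  eval-tabulate : ∀ n f x → eval (tabulate n f) x ≈ Σ n (λ i → f i * x ^ i)
  eval-tabulate zero f x = refl
  eval-tabulate (suc n) f x = begin
    f 0 + x * eval (tabulate n (f ∘ suc)) x
      ≈⟨ +-cong (sym (*-identityʳ _)) (*-congˡ (eval-tabulate n (f ∘ suc) x)) ⟩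
    f 0 * 1# + x * Σ n (λ i → f (suc i) * x ^ i)
      ≈⟨ +-congˡ (trans (Σ-*ˡ n x _) (Σ-cong n λ i → solve 3 (λ x f p → x :* (f :* p) := f :* (x :* p)) refl x (f (suc i)) (x ^ i))) ⟩
    f 0 * 1# + Σ n (λ i → f (suc i) * x ^ suc i)
      ≈⟨ Σ-front n (λ i → f i * x ^ i) ⟨
    Σ (suc n) (λ i → f i * x ^ i) ∎
    where open Solver

  nth-tabulate : ∀ n f i → i < n → nth 0# (tabulate n f) i ≈ f i
  nth-tabulate (suc n) f zero _ = refl
  nth-tabulate (suc n) f (suc i) (s≤s i<n) = nth-tabulate n (f ∘ suc) i i<n

  subtract : List Carrier → List ℤ → List Carrier
  subtract [] M = map (λ z → - intK K z) M
  subtract (y ∷ ys) [] = y ∷ ys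
  subtract (y ∷ ys) (z ∷ zs) = (y - intK K z) ∷ subtract ys zs

  evalℤ : List ℤ → Carrier → Carrier
  evalℤ [] x = 0#
  evalℤ (z ∷ zs) x = intK K z + x * evalℤ zs x

  eval-subtract : ∀ ys zs x → eval (subtract ys zs) x ≈ eval ys x - evalℤ zs x
  eval-subtract [] [] x = sym (-‿inverseʳ _)
  eval-subtract [] (z ∷ zs) x = begin
    - intK K z + x * eval (subtract [] zs) x   ≈⟨ +-congˡ (*-congˡ (eval-subtract [] zs x)) ⟩
    - intK K z + x * (0# - evalℤ zs x)         ≈⟨ solve 3 (λ z x e → (:- z) :+ x :* (con (+ 0) :- e) := con (+ 0) :- (z :+ x :* e)) refl _ x _ ⟩
    0# - (intK K z + x * evalℤ zs x)           ∎
    where open Solver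
  eval-subtract (y ∷ ys) [] x = solve 1 (λ e → e := e :- con (+ 0)) refl _
    where open Solver
  eval-subtract (y ∷ ys) (z ∷ zs) x = begin
    (y - intK K z) + x * eval (subtract ys zs) x           ≈⟨ +-congˡ (*-congˡ (eval-subtract ys zs x)) ⟩
    (y - intK K z) + x * (eval ys x - evalℤ zs x)          ≈⟨ solve 5 (λ y z x e f → (y :- z) :+ x :* (e :- f) := (y :+ x :* e) :- (z :+ x :* f)) refl _ _ x _ _ ⟩
    (y + x * eval ys x) - (intK K z + x * evalℤ zs x)      ∎
    where open Solver

  nth-subtract : ∀ ys zs n → nth 0# (subtract ys zs) n ≈ nth 0# ys n - intK K (coeff zs n)
  nth-subtract [] [] n = sym (-‿inverseʳ _)
  nth-subtract [] (z ∷ zs) zero = sym (+-identityˡ _)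
  nth-subtract [] (z ∷ zs) (suc n) = nth-subtract [] zs n
  nth-subtract (y ∷ ys) [] n = solve 1 (λ e → e := e :- con (+ 0)) refl _
    where open Solver
  nth-subtract (y ∷ ys) (z ∷ zs) zero = refl
  nth-subtract (y ∷ ys) (z ∷ zs) (suc n) = nth-subtract ys zs n

  compare-coefficients : ∀ n f zs x₀ → (∀ x → x₀ ≤ x → Σ n (λ i → f i * ι x ^ i) ≈ evalℤ zs (ι x)) →
                         ∀ i → i < n → f i ≈ intK K (coeff zs i)
  compare-coefficients n f zs x₀ eq i i<n = begin
    f i                                                ≈⟨ solve 2 (λ y z → y := (y :- z) :+ z) refl (f i) (intK K (coeff zs i)) ⟩
    (f i - intK K (coeff zs i)) + intK K (coeff zs i)  ≈⟨ +-congʳ (+-congʳ (nth-tabulate n f i i<n)) ⟨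
    (nth 0# (tabulate n f) i - intK K (coeff zs i)) + intK K (coeff zs i)  ≈⟨ +-congʳ (nth-subtract (tabulate n f) zs i) ⟨
    nth 0# ys i + intK K (coeff zs i)                  ≈⟨ +-congʳ (all-nth (vanishing x₀ ys ev≈0) i) ⟩
    0# + intK K (coeff zs i)                           ≈⟨ +-identityˡ _ ⟩
    intK K (coeff zs i)                                ∎
    where
    open Solver
    ys : List Carrier
    ys = subtract (tabulate n f) zs
    ev≈0 : ∀ x → x₀ ≤ x → eval ys (ι x) ≈ 0#
    ev≈0 x x₀≤x = trans (eval-subtract (tabulate n f) zs (ι x))
      (trans (+-congʳ (trans (eval-tabulate n f (ι x)) (eq x x₀≤x))) (-‿inverseʳ _))

  evalℤ-⊞ : ∀ L M x → evalℤ (L ⊞ M) x ≈ evalℤ L x + evalℤ M x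
  evalℤ-⊞ [] M x = sym (+-identityˡ _)
  evalℤ-⊞ (y ∷ L) [] x = sym (+-identityʳ _)
  evalℤ-⊞ (y ∷ L) (z ∷ M) x = trans (+-cong (intK-+ y z) (*-congˡ (evalℤ-⊞ L M x)))
    (solve 5 (λ y z x l m → (y :+ z) :+ x :* (l :+ m) := (y :+ x :* l) :+ (z :+ x :* m)) refl _ _ x _ _)
    where open Solver

  evalℤ-map-* : ∀ y M x → evalℤ (map (y ℤ.*_) M) x ≈ intK K y * evalℤ M x
  evalℤ-map-* y [] x = sym (zeroʳ _)
  evalℤ-map-* y (z ∷ M) x = trans (+-cong (intK-* y z) (*-congˡ (evalℤ-map-* y M x)))
    (solve 4 (λ y z x m → y :* z :+ x :* (y :* m) := y :* (z :+ x :* m)) refl _ _ x _)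
    where open Solver

  evalℤ-⊠ : ∀ L M x → evalℤ (L ⊠ M) x ≈ evalℤ L x * evalℤ M x
  evalℤ-⊠ [] M x = sym (zeroˡ _)
  evalℤ-⊠ (y ∷ L) M x = trans (evalℤ-⊞ (map (y ℤ.*_) M) (+ 0 ∷ L ⊠ M) x)
    (trans (+-cong (evalℤ-map-* y M x) (+-congˡ (*-congˡ (evalℤ-⊠ L M x))))
    (solve 4 (λ y x l m → y :* m :+ (con (+ 0) :+ x :* (l :* m)) := (y :+ x :* l) :* m) refl _ x _ _))
    where open Solver

  evalℤ-powL : ∀ L n x → evalℤ (powL L n) x ≈ evalℤ L x ^ n
  evalℤ-powL L zero x = trans (+-cong ι-1 (zeroʳ _)) (+-identityʳ _)
  evalℤ-powL L (suc n) x = trans (evalℤ-⊠ L (powL L n) x) (*-congˡ (evalℤ-powL L n x))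

  evalℤ-linL : ∀ u v x → evalℤ (linL u v) x ≈ intK K u * x + intK K v
  evalℤ-linL u v x = solve 3 (λ u v x → v :+ x :* (u :+ x :* con (+ 0)) := u :* x :+ v) refl _ _ x
    where open Solver

  -- Integrality is a property of functions on natural numbers, demanded only from x₀ on: the values
  -- of rays serve as exponents of E, and one of them involves the truncated difference `x ℕ.∸ r`.
  IntPoly : ℕ → (ℕ → Carrier) → Set ℓ
  IntPoly x₀ f = ∃[ L ] (∀ x → x₀ ≤ x → f x ≈ evalℤ L (ι x))

  module _ {x₀ : ℕ} where
    poly-resp : ∀ {f g} → (∀ x → x₀ ≤ x → f x ≈ g x) → IntPoly x₀ g → IntPoly x₀ f
    poly-resp eq (L , p) = L , λ x le → trans (eq x le) (p x le)

    poly-const : ∀ z → IntPoly x₀ (λ _ → intK K z)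
    poly-const z = z ∷ [] , λ x _ → sym (trans (+-congˡ (zeroʳ _)) (+-identityʳ _))

    poly-x : IntPoly x₀ ι
    poly-x = linL (+ 1) (+ 0) , λ x _ → sym (trans (evalℤ-linL (+ 1) (+ 0) (ι x))
      (trans (+-identityʳ _) (trans (*-congʳ ι-1) (*-identityˡ _))))

    poly-+ : ∀ {f g} → IntPoly x₀ f → IntPoly x₀ g → IntPoly x₀ (λ x → f x + g x)
    poly-+ (L , p) (M , r) = L ⊞ M , λ x le → trans (+-cong (p x le) (r x le)) (sym (evalℤ-⊞ L M (ι x)))

    poly-* : ∀ {f g} → IntPoly x₀ f → IntPoly x₀ g → IntPoly x₀ (λ x → f x * g x)
    poly-* (L , p) (M , r) = L ⊠ M , λ x le → trans (*-cong (p x le) (r x le)) (sym (evalℤ-⊠ L M (ι x)))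

    poly-neg : ∀ {f} → IntPoly x₀ f → IntPoly x₀ (λ x → - f x)
    poly-neg {f} P = poly-resp (λ x _ → trans (-‿cong (sym (*-identityˡ _))) (trans (-‿distribˡ-* _ _) (*-congʳ (-‿cong (sym ι-1)))))
      (poly-* (poly-const (ℤ.- + 1)) P)
      where open import Algebra.Properties.Ring ring using (-‿distribˡ-*)

    poly-^ : ∀ {f} → IntPoly x₀ f → ∀ n → IntPoly x₀ (λ x → f x ^ n)
    poly-^ (L , p) n = powL L n , λ x le → trans (^-cong (p x le) n) (sym (evalℤ-powL L n (ι x)))

    poly-Σ : ∀ n {f : ℕ → ℕ → Carrier} → (∀ i → i < n → IntPoly x₀ (f i)) → IntPoly x₀ (λ x → Σ n (λ i → f i x))
    poly-Σ zero P = [] , λ _ _ → refl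
    poly-Σ (suc n) P = poly-+ (poly-Σ n λ i i<n → P i (ℕP.m<n⇒m<1+n i<n)) (P n (ℕP.n<1+n n))

    -- The quotient is built along the recursion, so no division occurs and it stays an integer
    -- polynomial. It serves for congruences modulo f - g and, with -g for g and an odd exponent,
    -- for divisibility by f + g.
    difference-quotient : ∀ {f g} → IntPoly x₀ f → IntPoly x₀ g → ∀ n →
      ∃[ D ] (IntPoly x₀ D × (∀ x → f x ^ n - g x ^ n ≈ (f x - g x) * D x))
    difference-quotient P Q zero = (λ _ → 0#) , poly-const (+ 0) , λ x → trans (-‿inverseʳ _) (sym (zeroʳ _))
    difference-quotient {f} {g} P Q (suc n) with difference-quotient P Q n
    ... | D , PD , eq = (λ x → f x * D x + g x ^ n) , poly-+ (poly-* P PD) (poly-^ Q n) , λ x → begin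
      f x * f x ^ n - g x * g x ^ n
        ≈⟨ solve 4 (λ f g a b → f :* a :- g :* b := f :* (a :- b) :+ (f :- g) :* b) refl (f x) (g x) (f x ^ n) (g x ^ n) ⟩
      f x * (f x ^ n - g x ^ n) + (f x - g x) * g x ^ n
        ≈⟨ +-congʳ (*-congˡ (eq x)) ⟩
      f x * ((f x - g x) * D x) + (f x - g x) * g x ^ n
        ≈⟨ solve 4 (λ f d D b → f :* (d :* D) :+ d :* b := d :* (f :* D :+ b)) refl (f x) (f x - g x) (D x) (g x ^ n) ⟩
      (f x - g x) * (f x * D x + g x ^ n) ∎
      where open Solver

-- The Todd series and the Bernoulli numbers

binomial-factorials : ∀ {n k} → k ≤ n → (n C k) ℕ.* (k ! ℕ.* (n ℕ.∸ k) !) ≡ n !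
binomial-factorials {n} {k} k≤n = ≡.trans
  (≡.cong (ℕ._* (k ! ℕ.* (n ℕ.∸ k) !)) (nCk≡n!/k![n-k]! k≤n)) (m/n*n≡m {{ℕP._!*_!≢0 k (n ℕ.∸ k)}} (k![n∸k]!∣n! k≤n))

binomSum : ℕ → List ℚ → ℚ
binomSum m [] = 0ℚ
binomSum m (x ∷ xs) = ℚfromℕ (suc m C length xs) ℚ.* x ℚ.+ binomSum m xs

binomSum-unique : ∀ m (g : List ℚ → ℚ) → g [] ≡ 0ℚ →
  (∀ x xs → g (x ∷ xs) ≡ ℚfromℕ (suc m C length xs) ℚ.* x ℚ.+ g xs) → ∀ xs → g xs ≡ binomSum m xs
binomSum-unique m g nil cons [] = nil
binomSum-unique m g nil cons (x ∷ xs) =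
  ≡.trans (cons x xs) (≡.cong (ℚfromℕ (suc m C length xs) ℚ.* x ℚ.+_) (binomSum-unique m g nil cons xs))

-- The summation inside bernRev is a private function of Defs; unification supplies it for g.
bernRev-suc : ∀ m → bernRev (suc m) ≡ (ℚ.- ((+ 1 ℚ./ suc (suc m)) ℚ.* binomSum (suc m) (bernRev m))) ∷ bernRev m
bernRev-suc m with binomSum-unique (suc m) _ ≡.refl (λ _ _ → ≡.refl) | bernRev m
... | eq | xs = ≡.cong (λ z → (ℚ.- ((+ 1 ℚ./ suc (suc m)) ℚ.* z)) ∷ xs) (eq xs)

downFrom : ∀ {a} {A : Set a} → (ℕ → A) → ℕ → List A
downFrom f zero = f 0 ∷ []
downFrom f (suc n) = f (suc n) ∷ downFrom f n

length-downFrom : ∀ {a} {A : Set a} (f : ℕ → A) n → length (downFrom f n) ≡ suc n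
length-downFrom f zero = ≡.refl
length-downFrom f (suc n) = ≡.cong suc (length-downFrom f n)

bernRev-downFrom : ∀ n → bernRev n ≡ downFrom bernoulli n
bernRev-downFrom zero = ≡.refl
bernRev-downFrom (suc n) = ≡.cong (bernoulli (suc n) ∷_) (bernRev-downFrom n)

bernoulli-suc : ∀ m → bernoulli (suc m) ≡ ℚ.- ((+ 1 ℚ./ suc (suc m)) ℚ.* binomSum (suc m) (downFrom bernoulli m))
bernoulli-suc m = ≡.trans (∷-injectiveˡ (bernRev-suc m))
  (≡.cong (λ l → ℚ.- ((+ 1 ℚ./ suc (suc m)) ℚ.* binomSum (suc m) l)) (bernRev-downFrom m))

module ToddSeries {c ℓ : Level} (K : CommutativeRing c ℓ) (inv : CommutativeRing.Carrier K → CommutativeRing.Carrier K)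
                  (isInv : IsFieldInverse K inv) (char0 : CharZero K) where
  open CommutativeRing K hiding (zero)
  open RingLemmas K
  open FieldLemmas K inv isInv char0
  open PowerSeries K
  open WithInv K inv
  open Relation.Binary.Reasoning.Setoid setoid
  private module S = CommutativeRing seriesRing

  -- A description of `ratK` free of `inv` and of reduction to lowest terms: elements representing
  -- equal unnormalised fractions coincide, so the homomorphism laws follow by clearing
  -- denominators.
  Represents : ℚᵘ → Carrier → Set ℓ
  Represents r x = ι (ℚᵘ.↧ₙ r) * x ≈ intK K (ℚᵘ.↥ r)

  ratK-represents : ∀ r → Represents (toℚᵘ r) (ratK r)
  ratK-represents (mkℚ n d _) = begin
    ι (suc d) * (intK K n * inv (ι (suc d)))   ≈⟨ solve 3 (λ a b c → a :* (b :* c) := b :* (a :* c)) refl _ _ _ ⟩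
    intK K n * (ι (suc d) * inv (ι (suc d)))   ≈⟨ *-congˡ (isInv _ (ι≉0 {suc d} (s≤s z≤n))) ⟩
    intK K n * 1#                              ≈⟨ *-identityʳ _ ⟩
    intK K n                                   ∎
    where open Solver

  represents-unique : ∀ {r s x y} → r ℚᵘ.≃ s → Represents r x → Represents s y → x ≈ y
  represents-unique {mkℚᵘ m c} {mkℚᵘ n d} {x} {y} (*≡* eq) px py =
    ι-cancel {suc c} (s≤s z≤n) (ι-cancel {suc d} (s≤s z≤n) (begin
      ι (suc d) * (ι (suc c) * x)   ≈⟨ *-congˡ px ⟩
      ι (suc d) * intK K m          ≈⟨ *-comm _ _ ⟩
      intK K m * ι (suc d)          ≈⟨ intK-* m (+ suc d) ⟨
      intK K (m ℤ.* + suc d)        ≡⟨ ≡.cong (intK K) eq ⟩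
      intK K (n ℤ.* + suc c)        ≈⟨ intK-* n (+ suc c) ⟩
      intK K n * ι (suc c)          ≈⟨ *-congʳ py ⟨
      (ι (suc d) * y) * ι (suc c)   ≈⟨ solve 3 (λ a b c → (a :* b) :* c := a :* (c :* b)) refl _ _ _ ⟩
      ι (suc d) * (ι (suc c) * y)   ∎))
    where open Solver

  ratK-+ : ∀ r s → ratK (r ℚ.+ s) ≈ ratK r + ratK s
  ratK-+ r@(mkℚ m c _) s@(mkℚ n d _) = represents-unique (ℚP.toℚᵘ-homo-+ r s) (ratK-represents (r ℚ.+ s)) (begin
    ι (suc c ℕ.* suc d) * (ratK r + ratK s)
      ≈⟨ *-congʳ (ι-* (suc c) (suc d)) ⟩
    (ι (suc c) * ι (suc d)) * (ratK r + ratK s)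
      ≈⟨ solve 4 (λ c d x y → (c :* d) :* (x :+ y) := (c :* x) :* d :+ (d :* y) :* c) refl _ _ _ _ ⟩
    (ι (suc c) * ratK r) * ι (suc d) + (ι (suc d) * ratK s) * ι (suc c)
      ≈⟨ +-cong (*-congʳ (ratK-represents r)) (*-congʳ (ratK-represents s)) ⟩
    intK K m * ι (suc d) + intK K n * ι (suc c)
      ≈⟨ +-cong (intK-* m (+ suc d)) (intK-* n (+ suc c)) ⟨
    intK K (m ℤ.* + suc d) + intK K (n ℤ.* + suc c)
      ≈⟨ intK-+ (m ℤ.* + suc d) (n ℤ.* + suc c) ⟨
    intK K (m ℤ.* + suc d ℤ.+ n ℤ.* + suc c) ∎)
    where open Solver

  ratK-* : ∀ r s → ratK (r ℚ.* s) ≈ ratK r * ratK s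
  ratK-* r@(mkℚ m c _) s@(mkℚ n d _) = represents-unique (ℚP.toℚᵘ-homo-* r s) (ratK-represents (r ℚ.* s)) (begin
    ι (suc c ℕ.* suc d) * (ratK r * ratK s)
      ≈⟨ *-congʳ (ι-* (suc c) (suc d)) ⟩
    (ι (suc c) * ι (suc d)) * (ratK r * ratK s)
      ≈⟨ solve 4 (λ c d x y → (c :* d) :* (x :* y) := (c :* x) :* (d :* y)) refl _ _ _ _ ⟩
    (ι (suc c) * ratK r) * (ι (suc d) * ratK s)
      ≈⟨ *-cong (ratK-represents r) (ratK-represents s) ⟩
    intK K m * intK K n
      ≈⟨ intK-* m n ⟨
    intK K (m ℤ.* n) ∎)
    where open Solver

  ratK-/ : ∀ z n .{{_ : ℕ.NonZero n}} → ι n * ratK (z ℚ./ n) ≈ intK K z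
  ratK-/ z (suc n) = begin
    ι (suc n) * ratK (z ℚ./ suc n)
      ≈⟨ *-congˡ (represents-unique (ℚP.toℚᵘ-fromℚᵘ (mkℚᵘ z n)) (ratK-represents (z ℚ./ suc n)) represents) ⟩
    ι (suc n) * (intK K z * inv (ι (suc n)))   ≈⟨ represents ⟩
    intK K z                                   ∎
    where
    represents : Represents (mkℚᵘ z n) (intK K z * inv (ι (suc n)))
    represents = trans (solve 3 (λ a b c → a :* (b :* c) := b :* (a :* c)) refl _ _ _)
      (trans (*-congˡ (isInv _ (ι≉0 {suc n} (s≤s z≤n)))) (*-identityʳ _))
      where open Solver

  ratK-ℤ : ∀ z → ratK (ℚfromℤ z) ≈ intK K z
  ratK-ℤ z = trans (sym (trans (*-congʳ ι-1) (*-identityˡ _))) (ratK-/ z 1)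

  ratK-ℕ : ∀ n → ratK (ℚfromℕ n) ≈ ι n
  ratK-ℕ n = ratK-ℤ (+ n)

  ratK-neg : ∀ r → ratK (ℚ.- r) ≈ - ratK r
  ratK-neg r = begin
    ratK (ℚ.- r)                      ≈⟨ solve 2 (λ a b → a := (b :+ a) :- b) refl _ (ratK r) ⟩
    (ratK r + ratK (ℚ.- r)) - ratK r  ≈⟨ +-congʳ (ratK-+ r (ℚ.- r)) ⟨
    ratK (r ℚ.+ ℚ.- r) - ratK r       ≡⟨ ≡.cong (λ s → ratK s - ratK r) (ℚP.+-inverseʳ r) ⟩
    ratK 0ℚ - ratK r                  ≈⟨ +-congʳ (zeroˡ _) ⟩
    0# - ratK r                       ≈⟨ +-identityˡ _ ⟩
    - ratK r                          ∎
    where open Solver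

  fact-positive : ∀ n → 0 < n !
  fact-positive n = ℕ.>-nonZero⁻¹ (n !) {{ℕP._!≢0 n}}

  sign-sgn : ∀ n → intK K (signℤ n) ≈ sgn n
  sign-sgn zero = ι-1
  sign-sgn (suc n) = begin
    intK K (ℤ.- signℤ n)   ≈⟨ intK-neg (signℤ n) ⟩
    - intK K (signℤ n)     ≈⟨ -‿cong (sign-sgn n) ⟩
    - sgn n                ≈⟨ -‿cong (*-identityˡ _) ⟨
    - (1# * sgn n)         ≈⟨ -‿distribˡ-* _ _ ⟩
    - 1# * sgn n           ∎
    where open import Algebra.Properties.Ring ring using (-‿distribˡ-*)

  expNeg-fact : ∀ k → ι (k !) * expNeg k ≈ sgn k
  expNeg-fact k = begin
    ι (k !) * expNeg k                               ≈⟨ *-congˡ (ratK-* (ℚfromℤ (signℤ k)) _) ⟩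
    ι (k !) * (ratK (ℚfromℤ (signℤ k)) * ratK (ℚ._/_ (+ 1) (k !) {{ℕP._!≢0 k}}))
      ≈⟨ solve 3 (λ a b c → a :* (b :* c) := (a :* c) :* b) refl _ _ _ ⟩
    (ι (k !) * ratK (ℚ._/_ (+ 1) (k !) {{ℕP._!≢0 k}})) * ratK (ℚfromℤ (signℤ k))
      ≈⟨ *-cong (ratK-/ (+ 1) (k !) {{ℕP._!≢0 k}}) (trans (ratK-ℤ (signℤ k)) (sign-sgn k)) ⟩
    ι 1 * sgn k                                      ≈⟨ *-congʳ ι-1 ⟩
    1# * sgn k                                       ≈⟨ *-identityˡ _ ⟩
    sgn k                                            ∎
    where open Solver

  expNeg-0 : expNeg 0 ≈ 1#
  expNeg-0 = trans (sym (trans (*-congʳ ι-1) (*-identityˡ _))) (expNeg-fact 0)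

  expNeg-suc : ∀ n → ι (suc n) * expNeg (suc n) ≈ - expNeg n
  expNeg-suc n = ι-cancel (fact-positive n) (begin
    ι (n !) * (ι (suc n) * expNeg (suc n))   ≈⟨ solve 3 (λ a b c → a :* (b :* c) := (b :* a) :* c) refl _ _ _ ⟩
    (ι (suc n) * ι (n !)) * expNeg (suc n)   ≈⟨ *-congʳ (ι-* (suc n) (n !)) ⟨
    ι (suc n !) * expNeg (suc n)             ≈⟨ expNeg-fact (suc n) ⟩
    - 1# * sgn n                             ≈⟨ *-congˡ (expNeg-fact n) ⟨
    - 1# * (ι (n !) * expNeg n)              ≈⟨ solve 3 (λ o a b → (:- o) :* (a :* b) := a :* (:- (o :* b))) refl 1# _ _ ⟩
    ι (n !) * (- (1# * expNeg n))            ≈⟨ *-congˡ (-‿cong (*-identityˡ _)) ⟩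
    ι (n !) * (- expNeg n)                   ∎)
    where open Solver

  -- The recurrence is the differential equation f′ = -a f with f(0) = 1. In characteristic 0 it
  -- determines every coefficient.
  scale-exp-unique : ∀ a f → f 0 ≈ 1# → (∀ n → ι (suc n) * f (suc n) ≈ - (a * f n)) → f ≋ scale a expNeg
  scale-exp-unique a f f0 step = coeffwise go
    where
    open Solver
    go : ∀ n → f n ≈ scale a expNeg n
    go zero = trans f0 (sym (trans (*-identityʳ _) expNeg-0))
    go (suc n) = ι-cancel {suc n} (s≤s z≤n) (begin
      ι (suc n) * f (suc n)                        ≈⟨ step n ⟩
      - (a * f n)                                  ≈⟨ -‿cong (*-congˡ (go n)) ⟩
      - (a * (expNeg n * a ^ n))                   ≈⟨ solve 3 (λ a e p → :- (a :* (e :* p)) := (:- e) :* (a :* p)) refl a (expNeg n) (a ^ n) ⟩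
      (- expNeg n) * a ^ suc n                     ≈⟨ *-congʳ (expNeg-suc n) ⟨
      (ι (suc n) * expNeg (suc n)) * a ^ suc n     ≈⟨ *-assoc _ _ _ ⟩
      ι (suc n) * scale a expNeg (suc n)           ∎)

  θ-scale-exp : ∀ a → θ (scale a expNeg) ≋ cst (- a) ⊛ (X ⊛ scale a expNeg)
  θ-scale-exp a = coeffwise λ
    { zero → trans (zeroˡ _) (sym (trans (*-congˡ (zeroˡ _)) (zeroʳ _)))
    ; (suc n) → begin
        ι (suc n) * (expNeg (suc n) * a ^ suc n)     ≈⟨ *-assoc _ _ _ ⟨
        (ι (suc n) * expNeg (suc n)) * a ^ suc n     ≈⟨ *-congʳ (expNeg-suc n) ⟩
        (- expNeg n) * (a * a ^ n)                   ≈⟨ solve 3 (λ a e p → (:- e) :* (a :* p) := (:- a) :* (e :* p)) refl a (expNeg n) (a ^ n) ⟩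
        (- a) * scale a expNeg n                     ≈⟨ *-congˡ (X-⊛ (scale a expNeg) n) ⟨
        (- a) * (X ⊛ scale a expNeg) (suc n)         ≈⟨ cst-⊛ (- a) (X ⊛ scale a expNeg) (suc n) ⟨
        (cst (- a) ⊛ (X ⊛ scale a expNeg)) (suc n)     ∎ }
    where open Solver

  -- The functional equation of the exponential without binomial sums: by the product rule for `θ`,
  -- the product solves the equation that characterises the left side.
  scale-exp-+ : ∀ a b → scale (a + b) expNeg ≋ scale a expNeg ⊛ scale b expNeg
  scale-exp-+ a b = S.sym (scale-exp-unique (a + b) (Ea ⊛ Eb)
    (trans (*-cong (trans (*-identityʳ _) expNeg-0) (trans (*-identityʳ _) expNeg-0)) (*-identityˡ _)) λ n → begin
      ι (suc n) * (Ea ⊛ Eb) (suc n)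
        ≈⟨ θ-⊛ Ea Eb (suc n) ⟩
      (θ Ea ⊛ Eb) (suc n) + (Ea ⊛ θ Eb) (suc n)
        ≈⟨ +-cong (at (S.*-congʳ {Eb} (θ-scale-exp a)) (suc n)) (at (S.*-congˡ {Ea} (θ-scale-exp b)) (suc n)) ⟩
      ((cst (- a) ⊛ (X ⊛ Ea)) ⊛ Eb) (suc n) + (Ea ⊛ (cst (- b) ⊛ (X ⊛ Eb))) (suc n)
        ≈⟨ +-cong (at (SS.solve 4 (λ c x y z → (c SS.:* (x SS.:* y)) SS.:* z SS.:= c SS.:* (x SS.:* (y SS.:* z))) S.refl (cst (- a)) X Ea Eb) (suc n))
                  (at (SS.solve 4 (λ c x y z → y SS.:* (c SS.:* (x SS.:* z)) SS.:= c SS.:* (x SS.:* (y SS.:* z))) S.refl (cst (- b)) X Ea Eb) (suc n)) ⟩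
      (cst (- a) ⊛ (X ⊛ (Ea ⊛ Eb))) (suc n) + (cst (- b) ⊛ (X ⊛ (Ea ⊛ Eb))) (suc n)
        ≈⟨ +-cong (trans (cst-⊛ (- a) _ (suc n)) (*-congˡ (X-⊛ (Ea ⊛ Eb) n))) (trans (cst-⊛ (- b) _ (suc n)) (*-congˡ (X-⊛ (Ea ⊛ Eb) n))) ⟩
      (- a) * (Ea ⊛ Eb) n + (- b) * (Ea ⊛ Eb) n
        ≈⟨ solve 3 (λ a b f → (:- a) :* f :+ (:- b) :* f := :- ((a :+ b) :* f)) refl a b _ ⟩
      - ((a + b) * (Ea ⊛ Eb) n) ∎)
    where
    open Solver
    module SS = RingLemmas.Solver seriesRing
    Ea Eb : Series
    Ea = scale a expNeg
    Eb = scale b expNeg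

  scale-exp-0 : scale 0# expNeg ≋ cst 1#
  scale-exp-0 = coeffwise λ
    { zero → trans (*-identityʳ _) expNeg-0
    ; (suc n) → trans (*-congˡ (zeroˡ _)) (zeroʳ _) }

  exp : ℕ → Series
  exp u = scale (ι u) expNeg

  exp-+ : ∀ m n → exp (m ℕ.+ n) ≋ exp m ⊛ exp n
  exp-+ m n = S.trans (coeffwise λ k → *-congˡ (^-cong (ι-+ m n) k)) (scale-exp-+ (ι m) (ι n))

  exp-* : ∀ m n → exp (m ℕ.* n) ≋ powK seriesRing (exp n) m
  exp-* zero n = scale-exp-0
  exp-* (suc m) n = S.trans (exp-+ n (m ℕ.* n)) (S.*-congˡ (exp-* m n))

  shiftedDot : (ℕ → Carrier) → ℕ → List Carrier → Carrier
  shiftedDot h k [] = 0#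
  shiftedDot h k (x ∷ xs) = h k * x + shiftedDot h (suc k) xs

  shiftedDot-unique : ∀ h (g : ℕ → List Carrier → Carrier) → (∀ k → g k [] ≡ 0#) →
    (∀ k x xs → g k (x ∷ xs) ≡ h k * x + g (suc k) xs) → ∀ k xs → g k xs ≡ shiftedDot h k xs
  shiftedDot-unique h g nil cons k [] = nil k
  shiftedDot-unique h g nil cons k (x ∷ xs) =
    ≡.trans (cons k x xs) (≡.cong (λ z → h k * x + z) (shiftedDot-unique h g nil cons (suc k) xs))

  -- The same device as in `bernRev-suc`: the summation is local to `invRev`, and unification
  -- supplies it for `g`.
  invRev-suc : ∀ h n → invRev h (suc n) ≡ (- (inv (h 0) * shiftedDot h 1 (invRev h n))) ∷ invRev h n
  invRev-suc h n with shiftedDot-unique h _ (λ _ → ≡.refl) (λ _ _ _ → ≡.refl) | 1 | invRev h n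
  ... | eq | k | xs = ≡.cong (λ z → (- (inv (h 0) * z)) ∷ xs) (eq k xs)

  invRev-downFrom : ∀ h n → invRev h n ≡ downFrom (invCoef h) n
  invRev-downFrom h zero = ≡.refl
  invRev-downFrom h (suc n) = ≡.cong (invCoef h (suc n) ∷_) (invRev-downFrom h n)

  shiftedDot-⊛ : ∀ h f g k → (∀ i → f i ≡ h (i ℕ.+ k)) → ∀ n → shiftedDot h k (downFrom g n) ≈ (f ⊛ g) n
  shiftedDot-⊛ h f g k eq zero = trans (+-identityʳ _) (*-congʳ (reflexive (≡.sym (eq 0))))
  shiftedDot-⊛ h f g k eq (suc n) = +-cong (*-congʳ (reflexive (≡.sym (eq 0))))
    (shiftedDot-⊛ h (f ∘ suc) g (suc k) (λ i → ≡.trans (eq (suc i)) (≡.cong h (≡.sym (ℕP.+-suc i k)))) n)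

  invCoef-suc : ∀ h n → invCoef h (suc n) ≈ - (inv (h 0) * ((h ∘ suc) ⊛ invCoef h) n)
  invCoef-suc h n = begin
    invCoef h (suc n)
      ≡⟨ ∷-injectiveˡ (invRev-suc h n) ⟩
    - (inv (h 0) * shiftedDot h 1 (invRev h n))
      ≡⟨ ≡.cong (λ l → - (inv (h 0) * shiftedDot h 1 l)) (invRev-downFrom h n) ⟩
    - (inv (h 0) * shiftedDot h 1 (downFrom (invCoef h) n))
      ≈⟨ -‿cong (*-congˡ (shiftedDot-⊛ h (h ∘ suc) (invCoef h) 1 (λ i → ≡.cong h (ℕP.+-comm 1 i)) n)) ⟩
    - (inv (h 0) * ((h ∘ suc) ⊛ invCoef h) n) ∎

  invCoef-inverse : ∀ h → ¬ (h 0 ≈ 0#) → h ⊛ invCoef h ≋ cst 1#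
  invCoef-inverse h h0≉0 = coeffwise λ
    { zero → isInv (h 0) h0≉0
    ; (suc n) → begin
        h 0 * invCoef h (suc n) + D n              ≈⟨ +-congʳ (*-congˡ (invCoef-suc h n)) ⟩
        h 0 * (- (inv (h 0) * D n)) + D n          ≈⟨ solve 3 (λ a b d → a :* (:- (b :* d)) :+ d := d :- (a :* b) :* d) refl (h 0) (inv (h 0)) (D n) ⟩
        D n - (h 0 * inv (h 0)) * D n              ≈⟨ +-congˡ (-‿cong (trans (*-congʳ (isInv (h 0) h0≉0)) (*-identityˡ _))) ⟩
        D n - D n                                  ≈⟨ -‿inverseʳ _ ⟩
        0#                                         ∎ }
    where
    open Solver
    D : Series
    D = (h ∘ suc) ⊛ invCoef h

  denom-series : ∀ χ → denom χ ≋ cst 1# ⊕ ⊖ (cst χ ⊛ expNeg)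
  denom-series χ = coeffwise λ
    { zero → refl
    ; (suc n) → sym (trans (+-identityˡ _) (-‿cong (cst-⊛ χ expNeg (suc n)))) }

  toddFactor-suc : ∀ ζ e → ¬ (ζ ^ suc e ≈ 1#) → toddFactor ζ (suc e) ⊛ denom (ζ ^ suc e) ≋ X
  toddFactor-suc ζ e χ≉1 = S.trans (S.*-congʳ {denom χ} shift) (S.trans (S.*-assoc X (invCoef (denom χ)) (denom χ))
      (S.trans (S.*-congˡ (S.trans (S.*-comm (invCoef (denom χ)) (denom χ)) (invCoef-inverse (denom χ) d0≉0))) (S.*-identityʳ X)))
    where
    χ : Carrier
    χ = ζ ^ suc e
    shift : toddFactor ζ (suc e) ≋ X ⊛ invCoef (denom χ)
    shift = coeffwise λ { zero → sym (zeroˡ _) ; (suc n) → sym (X-⊛ (invCoef (denom χ)) n) }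
    d0≉0 : ¬ (denom χ 0 ≈ 0#)
    d0≉0 eq = χ≉1 (begin
      χ                          ≈⟨ *-identityʳ _ ⟨
      χ * 1#                     ≈⟨ *-congˡ expNeg-0 ⟨
      χ * expNeg 0               ≈⟨ solve 2 (λ o a → a := o :- (o :- a)) refl 1# (χ * expNeg 0) ⟩
      1# - (1# - χ * expNeg 0)   ≈⟨ +-congˡ (-‿cong eq) ⟩
      1# - 0#                    ≈⟨ solve 1 (λ o → o :- con (+ 0) := o) refl 1# ⟩
      1#                         ∎)
      where open Solver

  td : Series
  td = invCoef (λ k → denom 1# (suc k))

  td-inverse : (λ k → denom 1# (suc k)) ⊛ td ≋ cst 1#
  td-inverse = invCoef-inverse _ λ eq → ι≉0 {1} (s≤s z≤n) (trans ι-1 (begin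
    1#                        ≈⟨ expNeg-0 ⟨
    expNeg 0                  ≈⟨ solve 1 (λ a → a := :- (:- a)) refl (expNeg 0) ⟩
    - (- expNeg 0)            ≈⟨ -‿cong (expNeg-suc 0) ⟨
    - (ι 1 * expNeg 1)        ≈⟨ -‿cong (*-congʳ ι-1) ⟩
    - (1# * expNeg 1)         ≈⟨ eq ⟩
    0#                        ∎))
    where open Solver

  td-denom : td ⊛ denom 1# ≋ X
  td-denom = S.trans (S.*-congˡ {td} shift) (S.trans
      (SS.solve 3 (λ a x h → a SS.:* (x SS.:* h) SS.:= x SS.:* (h SS.:* a)) S.refl td X (λ k → denom 1# (suc k)))
      (S.trans (S.*-congˡ td-inverse) (S.*-identityʳ X)))
    where
    module SS = RingLemmas.Solver seriesRing
    shift : denom 1# ≋ X ⊛ (λ k → denom 1# (suc k))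
    shift = coeffwise λ
      { zero → trans (+-congˡ (-‿cong (trans (*-identityˡ _) expNeg-0))) (trans (-‿inverseʳ _) (sym (zeroˡ _)))
      ; (suc n) → sym (X-⊛ (λ k → denom 1# (suc k)) n) }

  scale-denom : ∀ a χ → scale a (denom χ) ≋ cst 1# ⊕ ⊖ (cst χ ⊛ scale a expNeg)
  scale-denom a χ = S.trans (scale-cong a (denom-series χ)) (coeffwise λ n → begin
    (cst 1# n - (cst χ ⊛ expNeg) n) * a ^ n
      ≈⟨ solve 3 (λ x y z → (x :- y) :* z := x :* z :- y :* z) refl (cst 1# n) ((cst χ ⊛ expNeg) n) (a ^ n) ⟩
    scale a (cst 1#) n - scale a (cst χ ⊛ expNeg) n
      ≈⟨ +-cong (at (scale-cst a 1#) n) (-‿cong (trans (at (scale-⊛ a (cst χ) expNeg) n) (at (S.*-congʳ {scale a expNeg} (scale-cst a χ)) n))) ⟩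
    cst 1# n - (cst χ ⊛ scale a expNeg) n ∎)
    where open Solver

  scaled-todd : ∀ a χ φ → φ ⊛ denom χ ≋ X → scale a φ ⊛ (cst 1# ⊕ ⊖ (cst χ ⊛ scale a expNeg)) ≋ cst a ⊛ X
  scaled-todd a χ φ eq = S.trans (S.*-congˡ {scale a φ} (S.sym (scale-denom a χ)))
    (S.trans (S.sym (scale-⊛ a φ (denom χ))) (S.trans (scale-cong a eq) (scale-X a)))

  scaled-td : ∀ a → scale a td ⊛ (cst 1# ⊕ ⊖ scale a expNeg) ≋ cst a ⊛ X
  scaled-td a = S.trans (S.*-congˡ {scale a td} (S.+-congˡ {cst 1#} (S.-‿cong (S.sym (S.*-identityˡ (scale a expNeg))))))
    (scaled-todd a 1# td td-denom)

  td-reflect : td ⊕ ⊖ scale (- 1#) td ≋ X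
  td-reflect = X-cancel (S.trans (S.*-comm X _) (S.trans (S.*-congˡ {td ⊕ ⊖ td⁻} (S.sym td⊛)) (S.trans
    (solve 4 (λ o t t⁻ E → (t :- t⁻) :* (t :* (o :- E)) := t :* (t :* (o :- E) :- t⁻ :* (o :- E))) S.refl (cst 1#) td td⁻ expNeg)
    (S.trans (S.*-congˡ {td} (S.+-cong td⊛ (S.-‿cong td⁻⊛)))
    (S.trans (solve 3 (λ t x E → t :* (x :- x :* E) := x :* (t :* (con (+ 1) :- E))) S.refl td X expNeg)
    (S.*-congˡ {X} (S.trans (S.*-congˡ {td} (S.+-congʳ {⊖ expNeg} (RingLemmas.ι-1 seriesRing))) td⊛)))))))
    where
    open RingLemmas.Solver seriesRing
    td⁻ E⁻ : Series
    td⁻ = scale (- 1#) td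
    E⁻ = scale (- 1#) expNeg
    td⊛ : td ⊛ (cst 1# ⊕ ⊖ expNeg) ≋ X
    td⊛ = S.trans (S.*-congˡ {td} (S.sym (S.trans (denom-series 1#) (S.+-congˡ {cst 1#} (S.-‿cong (S.*-identityˡ expNeg)))))) td-denom
    E⁻E : E⁻ ⊛ expNeg ≋ cst 1#
    E⁻E = S.trans (S.*-congˡ {E⁻} (coeffwise λ n → sym (trans (*-congˡ (1^ n)) (*-identityʳ _))))
      (S.trans (S.sym (scale-exp-+ (- 1#) 1#)) (S.trans (coeffwise λ n → *-congˡ (^-cong (-‿inverseˡ 1#) n)) scale-exp-0))
    td⁻⊛ : td⁻ ⊛ (cst 1# ⊕ ⊖ expNeg) ≋ X ⊛ expNeg
    td⁻⊛ = S.trans (S.*-congˡ {td⁻} (S.+-cong (S.sym E⁻E) (S.-‿cong (S.sym (S.*-identityˡ expNeg)))))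
      (S.trans (solve 4 (λ t e E o → t :* (e :* E :- o :* E) := (:- (t :* (o :- e))) :* E) S.refl td⁻ E⁻ expNeg (cst 1#))
      (S.*-congʳ {expNeg} (S.trans (S.-‿cong (scaled-td (- 1#))) (coeffwise λ n →
        trans (-‿cong (cst-⊛ (- 1#) X n)) (trans (K.solve 2 (λ o x → K.:- ((K.:- o) K.:* x) K.:= o K.:* x) refl 1# (X n)) (*-identityˡ _))))))
      where module K = Solver

  td-odd : ∀ k → td (suc (k ℕ.+ k)) + td (suc (k ℕ.+ k)) ≈ X (suc (k ℕ.+ k))
  td-odd k = begin
    td n + td n                  ≈⟨ +-congˡ (*-identityʳ _) ⟨
    td n + td n * 1#             ≈⟨ solve 2 (λ t o → t :+ t :* o := t :- t :* (:- o)) refl (td n) 1# ⟩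
    td n - td n * (- 1#)         ≈⟨ +-congˡ (-‿cong (*-congˡ sgn-odd)) ⟨
    td n - td n * sgn n          ≈⟨ at td-reflect n ⟩
    X n                          ∎
    where
    open Solver
    n = suc (k ℕ.+ k)
    sgn-odd : sgn n ≈ - 1#
    sgn-odd = trans (*-congˡ (sgn-even k)) (*-identityʳ _)

  td-odd-zero : ∀ k → td (suc (suc k ℕ.+ suc k)) ≈ 0#
  td-odd-zero k = ι-cancel {2} (s≤s z≤n) (begin
    ι 2 * td n     ≈⟨ *-congʳ (+-congˡ ι-1) ⟩
    (1# + 1#) * td n  ≈⟨ trans (distribʳ _ _ _) (+-cong (*-identityˡ _) (*-identityˡ _)) ⟩
    td n + td n    ≈⟨ td-odd (suc k) ⟩
    0#             ≈⟨ zeroʳ _ ⟨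
    ι 2 * 0#       ∎)
    where n = suc (suc k ℕ.+ suc k)

  sgn² : ∀ n → sgn n * sgn n ≈ 1#
  sgn² n = trans (sym (^-+ (- 1#) n n)) (sgn-even n)

  ratK-binomSum : ∀ m n → ratK (binomSum m (downFrom bernoulli n)) ≈ Σ (suc n) (λ k → ι (suc m C k) * ratK (bernoulli k))
  ratK-binomSum m = go
    where
    term : ∀ k → ratK (ℚfromℕ (suc m C k) ℚ.* bernoulli k) ≈ ι (suc m C k) * ratK (bernoulli k)
    term k = trans (ratK-* (ℚfromℕ (suc m C k)) (bernoulli k)) (*-congʳ (ratK-ℕ (suc m C k)))
    go : ∀ n → ratK (binomSum m (downFrom bernoulli n)) ≈ Σ (suc n) (λ k → ι (suc m C k) * ratK (bernoulli k))
    go zero = trans (ratK-+ (ℚfromℕ (suc m C 0) ℚ.* bernoulli 0) 0ℚ) (trans (+-comm _ _) (+-cong (zeroˡ _) (term 0)))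
    go (suc n) = trans (ratK-+ (ℚfromℕ (suc m C length (downFrom bernoulli n)) ℚ.* bernoulli (suc n)) (binomSum m (downFrom bernoulli n)))
      (trans (+-cong (trans (reflexive (≡.cong (λ l → ratK (ℚfromℕ (suc m C l) ℚ.* bernoulli (suc n))) (length-downFrom bernoulli n))) (term (suc n))) (go n))
             (+-comm _ _))

  bernoulli-recurrence : ∀ m → Σ (suc (suc m)) (λ k → ι (suc (suc m) C k) * ratK (bernoulli k)) ≈ 0#
  bernoulli-recurrence m = begin
    S + ι (suc (suc m) C suc m) * ratK (bernoulli (suc m))
      ≡⟨ ≡.cong (λ n → S + ι n * ratK (bernoulli (suc m))) choose ⟩
    S + ι (suc (suc m)) * ratK (bernoulli (suc m))
      ≡⟨ ≡.cong (λ r → S + ι (suc (suc m)) * ratK r) (bernoulli-suc m) ⟩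
    S + ι (suc (suc m)) * ratK (ℚ.- ((+ 1 ℚ./ suc (suc m)) ℚ.* binomSum (suc m) (downFrom bernoulli m)))
      ≈⟨ +-congˡ (*-congˡ (trans (ratK-neg ((+ 1 ℚ./ suc (suc m)) ℚ.* binomSum (suc m) (downFrom bernoulli m))) (-‿cong (trans (ratK-* (+ 1 ℚ./ suc (suc m)) (binomSum (suc m) (downFrom bernoulli m)))
           (*-congˡ (ratK-binomSum (suc m) m)))))) ⟩
    S + ι (suc (suc m)) * (- (ratK (+ 1 ℚ./ suc (suc m)) * S))
      ≈⟨ solve 3 (λ s i r → s :+ i :* (:- (r :* s)) := s :- (i :* r) :* s) refl S (ι (suc (suc m))) _ ⟩
    S - (ι (suc (suc m)) * ratK (+ 1 ℚ./ suc (suc m))) * S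
      ≈⟨ +-congˡ (-‿cong (trans (*-congʳ (trans (ratK-/ (+ 1) (suc (suc m))) ι-1)) (*-identityˡ _))) ⟩
    S - S ≈⟨ -‿inverseʳ _ ⟩
    0# ∎
    where
    open Solver
    S : Carrier
    S = Σ (suc m) (λ k → ι (suc (suc m) C k) * ratK (bernoulli k))
    choose : suc (suc m) C suc m ≡ suc (suc m)
    choose = ≡.trans (nCk≡nC[n∸k] (ℕP.n≤1+n (suc m)))
      (≡.trans (≡.cong (suc (suc m) C_) (ℕP.m+n∸n≡m 1 m)) (nC1≡n (suc (suc m))))

  invFact : ℕ → Carrier
  invFact n = inv (ι (n !))

  fact-invFact : ∀ n → ι (n !) * invFact n ≈ 1#
  fact-invFact n = isInv _ (ι≉0 (fact-positive n))

  bern : Series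
  bern n = ratK (bernoulli n) * invFact n

  -- Up to factorials, the Bernoulli recurrence is the vanishing of the higher coefficients of the
  -- product of Σ B_k x^k/k! and (e^x - 1)/x.
  bern-inverse : bern ⊛ (λ n → invFact (suc n)) ≋ cst 1#
  bern-inverse = coeffwise λ
    { zero → begin
        (ratK (bernoulli 0) * invFact 0) * invFact 1
          ≈⟨ *-cong (trans (*-congʳ (trans (ratK-ℕ 1) ι-1)) (*-identityˡ _)) refl ⟩
        invFact 0 * invFact 1
          ≈⟨ *-cong (trans (sym (*-identityˡ _)) (*-congʳ (sym ι-1))) (trans (sym (*-identityˡ _)) (*-congʳ (sym ι-1))) ⟩
        (ι (0 !) * invFact 0) * (ι (1 !) * invFact 1)
          ≈⟨ trans (*-cong (fact-invFact 0) (fact-invFact 1)) (*-identityˡ _) ⟩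
        1# ∎
    ; (suc m) → ι-cancel (fact-positive (suc (suc m))) (begin
        ι (suc (suc m) !) * (bern ⊛ (λ n → invFact (suc n))) (suc m)
          ≈⟨ *-congˡ (⊛-coeff bern (λ n → invFact (suc n)) (suc m)) ⟩
        ι (suc (suc m) !) * Σ (suc (suc m)) (λ k → bern k * invFact (suc (suc m ℕ.∸ k)))
          ≈⟨ Σ-*ˡ (suc (suc m)) _ _ ⟩
        Σ (suc (suc m)) (λ k → ι (suc (suc m) !) * (bern k * invFact (suc (suc m ℕ.∸ k))))
          ≈⟨ Σ-cong-< (suc (suc m)) (λ k k<n → term m k (ℕP.≤-pred k<n)) ⟩
        Σ (suc (suc m)) (λ k → ι (suc (suc m) C k) * ratK (bernoulli k))
          ≈⟨ bernoulli-recurrence m ⟩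
        0#
          ≈⟨ zeroʳ _ ⟨
        ι (suc (suc m) !) * 0# ∎) }
    where
    open Solver
    term : ∀ m k → k ≤ suc m → ι (suc (suc m) !) * (bern k * invFact (suc (suc m ℕ.∸ k))) ≈ ι (suc (suc m) C k) * ratK (bernoulli k)
    term m k k≤ = begin
      ι (n !) * (bern k * invFact (suc (suc m ℕ.∸ k)))
        ≡⟨ ≡.cong (λ z → ι (n !) * (bern k * invFact z)) (ℕP.+-∸-assoc 1 k≤) ⟨
      ι (n !) * ((B * invFact k) * invFact (n ℕ.∸ k))
        ≡⟨ ≡.cong (λ z → ι z * ((B * invFact k) * invFact (n ℕ.∸ k))) (binomial-factorials {n} {k} (ℕP.m≤n⇒m≤1+n k≤)) ⟨
      ι ((n C k) ℕ.* (k ! ℕ.* (n ℕ.∸ k) !)) * ((B * invFact k) * invFact (n ℕ.∸ k))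
        ≈⟨ *-congʳ (trans (ι-* (n C k) _) (*-congˡ (ι-* (k !) ((n ℕ.∸ k) !)))) ⟩
      (ι (n C k) * (ι (k !) * ι ((n ℕ.∸ k) !))) * ((B * invFact k) * invFact (n ℕ.∸ k))
        ≈⟨ solve 6 (λ c f g b i j → (c :* (f :* g)) :* ((b :* i) :* j) := (c :* b) :* ((f :* i) :* (g :* j))) refl _ _ _ _ _ _ ⟩
      (ι (n C k) * B) * ((ι (k !) * invFact k) * (ι ((n ℕ.∸ k) !) * invFact (n ℕ.∸ k)))
        ≈⟨ *-congˡ (trans (*-cong (fact-invFact k) (fact-invFact (n ℕ.∸ k))) (*-identityˡ _)) ⟩
      (ι (n C k) * B) * 1#
        ≈⟨ *-identityʳ _ ⟩
      ι (n C k) * B ∎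
      where
      n : ℕ
      n = suc (suc m)
      B : Carrier
      B = ratK (bernoulli k)

  td-bernoulli : ∀ n → ι (n !) * td n ≈ sgn n * ratK (bernoulli n)
  td-bernoulli n = begin
    ι (n !) * td n                               ≈⟨ *-congˡ (trans (*-congˡ (sgn² n)) (*-identityʳ _)) ⟨
    ι (n !) * (td n * (sgn n * sgn n))           ≈⟨ *-congˡ (*-assoc _ _ _) ⟨
    ι (n !) * ((td n * sgn n) * sgn n)           ≈⟨ *-congˡ (*-congʳ (at td⁻≋bern n)) ⟩
    ι (n !) * ((ratK (bernoulli n) * invFact n) * sgn n)
      ≈⟨ solve 4 (λ f b i s → f :* ((b :* i) :* s) := (f :* i) :* (s :* b)) refl _ _ _ _ ⟩
    (ι (n !) * invFact n) * (sgn n * ratK (bernoulli n))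
      ≈⟨ trans (*-congʳ (fact-invFact n)) (*-identityˡ _) ⟩
    sgn n * ratK (bernoulli n)                   ∎
    where
    open Solver
    expNeg-sgn : ∀ k → expNeg k ≈ sgn k * invFact k
    expNeg-sgn k = ι-cancel (fact-positive k) (trans (expNeg-fact k) (sym (trans
      (solve 3 (λ a b c → a :* (b :* c) := (a :* c) :* b) refl _ _ _) (trans (*-congʳ (fact-invFact k)) (*-identityˡ _)))))
    reflected : scale (- 1#) (λ k → denom 1# (suc k)) ≋ (λ n → invFact (suc n))
    reflected = coeffwise λ k → begin
      (- (1# * expNeg (suc k))) * sgn k
        ≈⟨ *-congʳ (-‿cong (trans (*-identityˡ _) (expNeg-sgn (suc k)))) ⟩
      (- ((- 1# * sgn k) * invFact (suc k))) * sgn k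
        ≈⟨ solve 3 (λ o s i → (:- (((:- o) :* s) :* i)) :* s := (o :* (s :* s)) :* i) refl 1# (sgn k) (invFact (suc k)) ⟩
      (1# * (sgn k * sgn k)) * invFact (suc k)
        ≈⟨ trans (*-congʳ (trans (*-identityˡ _) (sgn² k))) (*-identityˡ _) ⟩
      invFact (suc k) ∎
    td⁻≋bern : scale (- 1#) td ≋ bern
    td⁻≋bern = ⊛-inverse-unique {h = λ n → invFact (suc n)}
      (S.trans (S.*-congˡ {scale (- 1#) td} (S.sym reflected)) (S.trans (S.sym (scale-⊛ (- 1#) td _))
        (S.trans (scale-cong (- 1#) (S.trans (S.*-comm td _) td-inverse)) (scale-cst (- 1#) 1#))))
      bern-inverse

-- Integrality of the normalised Todd coefficients

parity : ∀ n → ∃[ j ] (n ≡ j ℕ.+ j ⊎ n ≡ suc (j ℕ.+ j))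
parity zero = 0 , inj₁ ≡.refl
parity (suc n) with parity n
... | j , inj₁ eq = j , inj₂ (≡.cong suc eq)
... | j , inj₂ eq = suc j , inj₁ (≡.trans (≡.cong suc eq) (≡.cong suc (≡.sym (ℕP.+-suc j j))))

isOdd-odd : ∀ j x → isOdd (suc (j ℕ.+ j)) x ≡ x
isOdd-odd zero x = ≡.refl
isOdd-odd (suc j) x rewrite ℕP.+-suc j j = isOdd-odd j x

rTerm-∣-rUpTo : ∀ N j n → suc (j ℕ.+ j) < n → rTerm N (suc (j ℕ.+ j)) ∣ rUpTo N n
rTerm-∣-rUpTo N j (suc n) lt = extend (suc (j ℕ.+ j) ℕP.≟ n)
  where
  extend : Dec (suc (j ℕ.+ j) ≡ n) → rTerm N (suc (j ℕ.+ j)) ∣ rUpTo N (suc n)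
  extend (yes ≡.refl) = ≡.subst (_∣ rUpTo N (suc n)) (isOdd-odd j (rTerm N n))
                          (n∣lcm[m,n] (rUpTo N n) (isOdd n (rTerm N n)))
  extend (no ≢n) = ∣-trans (rTerm-∣-rUpTo N j n (ℕP.≤∧≢⇒< (ℕP.≤-pred lt) ≢n))
                     (m∣lcm[m,n] (rUpTo N n) (isOdd n (rTerm N n)))

scaling : ℕ → ℕ
scaling N = N ! ℕ.* βB N ℕ.* rN N

module Integrality {c ℓ : Level} (K : CommutativeRing c ℓ) (inv : CommutativeRing.Carrier K → CommutativeRing.Carrier K)
                   (isInv : IsFieldInverse K inv) (char0 : CharZero K)
                   (N : ℕ) (sgn-N : CommutativeRing._≈_ K (RingLemmas.sgn K N) (CommutativeRing.1# K)) where
  open CommutativeRing K hiding (zero)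
  open RingLemmas K
  open ToddSeries K inv isInv char0
  open WithInv K inv
  open Relation.Binary.Reasoning.Setoid setoid

  κ : Carrier
  κ = ι (scaling N)

  private
    κ-split : ∀ x → κ * x ≈ ι (rN N) * (ι (βB N) * (ι (N !) * x))
    κ-split x = trans (*-congʳ (trans (ι-* (N ! ℕ.* βB N) (rN N)) (*-congʳ (ι-* (N !) (βB N)))))
      (solve 4 (λ a b c x → ((a :* b) :* c) :* x := c :* (b :* (a :* x))) refl (ι (N !)) (ι (βB N)) (ι (rN N)) x)
      where open Solver

    ratK-denominator : ∀ r → ι (↧ₙ r) * ratK r ≈ intK K (↥ r)
    ratK-denominator r@(mkℚ _ _ _) = ratK-represents r

  κ-td-N : κ * td N ≈ intK K (αB N ℤ.* + rN N)
  κ-td-N = begin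
    κ * td N                                             ≈⟨ κ-split (td N) ⟩
    ι (rN N) * (ι (βB N) * (ι (N !) * td N))             ≈⟨ *-congˡ (*-congˡ (td-bernoulli N)) ⟩
    ι (rN N) * (ι (βB N) * (sgn N * ratK (bernoulli N))) ≈⟨ *-congˡ (*-congˡ (trans (*-congʳ sgn-N) (*-identityˡ _))) ⟩
    ι (rN N) * (ι (βB N) * ratK (bernoulli N))           ≈⟨ *-congˡ (ratK-denominator (bernoulli N)) ⟩
    ι (rN N) * intK K (αB N)                             ≈⟨ *-comm _ _ ⟩
    intK K (αB N) * ι (rN N)                             ≈⟨ intK-* (αB N) (+ rN N) ⟨
    intK K (αB N ℤ.* + rN N)                             ∎

  td-product : ∀ i → i ≤ N → ι (N !) * (td i * td (N ℕ.∸ i)) ≈ ι (N C i) * (ratK (bernoulli i) * ratK (bernoulli (N ℕ.∸ i)))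
  td-product i i≤N = begin
    ι (N !) * (td i * td i′)
      ≡⟨ ≡.cong (λ z → ι z * (td i * td i′)) (binomial-factorials i≤N) ⟨
    ι ((N C i) ℕ.* (i ! ℕ.* i′ !)) * (td i * td i′)
      ≈⟨ *-congʳ (trans (ι-* (N C i) _) (*-congˡ (ι-* (i !) (i′ !)))) ⟩
    (ι (N C i) * (ι (i !) * ι (i′ !))) * (td i * td i′)
      ≈⟨ solve 5 (λ c f g x y → (c :* (f :* g)) :* (x :* y) := c :* ((f :* x) :* (g :* y))) refl _ _ _ _ _ ⟩
    ι (N C i) * ((ι (i !) * td i) * (ι (i′ !) * td i′))
      ≈⟨ *-congˡ (*-cong (td-bernoulli i) (td-bernoulli i′)) ⟩
    ι (N C i) * ((sgn i * B) * (sgn i′ * B′))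
      ≈⟨ *-congˡ (solve 4 (λ s b s′ b′ → (s :* b) :* (s′ :* b′) := (s :* s′) :* (b :* b′)) refl _ _ _ _) ⟩
    ι (N C i) * ((sgn i * sgn i′) * (B * B′))
      ≈⟨ *-congˡ (trans (*-congʳ signs) (*-identityˡ _)) ⟩
    ι (N C i) * (B * B′) ∎
    where
    open Solver
    i′ : ℕ
    i′ = N ℕ.∸ i
    B B′ : Carrier
    B = ratK (bernoulli i)
    B′ = ratK (bernoulli i′)
    signs : sgn i * sgn i′ ≈ 1#
    signs = trans (sym (^-+ (- 1#) i i′)) (trans (reflexive (≡.cong sgn (ℕP.m+[n∸m]≡n i≤N))) sgn-N)

  -- The definition of r_N indexes the product B_i B_{N-i} by the odd number i - 1, which is 2j + 1
  -- here. The bound i < N puts it into the range of the lcm, so r_N clears the denominator of `ρ`.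
  integral-even : ∀ j → suc (suc (j ℕ.+ j)) < N →
    ∃[ m ] κ * (td (suc (suc (j ℕ.+ j))) * td (N ℕ.∸ suc (suc (j ℕ.+ j)))) ≈ intK K m
  integral-even j i<N = + t ℤ.* ↥ ρ , (begin
    κ * (td i * td i′)                                     ≈⟨ κ-split _ ⟩
    ι (rN N) * (ι (βB N) * (ι (N !) * (td i * td i′)))     ≈⟨ *-congˡ (*-congˡ (td-product i (ℕP.<⇒≤ i<N))) ⟩
    ι (rN N) * (ι (βB N) * (ι (N C i) * (ratK (bernoulli i) * ratK (bernoulli i′))))
      ≈⟨ *-congˡ (solve 4 (λ a b c d → a :* (b :* (c :* d)) := ((a :* b) :* c) :* d) refl
             (ι (βB N)) (ι (N C i)) (ratK (bernoulli i)) (ratK (bernoulli i′))) ⟩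
    ι (rN N) * (((ι (βB N) * ι (N C i)) * ratK (bernoulli i)) * ratK (bernoulli i′))
      ≈⟨ *-congˡ (*-congʳ (*-congʳ (*-cong (ratK-ℕ (βB N)) (ratK-ℕ (N C i))))) ⟨
    ι (rN N) * (((ratK (ℚfromℕ (βB N)) * ratK (ℚfromℕ (N C i))) * ratK (bernoulli i)) * ratK (bernoulli i′))
      ≈⟨ *-congˡ (trans (ratK-* (ℚfromℕ (βB N) ℚ.* ℚfromℕ (N C i) ℚ.* bernoulli i) (bernoulli i′))
           (*-congʳ (trans (ratK-* (ℚfromℕ (βB N) ℚ.* ℚfromℕ (N C i)) (bernoulli i))
           (*-congʳ (ratK-* (ℚfromℕ (βB N)) (ℚfromℕ (N C i))))))) ⟨
    ι (rN N) * ratK ρ                                      ≡⟨ ≡.cong (λ r → ι r * ratK ρ) (_∣_.equality rTerm∣r) ⟩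
    ι (t ℕ.* ↧ₙ ρ) * ratK ρ                                ≈⟨ trans (*-congʳ (ι-* t (↧ₙ ρ))) (*-assoc _ _ _) ⟩
    ι t * (ι (↧ₙ ρ) * ratK ρ)                              ≈⟨ *-congˡ (ratK-denominator ρ) ⟩
    ι t * intK K (↥ ρ)                                     ≈⟨ intK-* (+ t) (↥ ρ) ⟨
    intK K (+ t ℤ.* ↥ ρ)                                   ∎)
    where
    open Solver
    i i′ : ℕ
    i = suc (suc (j ℕ.+ j))
    i′ = N ℕ.∸ i
    ρ : ℚ
    ρ = ℚfromℕ (βB N) ℚ.* ℚfromℕ (N C i) ℚ.* bernoulli i ℚ.* bernoulli i′
    rTerm∣r : rTerm N (suc (j ℕ.+ j)) ∣ rN N
    rTerm∣r = rTerm-∣-rUpTo N j (N ℕ.∸ 1) (ℕP.∸-monoˡ-≤ 1 i<N)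
    t : ℕ
    t = _∣_.quotient rTerm∣r

module EvenDegree {c ℓ : Level} (K : CommutativeRing c ℓ) (inv : CommutativeRing.Carrier K → CommutativeRing.Carrier K)
                  (isInv : IsFieldInverse K inv) (char0 : CharZero K) where
  open CommutativeRing K hiding (zero)
  open RingLemmas K
  open ToddSeries K inv isInv char0

  degree : ℕ → ℕ
  degree k = suc (suc (k ℕ.+ k))

  sgn-degree : ∀ k → sgn (degree k) ≈ 1#
  sgn-degree k = trans (reflexive (≡.cong (λ n → sgn (suc n)) (≡.sym (ℕP.+-suc k k)))) (sgn-even (suc k))

  private
    scaling-2 : ι (scaling 2) ≈ ι 12
    scaling-2 = reflexive (≡.cong ι {scaling 2} {12} ≡.refl)

  -- Needed for the ray that two adjacent cones share, which contributes the coefficient of degree N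
  -- - 1. That coefficient vanishes for N > 2. For N = 2 it is 1/2, while the scaling is 2!·6·1 =
  -- 12, whence the witness 6.
  integral-td-odd : ∀ k → ∃[ m ] ι (scaling (degree k)) * td (suc (k ℕ.+ k)) ≈ intK K m
  integral-td-odd zero = + 6 , trans (*-congʳ scaling-2)
    (trans (solve 1 (λ t → con (+ 12) :* t := con (+ 6) :* (t :+ t)) refl (td 1))
    (trans (*-congˡ (td-odd 0)) (*-identityʳ _)))
    where open Solver
  integral-td-odd (suc k) = + 0 , trans (*-congˡ (td-odd-zero k)) (zeroʳ _)

  -- The only middle terms with odd index that could survive are those with index 1 or N - 1. For N
  -- = 2 both are the single term 1/4, and 12/4 = 3; otherwise the factor of index N - 1 vanishes.
  integral-td-1 : ∀ k → ∃[ m ] ι (scaling (degree k)) * (td 1 * td (suc (k ℕ.+ k))) ≈ intK K m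
  integral-td-1 zero = + 3 , trans (*-congʳ scaling-2)
    (trans (solve 1 (λ t → con (+ 12) :* (t :* t) := con (+ 3) :* ((t :+ t) :* (t :+ t))) refl (td 1))
    (trans (*-congˡ (trans (*-cong (td-odd 0) (td-odd 0)) (*-identityʳ _))) (*-identityʳ _)))
    where open Solver
  integral-td-1 (suc k) = + 0 , trans (*-congˡ (trans (*-congˡ (td-odd-zero k)) (zeroʳ _))) (zeroʳ _)

  integral-td-product : ∀ k i → 1 ≤ i → i < degree k →
    ∃[ m ] ι (scaling (degree k)) * (td i * td (degree k ℕ.∸ i)) ≈ intK K m
  integral-td-product k i 1≤i i<N = split (parity i) 1≤i i<N
    where
    N = degree k
    split : ∀ {i} → ∃[ j ] (i ≡ j ℕ.+ j ⊎ i ≡ suc (j ℕ.+ j)) → 1 ≤ i → i < N →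
            ∃[ m ] ι (scaling N) * (td i * td (N ℕ.∸ i)) ≈ intK K m
    split (zero , inj₁ ≡.refl) () _
    split (suc j , inj₁ eq) _ i<N =
      ≡.subst (λ i → i < N → ∃[ m ] ι (scaling N) * (td i * td (N ℕ.∸ i)) ≈ intK K m)
        (≡.sym (≡.trans eq (≡.cong suc (ℕP.+-suc j j))))
        (Integrality.integral-even K inv isInv char0 N (sgn-degree k) j) i<N
    split (zero , inj₂ ≡.refl) _ _ = integral-td-1 k
    split (suc j , inj₂ ≡.refl) _ _ = + 0 , trans (*-congˡ (trans (*-congʳ (td-odd-zero j)) (zeroˡ _))) (zeroʳ _)

  -- All that the geometry uses of N! β_N r_N: a constant that makes the leading coefficient, the
  -- coefficient of the shared ray and the middle products integral. The Bernoulli numbers do not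
  -- appear beyond this point.
  record Normaliser (k : ℕ) : Set (c Level.⊔ ℓ) where
    field
      κ : Carrier
      leading odd : ℤ
      middle : ℕ → ℤ
      κ-leading : κ * td (degree k) ≈ intK K leading
      κ-odd : κ * td (suc (k ℕ.+ k)) ≈ intK K odd
      κ-middle : ∀ i → suc i < degree k → κ * (td (suc i) * td (degree k ℕ.∸ suc i)) ≈ intK K (middle i)

  normaliser : ∀ k → Normaliser k
  normaliser k = record
    { κ = ι (scaling N)
    ; leading = αB N ℤ.* + rN N
    ; odd = proj₁ (integral-td-odd k)
    ; middle = λ i → pick i (suc i ℕP.<? N)
    ; κ-leading = Integrality.κ-td-N K inv isInv char0 N (sgn-degree k)
    ; κ-odd = proj₂ (integral-td-odd k)
    ; κ-middle = λ i i<N → pick-spec i (suc i ℕP.<? N) i<N }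
    where
    N : ℕ
    N = degree k
    pick : ∀ i → Dec (suc i < N) → ℤ
    pick i (yes i<N) = proj₁ (integral-td-product k (suc i) (s≤s z≤n) i<N)
    -- A default outside the range: `middle` is total, but `κ-middle` speaks only of indices below
    -- N.
    pick i (no _) = + 0
    pick-spec : ∀ i (d : Dec (suc i < N)) → suc i < N →
                ι (scaling N) * (td (suc i) * td (N ℕ.∸ suc i)) ≈ intK K (pick i d)
    pick-spec i (yes i<N) _ = proj₂ (integral-td-product k (suc i) (s≤s z≤n) i<N)
    pick-spec i (no i≮N) i<N = contradiction i<N i≮N

-- Subdivision of cones

module _ {c ℓ : Level} (S : CommutativeRing c ℓ) where
  open CommutativeRing S
  open RingLemmas.Solver S
  open Relation.Binary.Reasoning.Setoid setoid

  -- With Tᵤ = uX / (1 - Eᵤ) and so on, and with F = P / ((1 - E_w)(1 - E_z)), F′ = P′ / ((1 - Eᵤ)(1 - E_z)),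
  -- this is F′ = 1 / ((1 - Eᵤ)(1 - E_w)) + F - 1 / (1 - E_w): subdivision of a cone by the ray w.
  subdivision : ∀ {X u w z Tu Tw Tz Eu Ew Ez P P′} →
    Tu * (1# - Eu) ≈ u * X → Tw * (1# - Ew) ≈ w * X → Tz * (1# - Ez) ≈ z * X →
    (1# - Ew) * P′ ≈ Eu * (1# - Ez) + (1# - Eu) * P →
    X * (w * ((Tu * Tz) * P′)) ≈ X * ((z * (Tu * Tw) + u * ((Tw * Tz) * P)) - u * (z * (X * Tw)))
  subdivision {X} {u} {w} {z} {Tu} {Tw} {Tz} {Eu} {Ew} {Ez} {P} {P′} tu tw tz rec = begin
    X * (w * ((Tu * Tz) * P′))
      ≈⟨ solve 5 (λ x w t s p → x :* (w :* ((t :* s) :* p)) := ((t :* s) :* (w :* x)) :* p) refl X w Tu Tz P′ ⟩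
    ((Tu * Tz) * (w * X)) * P′
      ≈⟨ *-congʳ (*-congˡ tw) ⟨
    ((Tu * Tz) * (Tw * (1# - Ew))) * P′
      ≈⟨ solve 5 (λ t s r e p → ((t :* s) :* (r :* e)) :* p := ((t :* s) :* r) :* (e :* p)) refl Tu Tz Tw (1# - Ew) P′ ⟩
    ((Tu * Tz) * Tw) * ((1# - Ew) * P′)
      ≈⟨ *-congˡ rec ⟩
    ((Tu * Tz) * Tw) * (Eu * (1# - Ez) + (1# - Eu) * P)
      ≈⟨ solve 7 (λ t s r e o f p → ((t :* s) :* r) :* (e :* f :+ (o :- e) :* p)
                    := r :* ((t :* o :- t :* (o :- e)) :* (s :* f)) :+ ((s :* r) :* p) :* (t :* (o :- e))) refl
           Tu Tz Tw Eu 1# (1# - Ez) P ⟩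
    Tw * ((Tu * 1# - Tu * (1# - Eu)) * (Tz * (1# - Ez))) + ((Tz * Tw) * P) * (Tu * (1# - Eu))
      ≈⟨ +-cong (*-congˡ (*-cong (+-cong (*-identityʳ Tu) (-‿cong tu)) tz)) (*-congˡ tu) ⟩
    Tw * ((Tu - u * X) * (z * X)) + ((Tz * Tw) * P) * (u * X)
      ≈⟨ solve 7 (λ x u z t r s p → r :* ((t :- u :* x) :* (z :* x)) :+ ((s :* r) :* p) :* (u :* x)
                    := x :* ((z :* (t :* r) :+ u :* ((r :* s) :* p)) :- u :* (z :* (x :* r)))) refl X u z Tu Tw Tz P ⟩
    X * ((z * (Tu * Tw) + u * ((Tw * Tz) * P)) - u * (z * (X * Tw))) ∎

  -- Here V is v^(N-1). The first hypothesis replaces w by v as neighbour of the outer ray of value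
  -- u, the error being a multiple of u. The second joins the two boundary terms at the new ray,
  -- u^(N-1)/w and v^(N-1)/w, into the polynomial D′. The term with o comes from the ray counted
  -- twice.
  combine : ∀ {z A w wᵐ u uᵐ J V W I o wⁿ D D′} → wᵐ ≈ V + u * D → uᵐ + V ≈ w * D′ →
    (z * (A * (w * wᵐ + u * uᵐ) + (u * w) * J) + u * (A * (z * V + w * W) + (w * z) * I)) - u * (z * (o * (w * wⁿ)))
    ≈ w * (A * (z * V + u * W) + (u * z) * (((J + I) + (- (o * wⁿ))) + A * (D′ + D)))
  combine {z} {A} {w} {wᵐ} {u} {uᵐ} {J} {V} {W} {I} {o} {wⁿ} {D} {D′} wᵐ≈ uᵐ≈ = begin
    (z * (A * (w * wᵐ + u * uᵐ) + (u * w) * J) + u * (A * (z * V + w * W) + (w * z) * I)) - u * (z * (o * (w * wⁿ)))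
      ≈⟨ solve 12 (λ z A w wᵐ u uᵐ J V W I o wⁿ →
             (z :* (A :* (w :* wᵐ :+ u :* uᵐ) :+ (u :* w) :* J) :+ u :* (A :* (z :* V :+ w :* W) :+ (w :* z) :* I))
               :- u :* (z :* (o :* (w :* wⁿ)))
           := ((z :* A) :* (w :* wᵐ) :+ (z :* A) :* (u :* (uᵐ :+ V)))
               :+ w :* ((A :* (u :* W)) :+ (u :* z) :* ((J :+ I) :+ (:- (o :* wⁿ))))) refl
           z A w wᵐ u uᵐ J V W I o wⁿ ⟩
    ((z * A) * (w * wᵐ) + (z * A) * (u * (uᵐ + V))) + w * ((A * (u * W)) + (u * z) * ((J + I) + (- (o * wⁿ))))
      ≈⟨ +-congʳ (+-cong (*-congˡ (*-congˡ wᵐ≈)) (*-congˡ (*-congˡ uᵐ≈))) ⟩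
    ((z * A) * (w * (V + u * D)) + (z * A) * (u * (w * D′))) + w * ((A * (u * W)) + (u * z) * ((J + I) + (- (o * wⁿ))))
      ≈⟨ solve 9 (λ z A w V u D D′ W R →
             ((z :* A) :* (w :* (V :+ u :* D)) :+ (z :* A) :* (u :* (w :* D′))) :+ w :* ((A :* (u :* W)) :+ (u :* z) :* R)
           := w :* (A :* (z :* V :+ u :* W) :+ (u :* z) :* (R :+ A :* (D′ :+ D)))) refl
           z A w V u D D′ W ((J + I) + (- (o * wⁿ))) ⟩
    w * (A * (z * V + u * W) + (u * z) * (((J + I) + (- (o * wⁿ))) + A * (D′ + D))) ∎

-- Todd coefficients of cones along the Euclidean algorithm.

module Reciprocity {c ℓ : Level} (K : CommutativeRing c ℓ) (inv : CommutativeRing.Carrier K → CommutativeRing.Carrier K)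
    (isInv : IsFieldInverse K inv) (char0 : CharZero K) (k : ℕ) (D : EvenDegree.Normaliser K inv isInv char0 k) (x₀ : ℕ) where
  open CommutativeRing K hiding (zero)
  open RingLemmas K
  open FieldLemmas K inv isInv char0
  open PowerSeries K
  open ToddSeries K inv isInv char0
  open Polynomials K inv isInv char0
  open WithInv K inv using (ratK)
  open Relation.Binary.Reasoning.Setoid setoid
  private module S = CommutativeRing seriesRing
  open PathSums seriesRing
  open EvenDegree.Normaliser D

  private
    n N : ℕ
    n = k ℕ.+ k
    N = suc (suc n)

    A : Carrier
    A = intK K leading

  T : ℕ → Series
  T u = scale (ι u) td

  td-0 : td 0 ≈ 1#
  td-0 = begin
    td 0                        ≈⟨ trans (*-congʳ ι-1) (*-identityˡ _) ⟨
    ι 1 * td 0                  ≈⟨ td-bernoulli 0 ⟩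
    1# * ratK (bernoulli 0)     ≈⟨ *-identityˡ _ ⟩
    ratK (ℚfromℕ 1)             ≈⟨ ratK-ℕ 1 ⟩
    ι 1                         ≈⟨ ι-1 ⟩
    1#                          ∎

  J : Carrier → Carrier → Carrier
  J u w = Σ (suc n) (λ i → intK K (middle i) * (u ^ i * w ^ (n ℕ.∸ i)))

  -- In the Cauchy product only the two end terms lack the factor u w. They carry the Bernoulli
  -- number B_N; the rest is integral after scaling.
  smooth-cone : ∀ u w → κ * (T u ⊛ T w) N ≈ A * (ι w ^ N + ι u ^ N) + (ι u * ι w) * J (ι u) (ι w)
  smooth-cone u w = begin
    κ * (T u ⊛ T w) N
      ≈⟨ *-congˡ (⊛-coeff (T u) (T w) N) ⟩
    κ * (Σ (suc (suc n)) f + f N)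
      ≈⟨ *-congˡ (+-congʳ (Σ-front (suc n) f)) ⟩
    κ * ((f 0 + Σ (suc n) (λ i → f (suc i))) + f N)
      ≈⟨ solve 4 (λ k a b c → k :* ((a :+ b) :+ c) := (k :* a :+ k :* c) :+ k :* b) refl κ (f 0) _ (f N) ⟩
    (κ * f 0 + κ * f N) + κ * Σ (suc n) (λ i → f (suc i))
      ≈⟨ +-cong (+-cong first last) (trans (Σ-*ˡ (suc n) κ _) (Σ-cong-< (suc n) inner)) ⟩
    (A * ι w ^ N + A * ι u ^ N) + Σ (suc n) (λ i → (ι u * ι w) * (intK K (middle i) * (ι u ^ i * ι w ^ (n ℕ.∸ i))))
      ≈⟨ +-cong (distribˡ _ _ _) (Σ-*ˡ (suc n) (ι u * ι w) _) ⟨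
    A * (ι w ^ N + ι u ^ N) + (ι u * ι w) * J (ι u) (ι w) ∎
    where
    open Solver
    f : ℕ → Carrier
    f i = T u i * T w (N ℕ.∸ i)
    first : κ * f 0 ≈ A * ι w ^ N
    first = begin
      κ * ((td 0 * 1#) * (td N * ι w ^ N))   ≈⟨ *-congˡ (trans (*-congʳ (trans (*-identityʳ _) td-0)) (*-identityˡ _)) ⟩
      κ * (td N * ι w ^ N)                   ≈⟨ *-assoc _ _ _ ⟨
      (κ * td N) * ι w ^ N                   ≈⟨ *-congʳ κ-leading ⟩
      A * ι w ^ N                            ∎
    last : κ * f N ≈ A * ι u ^ N
    last = begin
      κ * ((td N * ι u ^ N) * T w (N ℕ.∸ N))  ≡⟨ ≡.cong (λ m → κ * ((td N * ι u ^ N) * T w m)) (ℕP.n∸n≡0 N) ⟩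
      κ * ((td N * ι u ^ N) * (td 0 * 1#))    ≈⟨ *-congˡ (trans (*-congˡ (trans (*-identityʳ _) td-0)) (*-identityʳ _)) ⟩
      κ * (td N * ι u ^ N)                    ≈⟨ *-assoc _ _ _ ⟨
      (κ * td N) * ι u ^ N                    ≈⟨ *-congʳ κ-leading ⟩
      A * ι u ^ N                             ∎
    inner : ∀ i → i < suc n → κ * f (suc i) ≈ (ι u * ι w) * (intK K (middle i) * (ι u ^ i * ι w ^ (n ℕ.∸ i)))
    inner i i<1+n = begin
      κ * ((td (suc i) * (ι u * ι u ^ i)) * (td (suc n ℕ.∸ i) * ι w ^ (suc n ℕ.∸ i)))
        ≡⟨ ≡.cong (λ m → κ * ((td (suc i) * (ι u * ι u ^ i)) * (td (suc n ℕ.∸ i) * ι w ^ m))) (ℕP.+-∸-assoc 1 (ℕP.≤-pred i<1+n)) ⟩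
      κ * ((td (suc i) * (ι u * ι u ^ i)) * (td (suc n ℕ.∸ i) * (ι w * ι w ^ (n ℕ.∸ i))))
        ≈⟨ solve 7 (λ k a b u p w r → k :* ((a :* (u :* p)) :* (b :* (w :* r))) := (u :* w) :* ((k :* (a :* b)) :* (p :* r))) refl
             κ (td (suc i)) (td (suc n ℕ.∸ i)) (ι u) (ι u ^ i) (ι w) (ι w ^ (n ℕ.∸ i)) ⟩
      (ι u * ι w) * ((κ * (td (suc i) * td (suc n ℕ.∸ i))) * (ι u ^ i * ι w ^ (n ℕ.∸ i)))
        ≈⟨ *-congˡ (*-congʳ (κ-middle i (s≤s i<1+n))) ⟩
      (ι u * ι w) * (intK K (middle i) * (ι u ^ i * ι w ^ (n ℕ.∸ i))) ∎

  poly-J : ∀ {f g} → IntPoly x₀ f → IntPoly x₀ g → IntPoly x₀ (λ x → J (f x) (g x))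
  poly-J P Q = poly-Σ (suc n) λ i _ → poly-* (poly-const (middle i)) (poly-* (poly-^ P i) (poly-^ Q (n ℕ.∸ i)))

  coneSum : ∀ {p q} → Euclid p q → ℕ → ℕ → Series
  coneSum E u v = pathSum (weight exp exp-+ u v) 0 0 (word E)

  -- With z the value of (p,q), this is u z X² times the generating function of all lattice points
  -- of the closed cone, whose denominators 1 - E^u and 1 - E^z the two factors `T` absorb.
  coneTodd : ∀ {p q} → Euclid p q → ℕ → ℕ → Series
  coneTodd {p} {q} E u v = (T u ⊛ T (p ℕ.* u ℕ.+ q ℕ.* v)) ⊛ coneSum E u v

  coneSum-base : ∀ u v → coneSum base u v ≋ cst 1#
  coneSum-base u v = S.trans (S.+-identityʳ _) scale-exp-0

  coneTodd-stepA : ∀ {p q} (E : Euclid p q) u v → coneTodd (stepA E) u v ≋ coneTodd E u (u ℕ.+ v)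
  coneTodd-stepA {p} {q} E u v = S.*-cong
    (S.reflexive (≡.cong (λ z → T u ⊛ T z)
      (solve 4 (λ p q u v → (p :+ q) :* u :+ q :* v := p :* u :+ q :* (u :+ v)) ≡.refl p q u v)))
    (S.trans (pathSum-substA (weight exp exp-+ u v) 0 0 (word E))
      (pathSum-cong (λ c j → S.reflexive (≡.cong exp
        (solve 4 (λ c j u v → (c :+ j) :* u :+ j :* v := c :* u :+ j :* (u :+ v)) ≡.refl c j u v))) 0 0 (word E)))
    where open Data.Nat.Solver.+-*-Solver

  coneTodd-stepB : ∀ {p r} (E : Euclid p r) u v → let w = u ℕ.+ v ; z = p ℕ.* u ℕ.+ (p ℕ.+ r) ℕ.* v in
    cst (ι w) ⊛ coneTodd (stepB E) u v ≋
    (cst (ι z) ⊛ (T u ⊛ T w) ⊕ cst (ι u) ⊛ coneTodd E w v) ⊕ ⊖ (cst (ι u) ⊛ (cst (ι z) ⊛ (X ⊛ T w)))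
  coneTodd-stepB {p} {r} E u v = X-cancel (S.trans
    (subdivision seriesRing (scaled-td (ι u)) (scaled-td (ι w)) (scaled-td (ι z)) rec)
    (S.reflexive (≡.cong (λ m → X ⊛ ((cst (ι z) ⊛ (T u ⊛ T w) ⊕ cst (ι u) ⊛ ((T w ⊛ T m) ⊛ coneSum E w v))
                                   ⊕ ⊖ (cst (ι u) ⊛ (cst (ι z) ⊛ (X ⊛ T w))))) z≡)))
    where
    w z : ℕ
    w = u ℕ.+ v
    z = p ℕ.* u ℕ.+ (p ℕ.+ r) ℕ.* v
    z≡ : z ≡ p ℕ.* w ℕ.+ r ℕ.* v
    z≡ = solve 4 (λ p r u v → p :* u :+ (p :+ r) :* v := p :* (u :+ v) :+ r :* v) ≡.refl p r u v
      where open Data.Nat.Solver.+-*-Solver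
    end : weight exp exp-+ w v (#a (word E)) (#b (word E)) ≋ exp z
    end = S.reflexive (≡.cong exp (≡.trans (≡.cong₂ (λ c j → c ℕ.* w ℕ.+ j ℕ.* v) (#a-word E) (#b-word E)) (≡.sym z≡)))
    rec : (cst 1# ⊕ ⊖ exp w) ⊛ coneSum (stepB E) u v ≋ exp u ⊛ (cst 1# ⊕ ⊖ exp z) ⊕ (cst 1# ⊕ ⊖ exp u) ⊛ coneSum E w v
    rec = S.trans (pathSum-substB exp exp-+ u v 0 0 (word E))
      (S.+-congʳ (S.*-congˡ (S.+-cong scale-exp-0 (S.-‿cong end))))

  Positive : (ℕ → ℕ) → Set
  Positive u = ∀ x → x₀ ≤ x → 0 < u x

  -- Divided by u z, the right side is A (v^(N-1)/u + W^(N-1)/z) + I, where W is the value of the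
  -- last inner neighbour. The neighbour of (1,0) has the form (c,1), with value cu + v, and is
  -- recorded as v: the difference of the powers is a multiple of u and goes into I. The functions u
  -- and v are arbitrary because the steps of Euclid change them.
  Formula : ∀ {p q} → Euclid p q → Set (c Level.⊔ ℓ)
  Formula {p} {q} E = ∀ (u v : ℕ → ℕ) → Positive u → Positive v →
    IntPoly x₀ (λ x → ι (u x)) → IntPoly x₀ (λ x → ι (v x)) →
    ∃[ I ] (IntPoly x₀ I × (∀ x → x₀ ≤ x → let z = ι (p ℕ.* u x ℕ.+ q ℕ.* v x) in
      κ * coneTodd E (u x) (v x) N ≈
        A * (z * ι (v x) ^ suc n + ι (u x) * ι (dual₁ E ℕ.* u x ℕ.+ dual₂ E ℕ.* v x) ^ suc n) + (ι (u x) * z) * I x))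

  private
    poly-ι-+ : ∀ (u v : ℕ → ℕ) → IntPoly x₀ (λ x → ι (u x)) → IntPoly x₀ (λ x → ι (v x)) → IntPoly x₀ (λ x → ι (u x ℕ.+ v x))
    poly-ι-+ u v Pu Pv = poly-resp (λ x _ → ι-+ (u x) (v x)) (poly-+ Pu Pv)

    positive-+ : ∀ (u v : ℕ → ℕ) → Positive u → Positive (λ x → u x ℕ.+ v x)
    positive-+ u v 0<u x le = ℕP.≤-trans (0<u x le) (ℕP.m≤m+n (u x) (v x))

    shifted-power : ∀ (u v : ℕ → ℕ) → IntPoly x₀ (λ x → ι (u x)) → IntPoly x₀ (λ x → ι (v x)) →
      ∃[ D ] (IntPoly x₀ D × (∀ x → ι (u x ℕ.+ v x) ^ suc n ≈ ι (v x) ^ suc n + ι (u x) * D x))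
    shifted-power u v Pu Pv = map₂ (λ {D} (PD , eq) → PD , λ x → begin
      ι (u x ℕ.+ v x) ^ suc n
        ≈⟨ solve 2 (λ a b → a := b :+ (a :- b)) refl (ι (u x ℕ.+ v x) ^ suc n) (ι (v x) ^ suc n) ⟩
      ι (v x) ^ suc n + (ι (u x ℕ.+ v x) ^ suc n - ι (v x) ^ suc n)
        ≈⟨ +-congˡ (eq x) ⟩
      ι (v x) ^ suc n + (ι (u x ℕ.+ v x) - ι (v x)) * D x
        ≈⟨ +-congˡ (*-congʳ (trans (+-congʳ (ι-+ (u x) (v x))) (solve 2 (λ a b → (a :+ b) :- b := a) refl (ι (u x)) (ι (v x))))) ⟩
      ι (v x) ^ suc n + ι (u x) * D x ∎) (difference-quotient (poly-ι-+ u v Pu Pv) Pv (suc n))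
      where open Solver

    -- The exponent N - 1 is odd, so this is the difference quotient of u and -v. It is the place
    -- where the evenness of N makes the boundary terms at inner rays polynomial.
    power-sum : ∀ (u v : ℕ → ℕ) → IntPoly x₀ (λ x → ι (u x)) → IntPoly x₀ (λ x → ι (v x)) →
      ∃[ D ] (IntPoly x₀ D × (∀ x → ι (u x) ^ suc n + ι (v x) ^ suc n ≈ ι (u x ℕ.+ v x) * D x))
    power-sum u v Pu Pv = map₂ (λ {D} (PD , eq) → PD , λ x → begin
      ι (u x) ^ suc n + ι (v x) ^ suc n
        ≈⟨ solve 2 (λ a b → a :+ b := a :- (:- b)) refl (ι (u x) ^ suc n) (ι (v x) ^ suc n) ⟩
      ι (u x) ^ suc n - (- (ι (v x) ^ suc n))
        ≈⟨ +-congˡ (-‿cong (neg-^-odd (ι (v x)) k)) ⟨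
      ι (u x) ^ suc n - (- ι (v x)) ^ suc n
        ≈⟨ eq x ⟩
      (ι (u x) - (- ι (v x))) * D x
        ≈⟨ *-congʳ (trans (solve 2 (λ a b → a :- (:- b) := a :+ b) refl (ι (u x)) (ι (v x))) (sym (ι-+ (u x) (v x)))) ⟩
      ι (u x ℕ.+ v x) * D x ∎) (difference-quotient Pu (poly-neg Pv) (suc n))
      where open Solver

  formula-base : Formula base
  formula-base u v _ _ Pu Pv = (λ x → J (ι (u x)) (ι (v x))) , poly-J Pu Pv , λ x _ → begin
    κ * coneTodd base (u x) (v x) N
      ≈⟨ *-congˡ (at (S.trans (S.*-congˡ {T (u x) ⊛ T (0 ℕ.* u x ℕ.+ 1 ℕ.* v x)} (coneSum-base (u x) (v x))) (S.*-identityʳ (T (u x) ⊛ T (0 ℕ.* u x ℕ.+ 1 ℕ.* v x)))) N) ⟩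
    κ * (T (u x) ⊛ T (0 ℕ.* u x ℕ.+ 1 ℕ.* v x)) N
      ≡⟨ ≡.cong (λ z → κ * (T (u x) ⊛ T z) N) (z≡ x) ⟩
    κ * (T (u x) ⊛ T (v x)) N
      ≈⟨ smooth-cone (u x) (v x) ⟩
    A * (ι (v x) * ι (v x) ^ suc n + ι (u x) * ι (u x) ^ suc n) + (ι (u x) * ι (v x)) * J (ι (u x)) (ι (v x))
      ≡⟨ ≡.cong₂ (λ z w → A * (ι z * ι (v x) ^ suc n + ι (u x) * ι w ^ suc n) + (ι (u x) * ι z) * J (ι (u x)) (ι (v x)))
           (≡.sym (z≡ x)) (≡.sym (≡.trans (ℕP.+-identityʳ _) (ℕP.+-identityʳ (u x)))) ⟩
    A * (ι (0 ℕ.* u x ℕ.+ 1 ℕ.* v x) * ι (v x) ^ suc n + ι (u x) * ι (1 ℕ.* u x ℕ.+ 0 ℕ.* v x) ^ suc n)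
      + (ι (u x) * ι (0 ℕ.* u x ℕ.+ 1 ℕ.* v x)) * J (ι (u x)) (ι (v x)) ∎
    where
    z≡ : ∀ x → 0 ℕ.* u x ℕ.+ 1 ℕ.* v x ≡ v x
    z≡ x = ℕP.+-identityʳ (v x)

  -- The cone is the same up to the shear, but the induction hypothesis records u + v as the
  -- neighbour of the first ray. Replacing it by v changes the power by a multiple of u, which moves
  -- into I.
  formula-stepA : ∀ {p q} (E : Euclid p q) → Formula E → Formula (stepA E)
  formula-stepA {p} {q} E IH u v 0<u 0<v Pu Pv =
    let (I , PI , eq) = IH u (λ x → u x ℕ.+ v x) 0<u (positive-+ u v 0<u) Pu (poly-ι-+ u v Pu Pv)
        (D , PD , D-eq) = shifted-power u v Pu Pv
    in (λ x → I x + A * D x) , poly-+ PI (poly-* (poly-const leading) PD) , λ x le → begin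
    κ * coneTodd (stepA E) (u x) (v x) N
      ≈⟨ *-congˡ (at (coneTodd-stepA E (u x) (v x)) N) ⟩
    κ * coneTodd E (u x) (u x ℕ.+ v x) N
      ≈⟨ eq x le ⟩
    A * (ι (p ℕ.* u x ℕ.+ q ℕ.* (u x ℕ.+ v x)) * ι (u x ℕ.+ v x) ^ suc n
         + ι (u x) * ι (dual₁ E ℕ.* u x ℕ.+ dual₂ E ℕ.* (u x ℕ.+ v x)) ^ suc n)
      + (ι (u x) * ι (p ℕ.* u x ℕ.+ q ℕ.* (u x ℕ.+ v x))) * I x
      ≡⟨ ≡.cong₂ (λ z w → A * (ι z * ι (u x ℕ.+ v x) ^ suc n + ι (u x) * ι w ^ suc n) + (ι (u x) * ι z) * I x)
           (shear p q (u x) (v x)) (shear (dual₁ E) (dual₂ E) (u x) (v x)) ⟩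
    A * (z x * ι (u x ℕ.+ v x) ^ suc n + ι (u x) * W x) + (ι (u x) * z x) * I x
      ≈⟨ +-congʳ (*-congˡ (+-congʳ (*-congˡ (D-eq x)))) ⟩
    A * (z x * (ι (v x) ^ suc n + ι (u x) * D x) + ι (u x) * W x) + (ι (u x) * z x) * I x
      ≈⟨ solve 7 (λ A z V u D W I → A :* (z :* (V :+ u :* D) :+ u :* W) :+ (u :* z) :* I
                                 := A :* (z :* V :+ u :* W) :+ (u :* z) :* (I :+ A :* D)) refl
           A (z x) (ι (v x) ^ suc n) (ι (u x)) (D x) (W x) (I x) ⟩
    A * (z x * ι (v x) ^ suc n + ι (u x) * W x) + (ι (u x) * z x) * (I x + A * D x) ∎
    where
    open Solver
    z W : ℕ → Carrier
    z x = ι ((p ℕ.+ q) ℕ.* u x ℕ.+ q ℕ.* v x)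
    W x = ι ((dual₁ E ℕ.+ dual₂ E) ℕ.* u x ℕ.+ dual₂ E ℕ.* v x) ^ suc n
    shear : ∀ p q u v → p ℕ.* u ℕ.+ q ℕ.* (u ℕ.+ v) ≡ (p ℕ.+ q) ℕ.* u ℕ.+ q ℕ.* v
    shear = ℕS.solve 4 (λ p q u v → p ℕS.:* u ℕS.:+ q ℕS.:* (u ℕS.:+ v) ℕS.:= (p ℕS.:+ q) ℕS.:* u ℕS.:+ q ℕS.:* v) ≡.refl
      where module ℕS = Data.Nat.Solver.+-*-Solver

  formula-stepB : ∀ {p r} (E : Euclid p r) → Formula E → Formula (stepB E)
  formula-stepB {p} {r} E IH u v 0<u 0<v Pu Pv =
    let (I , PI , eq) = IH (λ x → u x ℕ.+ v x) v (positive-+ u v 0<u) 0<v (poly-ι-+ u v Pu Pv) Pv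
        (D , PD , D-eq) = shifted-power u v Pu Pv
        (D′ , PD′ , D′-eq) = power-sum u v Pu Pv
    in
    (λ x → ((J (U x) (w x) + I x) + (- (intK K odd * w x ^ n))) + A * (D′ x + D x)) ,
    poly-+ (poly-+ (poly-+ (poly-J Pu Pw) PI) (poly-neg (poly-* (poly-const odd) (poly-^ Pw n))))
           (poly-* (poly-const leading) (poly-+ PD′ PD)) ,
    -- The subdivision identity holds only after multiplication by the value of the new ray. It is
    -- cancelled at each x separately, so the witness above involves no division.
    λ x le → ι-cancel (positive-+ u v 0<u x le) (begin
    w x * (κ * coneTodd (stepB E) (u x) (v x) N)
      ≈⟨ solve 3 (λ w k m → w :* (k :* m) := k :* (w :* m)) refl (w x) κ (coneTodd (stepB E) (u x) (v x) N) ⟩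
    κ * (w x * coneTodd (stepB E) (u x) (v x) N)
      ≈⟨ *-congˡ (cst-⊛ (w x) (coneTodd (stepB E) (u x) (v x)) N) ⟨
    κ * (cst (w x) ⊛ coneTodd (stepB E) (u x) (v x)) N
      ≈⟨ *-congˡ (at (coneTodd-stepB E (u x) (v x)) N) ⟩
    κ * (((cst (z x) ⊛ TuTw x) N + (cst (U x) ⊛ M x) N) - (cst (U x) ⊛ (cst (z x) ⊛ (X ⊛ T (u x ℕ.+ v x)))) N)
      ≈⟨ *-congˡ (+-cong (+-cong (cst-⊛ (z x) (TuTw x) N) (cst-⊛ (U x) (M x) N)) (-‿cong
           (trans (cst-⊛ (U x) _ N) (*-congˡ (trans (cst-⊛ (z x) _ N) (*-congˡ (X-⊛ (T (u x ℕ.+ v x)) (suc n)))))))) ⟩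
    κ * ((z x * TuTw x N + U x * M x N) - U x * (z x * (td (suc n) * w x ^ suc n)))
      ≈⟨ solve 7 (λ k z a u m t p → k :* ((z :* a :+ u :* m) :- u :* (z :* (t :* p)))
                                 := (z :* (k :* a) :+ u :* (k :* m)) :- u :* (z :* ((k :* t) :* p))) refl
           κ (z x) (TuTw x N) (U x) (M x N) (td (suc n)) (w x ^ suc n) ⟩
    (z x * (κ * TuTw x N) + U x * (κ * M x N)) - U x * (z x * ((κ * td (suc n)) * w x ^ suc n))
      ≈⟨ +-cong (+-cong (*-congˡ (smooth-cone (u x) (u x ℕ.+ v x))) (*-congˡ (trans (eq x le) (reflexive (shear I x)))))
                (-‿cong (*-congˡ (*-congˡ (*-congʳ κ-odd)))) ⟩
    (z x * (A * (w x * w x ^ suc n + U x * U x ^ suc n) + (U x * w x) * J (U x) (w x))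
      + U x * (A * (z x * V x + w x * W x) + (w x * z x) * I x)) - U x * (z x * (intK K odd * (w x * w x ^ n)))
      ≈⟨ combine K (D-eq x) (D′-eq x) ⟩
    w x * (A * (z x * V x + U x * W x)
      + (U x * z x) * (((J (U x) (w x) + I x) + (- (intK K odd * w x ^ n))) + A * (D′ x + D x))) ∎)
    where
    open Solver
    U V w z W : ℕ → Carrier
    U x = ι (u x)
    V x = ι (v x) ^ suc n
    w x = ι (u x ℕ.+ v x)
    z x = ι (p ℕ.* u x ℕ.+ (p ℕ.+ r) ℕ.* v x)
    W x = ι (dual₁ E ℕ.* u x ℕ.+ (dual₁ E ℕ.+ dual₂ E) ℕ.* v x) ^ suc n
    Pw : IntPoly x₀ w
    Pw = poly-ι-+ u v Pu Pv
    TuTw M : ℕ → Series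
    TuTw x = T (u x) ⊛ T (u x ℕ.+ v x)
    M x = coneTodd E (u x ℕ.+ v x) (v x)
    shear-ℕ : ∀ p r u v → p ℕ.* (u ℕ.+ v) ℕ.+ r ℕ.* v ≡ p ℕ.* u ℕ.+ (p ℕ.+ r) ℕ.* v
    shear-ℕ = ℕS.solve 4 (λ p r u v → p ℕS.:* (u ℕS.:+ v) ℕS.:+ r ℕS.:* v ℕS.:= p ℕS.:* u ℕS.:+ (p ℕS.:+ r) ℕS.:* v) ≡.refl
      where module ℕS = Data.Nat.Solver.+-*-Solver
    shear : ∀ (I : ℕ → Carrier) x → A * (ι (p ℕ.* (u x ℕ.+ v x) ℕ.+ r ℕ.* v x) * V x
                       + w x * ι (dual₁ E ℕ.* (u x ℕ.+ v x) ℕ.+ dual₂ E ℕ.* v x) ^ suc n)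
                   + (w x * ι (p ℕ.* (u x ℕ.+ v x) ℕ.+ r ℕ.* v x)) * I x
                 ≡ A * (z x * V x + w x * W x) + (w x * z x) * I x
    shear I x = ≡.cong₂ (λ z m → A * (ι z * V x + w x * ι m ^ suc n) + (w x * ι z) * I x)
      (shear-ℕ p r (u x) (v x)) (shear-ℕ (dual₁ E) (dual₂ E) (u x) (v x))

  formula : ∀ {p q} (E : Euclid p q) → Formula E
  formula base = formula-base
  formula (stepA E) = formula-stepA E (formula E)
  formula (stepB E) = formula-stepB E (formula E)

-- Characters and lattice points

residue-unique : ∀ {q m} l d → l < q → d < q → q ∣ m ℕ.+ l → q ∣ m ℕ.+ d → l ≡ d
residue-unique {q} {m} l d l<q d<q q∣l q∣d = [ (λ l≤d → ordered l d l≤d d<q q∣l q∣d) , (λ d≤l → ≡.sym (ordered d l d≤l l<q q∣d q∣l)) ]′ (ℕP.≤-total l d)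
  where
  ordered : ∀ l d → l ≤ d → d < q → q ∣ m ℕ.+ l → q ∣ m ℕ.+ d → l ≡ d
  ordered l d l≤d d<q q∣l q∣d with ℕP.m≤n⇒∃[o]m+o≡n l≤d
  ... | zero , eq = ≡.trans (≡.sym (ℕP.+-identityʳ l)) eq
  ... | suc k , ≡.refl = contradiction
    (∣m+n∣m⇒∣n (≡.subst (q ∣_) (≡.sym (ℕP.+-assoc m l (suc k))) q∣d) q∣l)
    (>⇒∤ (ℕP.≤-<-trans (ℕP.m≤n+m (suc k) l) d<q))

-- Taking absolute values moves the integer equation e + pj = -t q to natural numbers, where the
-- exponents of ζ live.
negated-residue : ∀ p q j e t → + q ℤ.* + 0 ℤ.- + p ℤ.* + j ≡ + e ℤ.+ t ℤ.* + q → e ℕ.+ p ℕ.* j ≡ ℤ.∣ ℤ.- t ∣ ℕ.* q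
negated-residue p q j e t eq = begin
  ℤ.∣ + e ℤ.+ + (p ℕ.* j) ∣
    ≡⟨ ≡.cong (λ m → ℤ.∣ + e ℤ.+ m ∣) (ℤP.pos-* p j) ⟩
  ℤ.∣ + e ℤ.+ + p ℤ.* + j ∣
    ≡⟨ ≡.cong ℤ.∣_∣ (solve 4 (λ e t q m → e :+ m := (:- t) :* q :+ ((e :+ t :* q) :+ m)) ≡.refl (+ e) t (+ q) (+ p ℤ.* + j)) ⟩
  ℤ.∣ (ℤ.- t) ℤ.* + q ℤ.+ ((+ e ℤ.+ t ℤ.* + q) ℤ.+ + p ℤ.* + j) ∣
    ≡⟨ ≡.cong (λ z → ℤ.∣ (ℤ.- t) ℤ.* + q ℤ.+ (z ℤ.+ + p ℤ.* + j) ∣) (≡.sym eq) ⟩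
  ℤ.∣ (ℤ.- t) ℤ.* + q ℤ.+ ((+ q ℤ.* + 0 ℤ.- + p ℤ.* + j) ℤ.+ + p ℤ.* + j) ∣
    ≡⟨ ≡.cong ℤ.∣_∣ (solve 3 (λ t q m → (:- t) :* q :+ ((q :* con (+ 0) :- m) :+ m) := (:- t) :* q) ≡.refl t (+ q) (+ p ℤ.* + j)) ⟩
  ℤ.∣ (ℤ.- t) ℤ.* + q ∣
    ≡⟨ ℤP.abs-* (ℤ.- t) (+ q) ⟩
  ℤ.∣ ℤ.- t ∣ ℕ.* q ∎
  where
  open Data.Integer.Solver.+-*-Solver
  open ≡.≡-Reasoning

module Characters {c ℓ : Level} (K : CommutativeRing c ℓ) (inv : CommutativeRing.Carrier K → CommutativeRing.Carrier K)
    (isInv : IsFieldInverse K inv) (char0 : CharZero K)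
    (p r : ℕ) (0<p : 0 < p)
    (ζ : CommutativeRing.Carrier K) (prim : IsPrimitiveRoot K (p ℕ.+ r) ζ) where
  open CommutativeRing K hiding (zero)
  open RingLemmas K
  open FieldLemmas K inv isInv char0
  open PowerSeries K
  open ToddSeries K inv isInv char0
  open WithInv K inv
  open Relation.Binary.Reasoning.Setoid setoid
  open PathSums seriesRing
  private
    module S = CommutativeRing seriesRing
    module SR = RingLemmas seriesRing

    q : ℕ
    q = p ℕ.+ r

    0<q : 0 < q
    0<q = ℕP.≤-trans 0<p (ℕP.m≤m+n p r)

    instance
      q-nonZero : ℕ.NonZero q
      q-nonZero = ℕ.>-nonZero 0<q

    T : ℕ → Series
    T u = scale (ι u) td

  ζ^-multiple : ∀ m → ζ ^ (m ℕ.* q) ≈ 1#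
  ζ^-multiple m = trans (^-* ζ m q) (trans (^-cong (proj₁ prim) m) (1^ m))

  ζ^-nonmultiple : ∀ m → ¬ (q ∣ m) → ¬ (ζ ^ m ≈ 1#)
  ζ^-nonmultiple m q∤m eq = proj₂ prim (m ℕ.% q) (ℕP.n≢0⇒n>0 λ eq₀ → q∤m (m%n≡0⇒n∣m m q eq₀)) (m%n<n m q) (begin
    ζ ^ (m ℕ.% q)                            ≈⟨ *-identityʳ _ ⟨
    ζ ^ (m ℕ.% q) * 1#                       ≈⟨ *-congˡ (ζ^-multiple (m ℕ./ q)) ⟨
    ζ ^ (m ℕ.% q) * ζ ^ (m ℕ./ q ℕ.* q)      ≈⟨ ^-+ ζ (m ℕ.% q) (m ℕ./ q ℕ.* q) ⟨
    ζ ^ (m ℕ.% q ℕ.+ m ℕ./ q ℕ.* q)          ≡⟨ ≡.cong (ζ ^_) (m≡m%n+[m/n]*n m q) ⟨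
    ζ ^ m                                    ≈⟨ eq ⟩
    1#                                       ∎)

  orthogonality-multiple : ∀ m → q ∣ m → Σ q (λ j → ζ ^ (j ℕ.* m)) ≈ ι q
  orthogonality-multiple .(t ℕ.* q) (divides t ≡.refl) = begin
    Σ q (λ j → ζ ^ (j ℕ.* (t ℕ.* q)))   ≈⟨ Σ-cong q (λ j → trans (reflexive (≡.cong (ζ ^_) (≡.sym (ℕP.*-assoc j t q)))) (ζ^-multiple (j ℕ.* t))) ⟩
    Σ q (λ _ → 1#)                      ≈⟨ Σ-const q 1# ⟩
    ι q * 1#                            ≈⟨ *-identityʳ _ ⟩
    ι q                                 ∎

  orthogonality-nonmultiple : ∀ m → ¬ (q ∣ m) → Σ q (λ j → ζ ^ (j ℕ.* m)) ≈ 0#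
  orthogonality-nonmultiple m q∤m = *-cancel 1-ω≉0 (begin
    (1# - ω) * Σ q (λ j → ζ ^ (j ℕ.* m))   ≈⟨ *-congˡ (Σ-cong q (λ j → ^-* ζ j m)) ⟩
    (1# - ω) * Σ q (ω ^_)                  ≈⟨ geometric ω q ⟩
    1# - ω ^ q                             ≈⟨ +-congˡ (-‿cong ω^q) ⟩
    1# - 1#                                ≈⟨ -‿inverseʳ _ ⟩
    0#                                     ≈⟨ zeroʳ _ ⟨
    (1# - ω) * 0#                          ∎)
    where
    open Solver
    ω : Carrier
    ω = ζ ^ m
    ω^q : ω ^ q ≈ 1#
    ω^q = trans (sym (^-* ζ q m)) (trans (reflexive (≡.cong (ζ ^_) (ℕP.*-comm q m))) (ζ^-multiple m))
    1-ω≉0 : ¬ (1# - ω ≈ 0#)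
    1-ω≉0 eq = ζ^-nonmultiple m q∤m (begin
      ω               ≈⟨ solve 2 (λ o w → w := o :- (o :- w)) refl 1# ω ⟩
      1# - (1# - ω)   ≈⟨ +-congˡ (-‿cong eq) ⟩
      1# - 0#         ≈⟨ solve 1 (λ o → o :- con (+ 0) := o) refl 1# ⟩
      1#              ∎)

  toddFactor-denom : ∀ e → e < q → toddFactor ζ e ⊛ denom (ζ ^ e) ≋ X
  toddFactor-denom zero _ = td-denom
  toddFactor-denom (suc e) e<q = toddFactor-suc ζ e (proj₂ prim (suc e) (s≤s z≤n) e<q)

  twist : Carrier → ℕ → Series
  twist χ x = SR.Σ q (SR._^_ (cst χ ⊛ exp x))

  -- Multiplying numerator and denominator of x/(1 - χE^x) by the geometric sum of χE^x makes the
  -- denominator 1 - E^{qx}, as χ^q = 1. This removes the characters from all denominators, and the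
  -- factor with χ = 1 is treated alike.
  q-toddFactor : ∀ e x → e < q → 0 < x → cst (ι q) ⊛ scale (ι x) (toddFactor ζ e) ≋ T (q ℕ.* x) ⊛ twist (ζ ^ e) x
  q-toddFactor e x e<q 0<x = coeffwise λ n → ι-cancel 0<x (trans (sym (cst-⊛ (ι x) _ n)) (trans (at (X-cancel (S.trans
      (S.*-congˡ {X} (S.trans (S.sym (S.*-assoc (cst (ι x)) (cst (ι q)) F)) (S.*-congʳ {F} qx)))
      (S.trans cross (solve 4 (λ x a t g → (a :* x) :* (t :* g) := x :* (a :* (t :* g))) S.refl X (cst (ι x)) (T (q ℕ.* x)) Γ)))) n)
      (cst-⊛ (ι x) _ n)))
    where
    open SR.Solver
    χ : Carrier
    χ = ζ ^ e
    F Y Γ : Series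
    F = scale (ι x) (toddFactor ζ e)
    Y = cst χ ⊛ exp x
    Γ = twist χ x
    qx : cst (ι x) ⊛ cst (ι q) ≋ cst (ι (q ℕ.* x))
    qx = S.trans (S.sym (cst-* (ι x) (ι q))) (cst-cong (trans (*-comm _ _) (sym (ι-* q x))))
    Y^q : SR._^_ Y q ≋ exp (q ℕ.* x)
    Y^q = S.trans (SR.*-^ (cst χ) (exp x) q) (S.trans (S.*-cong (S.trans (S.sym (cst-^ χ q)) (cst-cong χ^q)) (S.sym (exp-* q x)))
      (S.*-identityˡ (exp (q ℕ.* x))))
      where
      χ^q : χ ^ q ≈ 1#
      χ^q = trans (sym (^-* ζ q e)) (trans (reflexive (≡.cong (ζ ^_) (ℕP.*-comm q e))) (ζ^-multiple e))
    cross : X ⊛ (cst (ι (q ℕ.* x)) ⊛ F) ≋ (cst (ι x) ⊛ X) ⊛ (T (q ℕ.* x) ⊛ Γ)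
    cross =
      S.trans (solve 3 (λ x a f → x :* (a :* f) := (a :* x) :* f) S.refl X (cst (ι (q ℕ.* x))) F)
      (S.trans (S.*-congʳ {F} (S.sym (scaled-td (ι (q ℕ.* x)))))
      (S.trans (S.*-congʳ {F} (S.*-congˡ {T (q ℕ.* x)} (S.+-congˡ {cst 1#} (S.-‿cong (S.sym Y^q)))))
      (S.trans (S.*-congʳ {F} (S.*-congˡ {T (q ℕ.* x)} (S.sym (SR.geometric Y q))))
      (S.trans (solve 4 (λ t y g f → (t :* (y :* g)) :* f := (f :* y) :* (t :* g)) S.refl (T (q ℕ.* x)) (cst 1# ⊕ ⊖ Y) Γ F)
      (S.*-congʳ {T (q ℕ.* x) ⊛ Γ} (scaled-todd (ι x) χ (toddFactor ζ e) (toddFactor-denom e e<q)))))))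

  e₁ e₂ : ℕ → ℕ
  e₁ j = exp₁ p q (+ 0) (+ j)
  e₂ j = exp₂ p q (+ 0) (+ j)

  private
    modq-spec : ∀ z n → 0 < n → modq z n < n × (∃[ t ] z ≡ + modq z n ℤ.+ t ℤ.* + n)
    modq-spec z (suc n) _ = ℤD.n%ℕd<d z (suc n) , (z ℤD./ℕ suc n) , ℤD.a≡a%ℕn+[a/ℕn]*n z (suc n)

    modq-small : ∀ j n → j < n → modq (+ j) n ≡ j
    modq-small j (suc n) j<n = m<n⇒m%n≡m j<n

  e₁<q : ∀ j → e₁ j < q
  e₁<q j = proj₁ (modq-spec (+ q ℤ.* + 0 ℤ.- + p ℤ.* + j) q 0<q)

  e₁-inverse : ∀ j → ∃[ t ] e₁ j ℕ.+ p ℕ.* j ≡ t ℕ.* q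
  e₁-inverse j = let (t , eq) = proj₂ (modq-spec (+ q ℤ.* + 0 ℤ.- + p ℤ.* + j) q 0<q) in
    ℤ.∣ ℤ.- t ∣ , negated-residue p q j (e₁ j) t eq

  -- Since -p ≡ r modulo q, the first character is a power with a natural exponent that is linear in
  -- j, as the sum over j requires.
  ζ^e₁ : ∀ j → ζ ^ e₁ j ≈ ζ ^ (j ℕ.* r)
  ζ^e₁ j = begin
    ζ ^ e₁ j                               ≈⟨ *-identityʳ _ ⟨
    ζ ^ e₁ j * 1#                          ≈⟨ *-congˡ (ζ^-multiple j) ⟨
    ζ ^ e₁ j * ζ ^ (j ℕ.* (p ℕ.+ r))       ≡⟨ ≡.cong (λ m → ζ ^ e₁ j * ζ ^ m) (ℕS.solve 3 (λ j p r → j ℕS.:* (p ℕS.:+ r) ℕS.:= p ℕS.:* j ℕS.:+ j ℕS.:* r) ≡.refl j p r) ⟩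
    ζ ^ e₁ j * ζ ^ (p ℕ.* j ℕ.+ j ℕ.* r)   ≈⟨ *-congˡ (^-+ ζ (p ℕ.* j) (j ℕ.* r)) ⟩
    ζ ^ e₁ j * (ζ ^ (p ℕ.* j) * ζ ^ (j ℕ.* r)) ≈⟨ *-assoc _ _ _ ⟨
    (ζ ^ e₁ j * ζ ^ (p ℕ.* j)) * ζ ^ (j ℕ.* r) ≈⟨ *-congʳ (^-+ ζ (e₁ j) (p ℕ.* j)) ⟨
    ζ ^ (e₁ j ℕ.+ p ℕ.* j) * ζ ^ (j ℕ.* r) ≡⟨ ≡.cong (λ m → ζ ^ m * ζ ^ (j ℕ.* r)) (proj₂ (e₁-inverse j)) ⟩
    ζ ^ (proj₁ (e₁-inverse j) ℕ.* q) * ζ ^ (j ℕ.* r) ≈⟨ *-congʳ (ζ^-multiple (proj₁ (e₁-inverse j))) ⟩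
    1# * ζ ^ (j ℕ.* r)                     ≈⟨ *-identityˡ _ ⟩
    ζ ^ (j ℕ.* r)                          ∎
    where module ℕS = Data.Nat.Solver.+-*-Solver

  cst-Σ : ∀ n (f : ℕ → Carrier) → cst (Σ n f) ≋ SR.Σ n (λ i → cst (f i))
  cst-Σ zero f = coeffwise λ { zero → refl ; (suc _) → refl }
  cst-Σ (suc n) f = S.trans (cst-+ (Σ n f) (f n)) (S.+-congʳ (cst-Σ n f))

  monomial : ℕ → ℕ → ℕ → ℕ → Series
  monomial x j k l = cst (ζ ^ (j ℕ.* (k ℕ.* r ℕ.+ l))) ⊛ exp (k ℕ.* x ℕ.+ l)

  twist-product : ∀ x j → twist (ζ ^ e₁ j) x ⊛ twist (ζ ^ j) 1 ≋ SR.Σ q (λ k → SR.Σ q (λ l → monomial x j k l))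
  twist-product x j = S.trans (SR.Σ-*ʳ q (twist (ζ ^ j) 1) _) (SR.Σ-cong q λ k →
    S.trans (SR.Σ-*ˡ q (SR._^_ (cst (ζ ^ e₁ j) ⊛ exp x) k) _) (SR.Σ-cong q λ l → term k l))
    where
    power : ∀ χ x k → SR._^_ (cst χ ⊛ exp x) k ≋ cst (χ ^ k) ⊛ exp (k ℕ.* x)
    power χ x k = S.trans (SR.*-^ (cst χ) (exp x) k) (S.*-cong (S.sym (cst-^ χ k)) (S.sym (exp-* k x)))
    characters : ∀ k l → (ζ ^ e₁ j) ^ k * (ζ ^ j) ^ l ≈ ζ ^ (j ℕ.* (k ℕ.* r ℕ.+ l))
    characters k l = begin
      (ζ ^ e₁ j) ^ k * (ζ ^ j) ^ l                ≈⟨ *-congʳ (^-cong (ζ^e₁ j) k) ⟩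
      (ζ ^ (j ℕ.* r)) ^ k * (ζ ^ j) ^ l           ≈⟨ *-cong (^-* ζ k (j ℕ.* r)) (^-* ζ l j) ⟨
      ζ ^ (k ℕ.* (j ℕ.* r)) * ζ ^ (l ℕ.* j)       ≈⟨ ^-+ ζ (k ℕ.* (j ℕ.* r)) (l ℕ.* j) ⟨
      ζ ^ (k ℕ.* (j ℕ.* r) ℕ.+ l ℕ.* j)           ≡⟨ ≡.cong (ζ ^_) (solve 4 (λ j k l r → k :* (j :* r) :+ l :* j := j :* (k :* r :+ l)) ≡.refl j k l r) ⟩
      ζ ^ (j ℕ.* (k ℕ.* r ℕ.+ l))                 ∎
      where open Data.Nat.Solver.+-*-Solver
    term : ∀ k l → SR._^_ (cst (ζ ^ e₁ j) ⊛ exp x) k ⊛ SR._^_ (cst (ζ ^ j) ⊛ exp 1) l ≋ monomial x j k l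
    term k l = S.trans (S.*-cong (power (ζ ^ e₁ j) x k) (power (ζ ^ j) 1 l)) (S.trans
      (solve 4 (λ a b c d → (a :* b) :* (c :* d) := (a :* c) :* (b :* d)) S.refl
        (cst ((ζ ^ e₁ j) ^ k)) (exp (k ℕ.* x)) (cst ((ζ ^ j) ^ l)) (exp (l ℕ.* 1)))
      (S.*-cong (S.trans (S.sym (cst-* _ _)) (cst-cong (characters k l)))
        (S.trans (S.sym (exp-+ (k ℕ.* x) (l ℕ.* 1))) (S.reflexive (≡.cong (λ m → exp (k ℕ.* x ℕ.+ m)) (ℕP.*-identityʳ l))))))
      where open SR.Solver

  column : ℕ → ℕ → Series
  column x k = SR.Σ q (λ l → cst (Σ q (λ j → ζ ^ (j ℕ.* (k ℕ.* r ℕ.+ l)))) ⊛ exp (k ℕ.* x ℕ.+ l))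

  -- Orthogonality keeps only the l with q dividing k r + l, and `Above` names it: l = c q - k r.
  -- Then k x + l = c q + k (x - r), which is how the values q and x - r of the two unit vectors
  -- arise.
  column-lattice : ∀ x → r ≤ x → ∀ c k → Above r q c k → cst (ι q) ⊛ weight exp exp-+ q (x ℕ.∸ r) c k ≋ column x k
  column-lattice x r≤x c k (d , cq≡ , d<q) = S.sym (S.trans
    (SR.Σ-single q d d<q λ l l<q l≢d → S.trans
      (S.*-congʳ {exp (k ℕ.* x ℕ.+ l)} (S.trans (cst-cong (orthogonality-nonmultiple (k ℕ.* r ℕ.+ l)
        λ q∣l → l≢d (residue-unique l d l<q d<q q∣l q∣d))) (coeffwise λ { zero → refl ; (suc _) → refl })))
      (S.zeroˡ (exp (k ℕ.* x ℕ.+ l))))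
    (S.*-cong (cst-cong (orthogonality-multiple (k ℕ.* r ℕ.+ d) q∣d)) (S.reflexive (≡.cong exp (≡.sym exponent)))))
    where
    q∣d : q ∣ k ℕ.* r ℕ.+ d
    q∣d = divides c (≡.sym cq≡)
    exponent : c ℕ.* q ℕ.+ k ℕ.* (x ℕ.∸ r) ≡ k ℕ.* x ℕ.+ d
    exponent = ≡.trans (≡.cong (ℕ._+ k ℕ.* (x ℕ.∸ r)) cq≡)
      (≡.trans (solve 4 (λ k r d y → k :* r :+ d :+ k :* y := k :* (r :+ y) :+ d) ≡.refl k r d (x ℕ.∸ r))
        (≡.cong (λ y → k ℕ.* y ℕ.+ d) (ℕP.m+[n∸m]≡n r≤x)))
      where open Data.Nat.Solver.+-*-Solver

  toddSum : ℕ → Series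
  toddSum x = SR.Σ q (λ j → scale (ι x) (toddFactor ζ (e₁ j)) ⊛ scale (ι 1) (toddFactor ζ (e₂ j)))

  -- Removing the characters from the denominators costs one factor q for each of the two series;
  -- orthogonality returns one of them, which is cancelled.
  toddSum-cone : ∀ (E : Euclid r q) x → 0 < x → r ≤ x →
    cst (ι q) ⊛ toddSum x ≋ (T q ⊛ T (q ℕ.* x)) ⊛ pathSum (weight exp exp-+ q (x ℕ.∸ r)) 0 0 (word E)
  toddSum-cone E x 0<x r≤x = coeffwise λ n → ι-cancel 0<q
    (trans (sym (cst-⊛ (ι q) _ n)) (trans (at doubled n) (cst-⊛ (ι q) _ n)))
    where
    open SR.Solver
    P : Series
    P = pathSum (weight exp exp-+ q (x ℕ.∸ r)) 0 0 (word E)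
    columns : SR.Σ q (column x) ≋ cst (ι q) ⊛ P
    columns = S.sym (S.trans (pathSum-*ˡ (cst (ι q)) (weight exp exp-+ q (x ℕ.∸ r)) 0 0 (word E))
      (S.trans (pathSum-Σ (column x) (column-lattice x r≤x) 0 0 (word E) (hugs-word E))
        (S.reflexive (≡.cong (λ m → SR.Σ m (column x)) (#b-word E)))))
    collect : SR.Σ q (λ j → twist (ζ ^ e₁ j) x ⊛ twist (ζ ^ j) 1) ≋ SR.Σ q (column x)
    collect = S.trans (SR.Σ-cong q (twist-product x)) (S.trans (SR.Σ-swap q q (λ j k → SR.Σ q (monomial x j k)))
      (SR.Σ-cong q λ k → S.trans (SR.Σ-swap q q (λ j l → monomial x j k l)) (SR.Σ-cong q λ l →
        S.trans (S.sym (SR.Σ-*ʳ q (exp (k ℕ.* x ℕ.+ l)) (λ j → cst (ζ ^ (j ℕ.* (k ℕ.* r ℕ.+ l))))))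
          (S.*-congʳ {exp (k ℕ.* x ℕ.+ l)} (S.sym (cst-Σ q (λ j → ζ ^ (j ℕ.* (k ℕ.* r ℕ.+ l)))))))))
    factor : ∀ j → j < q → cst (ι q) ⊛ (cst (ι q) ⊛ (scale (ι x) (toddFactor ζ (e₁ j)) ⊛ scale (ι 1) (toddFactor ζ (e₂ j))))
                         ≋ (T q ⊛ T (q ℕ.* x)) ⊛ (twist (ζ ^ e₁ j) x ⊛ twist (ζ ^ j) 1)
    factor j j<q = S.trans
      (solve 3 (λ c f g → c :* (c :* (f :* g)) := (c :* f) :* (c :* g)) S.refl (cst (ι q)) (scale (ι x) (toddFactor ζ (e₁ j))) (scale (ι 1) (toddFactor ζ (e₂ j))))
      (S.trans (S.*-cong (q-toddFactor (e₁ j) x (e₁<q j) 0<x)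
        (S.trans (S.reflexive (≡.cong (λ e → cst (ι q) ⊛ scale (ι 1) (toddFactor ζ e)) (modq-small j q j<q)))
        (S.trans (q-toddFactor j 1 j<q (s≤s z≤n)) (S.reflexive (≡.cong (λ m → T m ⊛ twist (ζ ^ j) 1) (ℕP.*-identityʳ q))))))
      (solve 4 (λ t g s h → (t :* g) :* (s :* h) := (s :* t) :* (g :* h)) S.refl (T (q ℕ.* x)) (twist (ζ ^ e₁ j) x) (T q) (twist (ζ ^ j) 1)))
    doubled : cst (ι q) ⊛ (cst (ι q) ⊛ toddSum x) ≋ cst (ι q) ⊛ ((T q ⊛ T (q ℕ.* x)) ⊛ P)
    doubled = S.trans (S.*-congˡ {cst (ι q)} (SR.Σ-*ˡ q (cst (ι q)) _)) (S.trans (SR.Σ-*ˡ q (cst (ι q)) _)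
      (S.trans (SR.Σ-cong-< q factor) (S.trans (S.sym (SR.Σ-*ˡ q (T q ⊛ T (q ℕ.* x)) _))
      (S.trans (S.*-congˡ {T q ⊛ T (q ℕ.* x)} (S.trans collect columns))
      (solve 3 (λ t c p → t :* (c :* p) := c :* (t :* p)) S.refl (T q ⊛ T (q ℕ.* x)) (cst (ι q)) P)))))

  toddSum-coeff : ∀ x N → toddSum x N ≈ Σ (suc N) (λ a → toddCoef p q ζ a (N ℕ.∸ a) * ι x ^ a)
  toddSum-coeff x N = begin
    toddSum x N
      ≈⟨ Σ-at q _ N ⟩
    Σ q (λ j → (scale (ι x) (φ₁ j) ⊛ scale (ι 1) (φ₂ j)) N)
      ≈⟨ Σ-cong q (λ j → trans (⊛-coeff (scale (ι x) (φ₁ j)) (scale (ι 1) (φ₂ j)) N) (Σ-cong (suc N) λ a → term j a)) ⟩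
    Σ q (λ j → Σ (suc N) (λ a → (φ₁ j a * φ₂ j (N ℕ.∸ a)) * ι x ^ a))
      ≈⟨ Σ-swap q (suc N) (λ j a → (φ₁ j a * φ₂ j (N ℕ.∸ a)) * ι x ^ a) ⟩
    Σ (suc N) (λ a → Σ q (λ j → (φ₁ j a * φ₂ j (N ℕ.∸ a)) * ι x ^ a))
      ≈⟨ Σ-cong (suc N) (λ a → trans (sym (Σ-*ʳ q (ι x ^ a) _)) (*-congʳ (sym (sumK-Σ q _)))) ⟩
    Σ (suc N) (λ a → toddCoef p q ζ a (N ℕ.∸ a) * ι x ^ a) ∎
    where
    φ₁ φ₂ : ℕ → Series
    φ₁ j = toddFactor ζ (e₁ j)
    φ₂ j = toddFactor ζ (e₂ j)
    Σ-at : ∀ m (f : ℕ → Series) n → SR.Σ m f n ≈ Σ m (λ j → f j n)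
    Σ-at zero f n = refl
    Σ-at (suc m) f n = +-congʳ (Σ-at m f n)
    sumK-Σ : ∀ m f → sumK m f ≈ Σ m f
    sumK-Σ zero f = refl
    sumK-Σ (suc m) f = +-congʳ (sumK-Σ m f)
    term : ∀ j a → (φ₁ j a * ι x ^ a) * (φ₂ j (N ℕ.∸ a) * ι 1 ^ (N ℕ.∸ a)) ≈ (φ₁ j a * φ₂ j (N ℕ.∸ a)) * ι x ^ a
    term j a = trans (*-congˡ (trans (*-congˡ (trans (^-cong ι-1 (N ℕ.∸ a)) (1^ (N ℕ.∸ a)))) (*-identityʳ _)))
      (solve 3 (λ f x g → (f :* x) :* g := (f :* g) :* x) refl _ _ _)
      where open Solver

-- Comparison of coefficients

-- As r ≡ -p modulo p + r, the second equation says that e p ≡ 1, so e and s are both inverse to p.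
-- Evaluating e s p by both equations gives the witness.
inverse-unique-mod : ∀ p r e f (s m : ℤ) → s ℤ.* + p ≡ + 1 ℤ.+ + (p ℕ.+ r) ℤ.* m → f ℕ.* (p ℕ.+ r) ≡ suc (e ℕ.* r) →
                     ∃[ t ] + e ≡ s ℤ.+ + (p ℕ.+ r) ℤ.* t
inverse-unique-mod p r e f s m sp≡ fq≡ = s ℤ.* (+ e ℤ.- + f) ℤ.- + e ℤ.* m , (begin
  + e
    ≡⟨ solve 4 (λ e s q m → e := (e :* (con (+ 1) :+ q :* m) :- e :* q :* m)) ≡.refl (+ e) s (+ q) m ⟩
  + e ℤ.* (+ 1 ℤ.+ + q ℤ.* m) ℤ.- + e ℤ.* + q ℤ.* m
    ≡⟨ ≡.cong (λ z → + e ℤ.* z ℤ.- + e ℤ.* + q ℤ.* m) (≡.sym sp≡) ⟩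
  + e ℤ.* (s ℤ.* + p) ℤ.- + e ℤ.* + q ℤ.* m
    ≡⟨ solve 5 (λ e s p r m → e :* (s :* p) :- e :* (p :+ r) :* m
                  := s :* (e :* (p :+ r) :- (con (+ 1) :+ e :* r) :+ con (+ 1)) :- e :* (p :+ r) :* m) ≡.refl (+ e) s (+ p) (+ r) m ⟩
  s ℤ.* (+ e ℤ.* + q ℤ.- (+ 1 ℤ.+ + e ℤ.* + r) ℤ.+ + 1) ℤ.- + e ℤ.* + q ℤ.* m
    ≡⟨ ≡.cong (λ z → s ℤ.* (+ e ℤ.* + q ℤ.- z ℤ.+ + 1) ℤ.- + e ℤ.* + q ℤ.* m) fq≡ℤ ⟨
  s ℤ.* (+ e ℤ.* + q ℤ.- + f ℤ.* + q ℤ.+ + 1) ℤ.- + e ℤ.* + q ℤ.* m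
    ≡⟨ solve 5 (λ e s f q m → s :* (e :* q :- f :* q :+ con (+ 1)) :- e :* q :* m
                  := s :+ q :* (s :* (e :- f) :- e :* m)) ≡.refl (+ e) s (+ f) (+ q) m ⟩
  s ℤ.+ + q ℤ.* (s ℤ.* (+ e ℤ.- + f) ℤ.- + e ℤ.* m) ∎)
  where
  open Data.Integer.Solver.+-*-Solver
  open ≡.≡-Reasoning
  q : ℕ
  q = p ℕ.+ r
  fq≡ℤ : + f ℤ.* + q ≡ + 1 ℤ.+ + e ℤ.* + r
  fq≡ℤ = ≡.trans (≡.sym (ℤP.pos-* f q)) (≡.trans (≡.cong +_ fq≡) (≡.cong (λ z → + 1 ℤ.+ z) (ℤP.pos-* e r)))

module Congruence {c ℓ : Level} (K : CommutativeRing c ℓ) (inv : CommutativeRing.Carrier K → CommutativeRing.Carrier K)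
    (isInv : IsFieldInverse K inv) (char0 : CharZero K) (k : ℕ) (D : EvenDegree.Normaliser K inv isInv char0 k)
    (p r : ℕ) (0<p : 0 < p) (cop : Coprime p (p ℕ.+ r))
    (ζ : CommutativeRing.Carrier K) (prim : IsPrimitiveRoot K (p ℕ.+ r) ζ) where
  open CommutativeRing K hiding (zero)
  open RingLemmas K
  open FieldLemmas K inv isInv char0
  open PowerSeries K
  open Polynomials K inv isInv char0
  open WithInv K inv
  open EvenDegree.Normaliser D
  open Characters K inv isInv char0 p r 0<p ζ prim
  open Relation.Binary.Reasoning.Setoid setoid
  private
    q m N : ℕ
    q = p ℕ.+ r
    m = suc (k ℕ.+ k)
    N = suc m
    module Cone = Reciprocity K inv isInv char0 k D q

    A : Carrier
    A = intK K leading

    E : Euclid r q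
    E = euclid r q (ℕP.≤-trans 0<p (ℕP.m≤m+n p r)) λ {d} (d∣r , d∣q) → cop (∣m+n∣m⇒∣n (≡.subst (d ∣_) (ℕP.+-comm p r) d∣q) d∣r , d∣q)

    e : ℕ
    e = dual₂ E

    r≤ : ∀ {x} → q ≤ x → r ≤ x
    r≤ = ℕP.≤-trans (ℕP.m≤n+m r p)

    ι-∸ : ∀ {x} → q ≤ x → ι (x ℕ.∸ r) ≈ ι x - ι r
    ι-∸ {x} q≤x = begin
      ι (x ℕ.∸ r)                  ≈⟨ solve 2 (λ a b → a := (b :+ a) :- b) refl (ι (x ℕ.∸ r)) (ι r) ⟩
      (ι r + ι (x ℕ.∸ r)) - ι r    ≈⟨ +-congʳ (ι-+ r (x ℕ.∸ r)) ⟨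
      ι (r ℕ.+ (x ℕ.∸ r)) - ι r    ≡⟨ ≡.cong (λ y → ι y - ι r) (ℕP.m+[n∸m]≡n (r≤ q≤x)) ⟩
      ι x - ι r                    ∎
      where open Solver

    z≡ : ∀ {x} → q ≤ x → r ℕ.* q ℕ.+ q ℕ.* (x ℕ.∸ r) ≡ q ℕ.* x
    z≡ {x} q≤x = ≡.trans (solve 3 (λ r q y → r :* q :+ q :* y := q :* (r :+ y)) ≡.refl r q (x ℕ.∸ r))
      (≡.cong (q ℕ.*_) (ℕP.m+[n∸m]≡n (r≤ q≤x)))
      where open Data.Nat.Solver.+-*-Solver

    w≡ : ∀ {x} → q ≤ x → dual₁ E ℕ.* q ℕ.+ e ℕ.* (x ℕ.∸ r) ≡ suc (e ℕ.* x)
    w≡ {x} q≤x = ≡.trans (≡.cong (ℕ._+ e ℕ.* (x ℕ.∸ r)) (dual-det E)) (≡.cong suc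
      (≡.trans (≡.sym (ℕP.*-distribˡ-+ e r (x ℕ.∸ r))) (≡.cong (e ℕ.*_) (ℕP.m+[n∸m]≡n (r≤ q≤x)))))

    poly-v : IntPoly q (λ x → ι (x ℕ.∸ r))
    poly-v = poly-resp (λ x q≤x → ι-∸ q≤x) (poly-+ poly-x (poly-neg (poly-const (+ r))))

  -- Here the factor q of the integral part appears: the outer rays have values q and q x, so I
  -- comes with q · q x, while the lattice sum is q times the Todd coefficient and only one q is
  -- divided out.
  value : ∃[ I ] (IntPoly q I × (∀ x → q ≤ x →
    κ * toddSum x N ≈ A * (ι x * ι (x ℕ.∸ r) ^ m + ι (suc (e ℕ.* x)) ^ m) + (ι q * ι x) * I x))
  value =
    let (I , PI , eq) = Cone.formula E (λ _ → q) (λ x → x ℕ.∸ r) (λ _ _ → 0<q)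
                          (λ x q≤x → ℕP.m<n⇒0<n∸m (ℕP.<-≤-trans (ℕP.m<n+m r 0<p) q≤x)) (poly-const (+ q)) poly-v
    in I , PI , λ x q≤x → ι-cancel 0<q (begin
      ι q * (κ * toddSum x N)
        ≈⟨ solve 3 (λ q k t → q :* (k :* t) := k :* (q :* t)) refl (ι q) κ (toddSum x N) ⟩
      κ * (ι q * toddSum x N)
        ≈⟨ *-congˡ (cst-⊛ (ι q) (toddSum x) N) ⟨
      κ * (cst (ι q) ⊛ toddSum x) N
        ≈⟨ *-congˡ (at (toddSum-cone E x (ℕP.<-≤-trans 0<q q≤x) (r≤ q≤x)) N) ⟩
      κ * ((Cone.T q ⊛ Cone.T (q ℕ.* x)) ⊛ Cone.coneSum E q (x ℕ.∸ r)) N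
        ≡⟨ ≡.cong (λ z → κ * ((Cone.T q ⊛ Cone.T z) ⊛ Cone.coneSum E q (x ℕ.∸ r)) N) (z≡ q≤x) ⟨
      κ * Cone.coneTodd E q (x ℕ.∸ r) N
        ≈⟨ eq x q≤x ⟩
      A * (ι (r ℕ.* q ℕ.+ q ℕ.* (x ℕ.∸ r)) * ι (x ℕ.∸ r) ^ m + ι q * ι (dual₁ E ℕ.* q ℕ.+ e ℕ.* (x ℕ.∸ r)) ^ m)
        + (ι q * ι (r ℕ.* q ℕ.+ q ℕ.* (x ℕ.∸ r))) * I x
        ≡⟨ ≡.cong₂ (λ z w → A * (ι z * ι (x ℕ.∸ r) ^ m + ι q * ι w ^ m) + (ι q * ι z) * I x) (z≡ q≤x) (w≡ q≤x) ⟩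
      A * (ι (q ℕ.* x) * ι (x ℕ.∸ r) ^ m + ι q * ι (suc (e ℕ.* x)) ^ m) + (ι q * ι (q ℕ.* x)) * I x
        ≈⟨ +-cong (*-congˡ (+-congʳ (*-congʳ (ι-* q x)))) (*-congʳ (*-congˡ (ι-* q x))) ⟩
      A * ((ι q * ι x) * ι (x ℕ.∸ r) ^ m + ι q * ι (suc (e ℕ.* x)) ^ m) + (ι q * (ι q * ι x)) * I x
        ≈⟨ solve 6 (λ A q x V W I → A :* ((q :* x) :* V :+ q :* W) :+ (q :* (q :* x)) :* I
                                 := q :* (A :* (x :* V :+ W) :+ (q :* x) :* I)) refl
             A (ι q) (ι x) (ι (x ℕ.∸ r) ^ m) (ι (suc (e ℕ.* x)) ^ m) (I x) ⟩
      ι q * (A * (ι x * ι (x ℕ.∸ r) ^ m + ι (suc (e ℕ.* x)) ^ m) + (ι q * ι x) * I x) ∎)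
    where
    open Solver
    0<q : 0 < q
    0<q = ℕP.≤-trans 0<p (ℕP.m≤m+n p r)

  module _ (s : ℤ) (s-inverse : ∃[ t ] s ℤ.* + p ≡ + 1 ℤ.+ + q ℤ.* t) where

    private
      t : ℤ
      t = proj₁ (inverse-unique-mod p r e (dual₁ E) s (proj₁ s-inverse) (proj₂ s-inverse) (dual-det E))

      e≡ : + e ≡ s ℤ.+ + q ℤ.* t
      e≡ = proj₂ (inverse-unique-mod p r e (dual₁ E) s (proj₁ s-inverse) (proj₂ s-inverse) (dual-det E))

      L₁ L₂ : List ℤ
      L₁ = powL (linL (+ 1) (+ p)) m ⊠ linL (+ 1) (+ 0)
      L₂ = powL (linL s (+ 1)) m ⊠ linL (+ 0) (+ 1)

      x+p sx+1 : ℕ → Carrier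
      x+p x = ι x + ι p
      sx+1 x = intK K s * ι x + 1#

      eval-L₁ : ∀ x → evalℤ L₁ (ι x) ≈ ι x * x+p x ^ m
      eval-L₁ x = begin
        evalℤ L₁ (ι x)
          ≈⟨ evalℤ-⊠ (powL (linL (+ 1) (+ p)) m) (linL (+ 1) (+ 0)) (ι x) ⟩
        evalℤ (powL (linL (+ 1) (+ p)) m) (ι x) * evalℤ (linL (+ 1) (+ 0)) (ι x)
          ≈⟨ *-cong (evalℤ-powL (linL (+ 1) (+ p)) m (ι x)) (evalℤ-linL (+ 1) (+ 0) (ι x)) ⟩
        evalℤ (linL (+ 1) (+ p)) (ι x) ^ m * (ι 1 * ι x + 0#)
          ≈⟨ *-cong (^-cong (trans (evalℤ-linL (+ 1) (+ p) (ι x)) (+-congʳ ι-1*)) m) (trans (+-identityʳ _) ι-1*) ⟩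
        x+p x ^ m * ι x
          ≈⟨ *-comm _ _ ⟩
        ι x * x+p x ^ m ∎
        where
        ι-1* : ∀ {y} → ι 1 * y ≈ y
        ι-1* = trans (*-congʳ ι-1) (*-identityˡ _)

      eval-L₂ : ∀ x → evalℤ L₂ (ι x) ≈ sx+1 x ^ m
      eval-L₂ x = begin
        evalℤ L₂ (ι x)
          ≈⟨ evalℤ-⊠ (powL (linL s (+ 1)) m) (linL (+ 0) (+ 1)) (ι x) ⟩
        evalℤ (powL (linL s (+ 1)) m) (ι x) * evalℤ (linL (+ 0) (+ 1)) (ι x)
          ≈⟨ *-cong (evalℤ-powL (linL s (+ 1)) m (ι x)) (evalℤ-linL (+ 0) (+ 1) (ι x)) ⟩
        evalℤ (linL s (+ 1)) (ι x) ^ m * (0# * ι x + ι 1)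
          ≈⟨ *-cong (^-cong (trans (evalℤ-linL s (+ 1) (ι x)) (+-congˡ ι-1)) m)
                    (trans (+-cong (zeroˡ _) ι-1) (+-identityˡ _)) ⟩
        sx+1 x ^ m * 1#
          ≈⟨ *-identityʳ _ ⟩
        sx+1 x ^ m ∎

      poly-x+p : IntPoly q x+p
      poly-x+p = poly-+ poly-x (poly-const (+ p))

      poly-sx+1 : IntPoly q sx+1
      poly-sx+1 = poly-+ (poly-* (poly-const s) poly-x) (poly-resp (λ _ _ → sym ι-1) (poly-const (+ 1)))

      poly-w : IntPoly q (λ x → ι (suc (e ℕ.* x)))
      poly-w = poly-resp (λ x _ → trans (ι-+ 1 (e ℕ.* x)) (+-congˡ (ι-* e x)))
        (poly-+ (poly-const (+ 1)) (poly-* (poly-const (+ e)) poly-x))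

      v-shift : ∀ x → q ≤ x → ι (x ℕ.∸ r) - x+p x ≈ - ι q
      v-shift x q≤x = trans (+-congʳ (ι-∸ q≤x)) (trans
        (solve 3 (λ x r p → (x :- r) :- (x :+ p) := :- (p :+ r)) refl (ι x) (ι r) (ι p)) (-‿cong (sym (ι-+ p r))))
        where open Solver

      w-shift : ∀ x → ι (suc (e ℕ.* x)) - sx+1 x ≈ ι q * (intK K t * ι x)
      w-shift x = begin
        (1# + ι (e ℕ.* x)) - (intK K s * ι x + 1#)
          ≈⟨ +-congʳ (+-congˡ (trans (ι-* e x) (*-congʳ e-image))) ⟩
        (1# + (intK K s + ι q * intK K t) * ι x) - (intK K s * ι x + 1#)
          ≈⟨ solve 5 (λ o s q t x → (o :+ (s :+ q :* t) :* x) :- (s :* x :+ o) := q :* (t :* x)) refl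
               1# (intK K s) (ι q) (intK K t) (ι x) ⟩
        ι q * (intK K t * ι x) ∎
        where
        open Solver
        e-image : ι e ≈ intK K s + ι q * intK K t
        e-image = trans (reflexive (≡.cong (intK K) e≡)) (trans (intK-+ s (+ q ℤ.* t)) (+-congˡ (intK-* (+ q) t)))

      -- Both replacements are congruences modulo q: x - r = (x + p) - q, and e ≡ s because both
      -- invert p. Their difference quotients join the multiple of q.
      remainder : ∃[ G ] (IntPoly q G × (∀ x → q ≤ x →
        κ * toddSum x N ≈ A * (ι x * x+p x ^ m + sx+1 x ^ m) + ι q * G x))
      remainder =
        let (I , PI , eq) = value
            (Dᵥ , PDᵥ , Dᵥ-eq) = difference-quotient poly-v poly-x+p m
            (D_w , PD_w , D_w-eq) = difference-quotient poly-w poly-sx+1 m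
        in (λ x → A * ((- (ι x * Dᵥ x)) + (intK K t * ι x) * D_w x) + ι x * I x) ,
           poly-+ (poly-* (poly-const leading) (poly-+ (poly-neg (poly-* poly-x PDᵥ))
             (poly-* (poly-* (poly-const t) poly-x) PD_w))) (poly-* poly-x PI) ,
           λ x q≤x → begin
        κ * toddSum x N
          ≈⟨ eq x q≤x ⟩
        A * (ι x * ι (x ℕ.∸ r) ^ m + ι (suc (e ℕ.* x)) ^ m) + (ι q * ι x) * I x
          ≈⟨ +-congʳ (*-congˡ (solve 5 (λ x V W V′ W′ → x :* V :+ W := x :* (V′ :+ (V :- V′)) :+ (W′ :+ (W :- W′))) refl
               (ι x) (ι (x ℕ.∸ r) ^ m) (ι (suc (e ℕ.* x)) ^ m) (x+p x ^ m) (sx+1 x ^ m))) ⟩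
        A * (ι x * (x+p x ^ m + (ι (x ℕ.∸ r) ^ m - x+p x ^ m)) + (sx+1 x ^ m + (ι (suc (e ℕ.* x)) ^ m - sx+1 x ^ m)))
          + (ι q * ι x) * I x
          ≈⟨ +-congʳ (*-congˡ (+-cong (*-congˡ (+-congˡ (trans (Dᵥ-eq x) (*-congʳ (v-shift x q≤x)))))
                                      (+-congˡ (trans (D_w-eq x) (*-congʳ (w-shift x)))))) ⟩
        A * (ι x * (x+p x ^ m + (- ι q) * Dᵥ x) + (sx+1 x ^ m + (ι q * (intK K t * ι x)) * D_w x)) + (ι q * ι x) * I x
          ≈⟨ solve 9 (λ A x V q D W T D′ I → A :* (x :* (V :+ (:- q) :* D) :+ (W :+ (q :* T) :* D′)) :+ (q :* x) :* I
                 := A :* (x :* V :+ W) :+ q :* (A :* ((:- (x :* D)) :+ T :* D′) :+ x :* I)) refl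
               A (ι x) (x+p x ^ m) (ι q) (Dᵥ x) (sx+1 x ^ m) (intK K t * ι x) (D_w x) (I x) ⟩
        A * (ι x * x+p x ^ m + sx+1 x ^ m) + ι q * (A * ((- (ι x * Dᵥ x)) + (intK K t * ι x) * D_w x) + ι x * I x) ∎
        where open Solver

    P₁ P₂ : HPoly
    P₁ = hmul (hpow (lin (+ 1) (+ p)) m) (lin (+ 1) (+ 0))
    P₂ = hmul (hpow (lin s (+ 1)) m) (lin (+ 0) (+ 1))

    -- The normalised coefficients are those of a polynomial in x that agrees with the integer
    -- polynomial `L` at all natural x ≥ q, so they agree one by one; `L` was assembled as the main
    -- part plus q times `G`.
    congruence : ∀ a → a ≤ N → ∃[ g ]
      (κ * toddCoef p q ζ a (N ℕ.∸ a) - intK K (leading ℤ.* (P₁ a ℤ.+ P₂ a)) ≈ intK K (+ q ℤ.* g))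
    congruence a a≤N = g , (begin
      κ * toddCoef p q ζ a (N ℕ.∸ a) - intK K main
        ≈⟨ +-congʳ (compare-coefficients (suc N) (λ a → κ * toddCoef p q ζ a (N ℕ.∸ a)) L q evaluation a (s≤s a≤N)) ⟩
      intK K (coeff L a) - intK K main
        ≡⟨ ≡.cong (λ z → intK K z - intK K main) coeff-L ⟩
      intK K (main ℤ.+ + q ℤ.* g) - intK K main
        ≈⟨ +-congʳ (intK-+ main (+ q ℤ.* g)) ⟩
      (intK K main + intK K (+ q ℤ.* g)) - intK K main
        ≈⟨ solve 2 (λ a b → (a :+ b) :- a := b) refl (intK K main) (intK K (+ q ℤ.* g)) ⟩
      intK K (+ q ℤ.* g) ∎)
      where
      open Solver
      G : List ℤ
      G = proj₁ (proj₁ (proj₂ remainder))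
      g main : ℤ
      g = coeff G a
      main = leading ℤ.* (P₁ a ℤ.+ P₂ a)
      L : List ℤ
      L = map (leading ℤ.*_) (L₁ ⊞ L₂) ⊞ map ((+ q) ℤ.*_) G
      coeff-L : coeff L a ≡ main ℤ.+ + q ℤ.* g
      coeff-L = ≡.trans (coeff-⊞ (map (leading ℤ.*_) (L₁ ⊞ L₂)) (map ((+ q) ℤ.*_) G) a) (≡.cong₂ ℤ._+_
        (≡.trans (coeff-map-* leading (L₁ ⊞ L₂) a) (≡.cong (leading ℤ.*_) (≡.trans (coeff-⊞ L₁ L₂ a) (≡.cong₂ ℤ._+_
          (coeff-hmul (powL (linL (+ 1) (+ p)) m) (linL (+ 1) (+ 0)) (coeff-hpow (linL (+ 1) (+ p)) (coeff-lin (+ 1) (+ p)) m) (coeff-lin (+ 1) (+ 0)) a)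
          (coeff-hmul (powL (linL s (+ 1)) m) (linL (+ 0) (+ 1)) (coeff-hpow (linL s (+ 1)) (coeff-lin s (+ 1)) m) (coeff-lin (+ 0) (+ 1)) a)))))
        (coeff-map-* (+ q) G a))
      evaluation : ∀ x → q ≤ x → Σ (suc N) (λ a → (κ * toddCoef p q ζ a (N ℕ.∸ a)) * ι x ^ a) ≈ evalℤ L (ι x)
      evaluation x q≤x = begin
        Σ (suc N) (λ a → (κ * toddCoef p q ζ a (N ℕ.∸ a)) * ι x ^ a)
          ≈⟨ Σ-cong (suc N) (λ a → *-assoc _ _ _) ⟩
        Σ (suc N) (λ a → κ * (toddCoef p q ζ a (N ℕ.∸ a) * ι x ^ a))
          ≈⟨ Σ-*ˡ (suc N) κ _ ⟨
        κ * Σ (suc N) (λ a → toddCoef p q ζ a (N ℕ.∸ a) * ι x ^ a)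
          ≈⟨ *-congˡ (toddSum-coeff x N) ⟨
        κ * toddSum x N
          ≈⟨ proj₂ (proj₂ remainder) x q≤x ⟩
        A * (ι x * x+p x ^ m + sx+1 x ^ m) + ι q * proj₁ remainder x
          ≈⟨ +-cong (*-congˡ (trans (evalℤ-⊞ L₁ L₂ (ι x)) (+-cong (eval-L₁ x) (eval-L₂ x))))
                    (*-congˡ (sym (proj₂ (proj₁ (proj₂ remainder)) x q≤x))) ⟨
        A * evalℤ (L₁ ⊞ L₂) (ι x) + ι q * evalℤ G (ι x)
          ≈⟨ +-cong (evalℤ-map-* leading (L₁ ⊞ L₂) (ι x)) (evalℤ-map-* (+ q) G (ι x)) ⟨
        evalℤ (map (leading ℤ.*_) (L₁ ⊞ L₂)) (ι x) + evalℤ (map ((+ q) ℤ.*_) G) (ι x)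
          ≈⟨ evalℤ-⊞ (map (leading ℤ.*_) (L₁ ⊞ L₂)) (map ((+ q) ℤ.*_) G) (ι x) ⟨
        evalℤ L (ι x) ∎

private
  mainCoef-congruence : ∀ {c ℓ : Level} (K : CommutativeRing c ℓ)
    (inv : CommutativeRing.Carrier K → CommutativeRing.Carrier K)
    → IsFieldInverse K inv → CharZero K
    → (k p r : ℕ) → 0 < p → Coprime p (p ℕ.+ r)
    → (ζ : CommutativeRing.Carrier K) → IsPrimitiveRoot K (p ℕ.+ r) ζ
    → (as : List ℕ) → 0 < length as → All (1 ≤_) as
    → ↥ (cf as) ≡ + (p ℕ.+ r) → ↧ₙ (cf as) ≡ p
    → ∀ a → a ≤ suc (suc (k ℕ.+ k))
    → ∃[ m ] CommutativeRing._≈_ K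
         (WithInv.mainCoef K inv p (p ℕ.+ r) ζ as (suc (suc (k ℕ.+ k))) a)
         (intK K (+ (p ℕ.+ r) ℤ.* m))
  mainCoef-congruence K inv isInv char0 k p r 0<p cop ζ prim as len pos q≡ p≡ a a≤N =
    let (g , eq) = Congruence.congruence K inv isInv char0 k (EvenDegree.normaliser K inv isInv char0 k)
                     p r 0<p cop ζ prim _ (cf-inverse as len pos q≡ p≡) a a≤N
    in g , trans (+-congʳ (*-congʳ (ToddSeries.ratK-ℕ K inv isInv char0 (scaling (suc (suc (k ℕ.+ k))))))) eq
    where open CommutativeRing K

theorem5p1 : ∀ {c ℓ : Level} (K : CommutativeRing c ℓ)
    (inv : CommutativeRing.Carrier K → CommutativeRing.Carrier K)
    → IsFieldInverse K inv → CharZero K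
    → (N p q : ℕ) → 0 < N → 2 ∣ N
    → 0 < p → p < q → Coprime p q
    → (ζ : CommutativeRing.Carrier K) → IsPrimitiveRoot K q ζ
    → (as : List ℕ) → 0 < length as → All (1 ≤_) as
    → ↥ (cf as) ≡ + q → ↧ₙ (cf as) ≡ p
    → ∀ a → a ≤ N
    → ∃[ m ] CommutativeRing._≈_ K
    (WithInv.mainCoef K inv p q ζ as N a)
    (intK K (+ q ℤ.* m))
theorem5p1 K inv isInv char0 N p q 0<N 2∣N 0<p p<q
  with even-split N 0<N 2∣N | ℕP.m≤n⇒∃[o]m+o≡n (ℕP.<⇒≤ p<q)
  where
  even-split : ∀ N → 0 < N → 2 ∣ N → ∃[ k ] N ≡ suc (suc (k ℕ.+ k))
  even-split .(zero ℕ.* 2) () (divides zero ≡.refl)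
  even-split .(suc k ℕ.* 2) _ (divides (suc k) ≡.refl) =
    k , ≡.cong (λ n → suc (suc n)) (≡.trans (ℕP.*-comm k 2) (≡.cong (k ℕ.+_) (ℕP.+-identityʳ k)))
... | k , ≡.refl | r , ≡.refl = mainCoef-congruence K inv isInv char0 k p r 0<p
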